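{- A fullerene graph $F$ is 3-resonant if and only if it is $k$-resonant for every integer $k\ge 3$.
   Context: A fullerene graph is a 3-connected plane cubic graph with exactly 12 pentagonal faces and all other faces hexagonal. A set $\mathcal H$ of pairwise vertex-disjoint hexagonal faces of $F$ is a resonant pattern if $F$ has a perfect matching $M$ such that every hexagon in $\mathcal H$ is $M$-alternating (edges alternately in and off $M$), equivalently $F$ minus all vertices of the hexagons of $\mathcal H$ has a perfect matching. $F$ is $k$-resonant if every set of $i$ pairwise disjoint hexagons, for each $0\le i\le k$, is a resonant pattern. -}

module Defs where

open import Data.Nat using (ℕ; zero; suc; _+_; _≤_; _≡ᵇ_; _≤ᵇ_)
open import Data.Bool using (Bool; true; false; if_then_else_; _∧_)
open import Data.Fin using (Fin; toℕ)
open import Data.List using (List; length; allFin; upTo)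
open import Data.List.Relation.Unary.All using (All)
open import Data.List.Relation.Unary.AllPairs using (AllPairs)
open import Data.Product using (Σ; _×_)
open import Data.Sum using (_⊎_)
open import Relation.Binary.PropositionalEquality using (_≡_; _≢_)
open import Relation.Nullary using (¬_)
open import Data.Unit using (⊤)

iter : {A : Set} → (A → A) → ℕ → A → A
iter f zero    x = x
iter f (suc k) x = f (iter f k x)

countFin : (n : ℕ) → (Fin n → Bool) → ℕ
countFin n p = go (allFin n)
  where
  go : List (Fin n) → ℕ
  go List.[] = 0
  go (x List.∷ xs) = (if p x then 1 else 0) + go xs

-- x is the (numerically) least element of its f-orbit
-- (for a permutation of Fin n every orbit is reached within n steps)
isOrbitMin : (n : ℕ) → (Fin n → Fin n) → Fin n → Bool
isOrbitMin n f x = go n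
  where
  go : ℕ → Bool
  go zero    = true
  go (suc k) = (toℕ x ≤ᵇ toℕ (iter f (suc k) x)) ∧ go k

numOrbits : (n : ℕ) → (Fin n → Fin n) → ℕ
numOrbits n f = countFin n (isOrbitMin n f)

period : (n : ℕ) → (Fin n → Fin n) → Fin n → ℕ
period n f x = go 1 n
  where
  go : ℕ → ℕ → ℕ
  go k zero       = 0
  go k (suc fuel) = if toℕ (iter f k x) ≡ᵇ toℕ x then k else go (suc k) fuel

-- Combinatorial maps (rotation systems) of cubic graphs.
-- Darts are Fin d; α sends a dart to the opposite dart of its edge,
-- σ rotates darts around their vertex (vertices = σ-orbits, of size 3),
-- faces = orbits of φ = σ ∘ α.

data Reach {d : ℕ} (σ α : Fin d → Fin d) (ok : Fin d → Set) (x : Fin d)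
     : Fin d → Set where
  here  : Reach σ α ok x x
  stepσ : ∀ {y} → Reach σ α ok x y → Reach σ α ok x (σ y)
  stepα : ∀ {y} → Reach σ α ok x y → ok (α y) → Reach σ α ok x (α y)

record Fullerene : Set where
  field
    d : ℕ
    α : Fin d → Fin d
    σ : Fin d → Fin d
    α-invol : ∀ x → α (α x) ≡ x
    α-nofix : ∀ x → α x ≢ x
    σ-cube  : ∀ x → iter σ 3 x ≡ x
    σ-nofix : ∀ x → σ x ≢ x

  φ : Fin d → Fin d
  φ x = σ (α x)

  SameVertex : Fin d → Fin d → Set
  SameVertex x y = Σ ℕ λ m → iter σ m x ≡ y

  field
    noLoop  : ∀ x → ¬ SameVertex x (α x)
    noMulti : ∀ x y → SameVertex x y → x ≢ y → ¬ SameVertex (α x) (α y)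
    connected : ∀ x y → Reach σ α (λ _ → ⊤) x y
    -- 3-connected: more than 3 vertices, and deleting any ≤ 2 vertices
    -- (those of darts u and v; u, v may coincide) leaves a connected graph
    moreThan3Vertices : 12 ≤ d
    threeConnected : ∀ u v x y →
      ¬ SameVertex u x → ¬ SameVertex v x →
      ¬ SameVertex u y → ¬ SameVertex v y →
      Reach σ α (λ z → ¬ SameVertex u z × ¬ SameVertex v z) x y
    -- plane: Euler's formula V − E + F = 2 for the connected map
    euler : numOrbits d σ + numOrbits d φ ≡ numOrbits d α + 2
    faceSizes : ∀ x → period d φ x ≡ 5 ⊎ period d φ x ≡ 6
    twelvePentagons :
      countFin d (λ x → isOrbitMin d φ x ∧ (period d φ x ≡ᵇ 5)) ≡ 12

module _ (F : Fullerene) where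
  open Fullerene F

  IsHexagon : Fin d → Set
  IsHexagon x = period d φ x ≡ 6

  VertexDisjointFaces : Fin d → Fin d → Set
  VertexDisjointFaces x y = ∀ k l → ¬ SameVertex (iter φ k x) (iter φ l y)

  record PerfectMatching : Set where
    field
      M       : Fin d → Bool
      M-edge  : ∀ x → M (α x) ≡ M x
      M-perf  : ∀ x → (if M x then 1 else 0) + (if M (σ x) then 1 else 0)
                       + (if M (σ (σ x)) then 1 else 0) ≡ 1

  Alternating : PerfectMatching → Fin d → Set
  Alternating PM x = ∀ k → PerfectMatching.M PM (iter φ k x)
                        ≢ PerfectMatching.M PM (iter φ (suc k) x)

  -- a set of pairwise vertex-disjoint hexagons, each given by one of its darts
  DisjointHexagons : List (Fin d) → Set
  DisjointHexagons hs = All IsHexagon hs × AllPairs VertexDisjointFaces hs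

  ResonantPattern : List (Fin d) → Set
  ResonantPattern hs = Σ PerfectMatching λ PM → All (Alternating PM) hs

  Resonant : ℕ → Set
  Resonant k = ∀ hs → length hs ≤ k → DisjointHexagons hs → ResonantPattern hs

{-# OPTIONS --safe #-}

-- Let F be 3-resonant. Two local configurations cannot occur: a vertex each of whose neighbours has a hexagon as its
-- third face (the three hexagons isolate the vertex), and a vertex on three pentagons whose far sides all border
-- hexagons (the three hexagons cut off a claw). Both need the three hexagons to be disjoint, that is, F has no ring
-- of three faces other than around a vertex. Such a ring is a short closed path; pushing it across faces towards the
-- side with fewer outgoing edges shortens it to a contradiction, unless it never meets a pentagon, in which case it
-- sweeps out a tube that is all of F.
--
-- Excluding these configurations bounds F. Developing F face by face from a pentagon, with a case split on each
-- face size, leaves 22 maps up to orientation-preserving isomorphism; the naming of the darts of F thus obtained is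
-- a bijection because F has only 12 pentagons. In some of these maps three disjoint hexagons visibly leave no perfect
-- matching. In the others every set of disjoint hexagons alternates in one of at most four perfect matchings.

module Submission where

open import Defs
open import Data.Nat using (ℕ; zero; suc; _+_; _≤_; _<_; z≤n; s≤s; s≤s⁻¹; _≡ᵇ_; _<ᵇ_; _≤ᵇ_)
open import Data.Nat.Properties using (_≟_; <-cmp; <ᵇ⇒<; ≤ᵇ⇒≤; ≡ᵇ⇒≡; ≡⇒≡ᵇ; ≤-refl; ≤-trans; ≤-antisym; ≤-reflexive; <-irrefl; <⇒≢; n≤1+n; m≤m+n; m≤n+m; m≤n⇒m<n∨m≡n; m≤n⇒∃[o]m+o≡n; +-comm; +-suc; +-identityʳ; +-mono-≤; suc-injective)
open import Data.Nat.Induction using (<-rec)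
open import Data.Bool using (Bool; true; false; if_then_else_; not; _∧_; _∨_; _xor_)
open import Data.Fin using (Fin; toℕ)
open import Data.Fin.Properties using (toℕ-injective; any?)
open import Data.List using (List; []; _∷_; _++_; length; take; map; concatMap; allFin)
open import Data.List.Properties using (length-map; length-++)
open import Data.List.Relation.Unary.All using (All; []; _∷_)
open import Data.List.Relation.Unary.All.Properties using (++⁺; map⁺)
open import Data.List.Relation.Unary.Any using (Any; here; there)
open import Data.List.Relation.Unary.AllPairs using (AllPairs; []; _∷_)
open import Data.List.Relation.Unary.Unique.Propositional using (Unique)
open import Data.List.Relation.Unary.Unique.Propositional.Properties using (allFin⁺)
open import Data.List.Membership.Propositional using (_∈_)
open import Data.List.Membership.Propositional.Properties using (∈-map⁺; ∈-map⁻; ∈-++⁻; ∈-++⁺ˡ; ∈-++⁺ʳ)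
open import Data.List.Membership.DecPropositional _≟_ using (_∈?_)
open import Data.Maybe using (Maybe; just; nothing)
open import Data.Product using (_×_; _,_; proj₁; proj₂; ∃; ∃₂)
open import Data.Sum using (_⊎_; inj₁; inj₂; [_,_]′)
open import Data.Unit using (⊤; tt)
open import Data.Empty using (⊥; ⊥-elim)
open import Relation.Binary.Definitions using (tri<; tri≈; tri>)
open import Relation.Binary.PropositionalEquality
open import Relation.Nullary using (¬_; Dec; yes; no)
open import Relation.Nullary.Decidable using (_×-dec_)
import Data.Bool
import Data.Fin
import Data.List.Relation.Unary.All as All
import Data.List.Relation.Unary.AllPairs as AllPairs
import Data.List.Relation.Unary.Any as Any
import Data.Maybe as Maybe

-- `α` and `σ` let the free product of cyclic groups of orders two and three act on the darts, so up
-- to its base point a closed path is a cyclic sequence of left and right turns. Around a disc with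
-- p pentagons the left turns exceed the right ones by 6 - p. Crossing a hexagon keeps this excess
-- and crossing a pentagon changes it by one; only a balanced path, with six pentagons on either
-- side, can be pushed on forever, and only such paths need the global tube argument. No side of a
-- path is ever formed: a push merely inserts the boundary of one face into a word.
--
-- The obstacle in developing `F` is that one dart may receive several names. A table therefore
-- records only true statements about named darts and never that two names differ. Coincidences
-- surface as contradictions in some branches; uniqueness of names is recovered once, in a completed
-- table.
--
-- Case trees, pushes and matchings are explicit data. Boolean checkers run on them during type
-- checking, and the proofs show that a successful check is conclusive.

firstReturn : (n : ℕ) → (Fin n → Fin n) → Fin n → ℕ → ℕ → ℕ
firstReturn n f x k zero = 0
firstReturn n f x k (suc m) = if toℕ (iter f k x) ≡ᵇ toℕ x then k else firstReturn n f x (suc k) m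

-- The local functions of Defs.period, isOrbitMin and countFin have no name here. Abstracting over their arguments
-- makes the underscore in the second signature of each mutual block solvable by unification.
mutual
  period-firstReturn : ∀ m (f : Fin (suc m) → Fin (suc m)) x →
    period (suc m) f x ≡ firstReturn (suc m) f x 1 (suc m)
  period-firstReturn m f x with suc m | suc (suc zero)
  ... | n | k = cong (if toℕ (f x) ≡ᵇ toℕ x then 1 else_) (go≡firstReturn n f x k m)

  go≡firstReturn : ∀ n (f : Fin n → Fin n) x k m → _ ≡ firstReturn n f x k m
  go≡firstReturn n f x k zero = refl
  go≡firstReturn n f x k (suc m) =
    cong (if toℕ (iter f k x) ≡ᵇ toℕ x then k else_) (go≡firstReturn n f x (suc k) m)

leastUpTo : (n : ℕ) → (Fin n → Fin n) → Fin n → ℕ → Bool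
leastUpTo n f x zero = true
leastUpTo n f x (suc k) = (toℕ x ≤ᵇ toℕ (iter f (suc k) x)) ∧ leastUpTo n f x k

mutual
  isOrbitMin-leastUpTo : ∀ m (f : Fin (suc m) → Fin (suc m)) x →
    isOrbitMin (suc m) f x ≡ leastUpTo (suc m) f x (suc m)
  isOrbitMin-leastUpTo m f x with suc m
  ... | n = cong ((toℕ x ≤ᵇ toℕ (f (iter f m x))) ∧_) (go≡leastUpTo n f x m)

  go≡leastUpTo : ∀ n (f : Fin n → Fin n) x m → _ ≡ leastUpTo n f x m
  go≡leastUpTo n f x zero = refl
  go≡leastUpTo n f x (suc m) = cong ((toℕ x ≤ᵇ toℕ (iter f (suc m) x)) ∧_) (go≡leastUpTo n f x m)

count : {n : ℕ} → (Fin n → Bool) → List (Fin n) → ℕ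
count p [] = 0
count p (x ∷ xs) = (if p x then 1 else 0) + count p xs
mutual
  countFin-count : ∀ n p → countFin n p ≡ count p (allFin n)
  countFin-count n p with allFin n
  ... | xs = go≡count n p xs

  go≡count : ∀ n (p : Fin n → Bool) xs → _ ≡ count p xs
  go≡count n p [] = refl
  go≡count n p (x ∷ xs) = cong ((if p x then 1 else 0) +_) (go≡count n p xs)

∧-elim : ∀ {a b} → a ∧ b ≡ true → a ≡ true × b ≡ true
∧-elim {true} {true} refl = refl , refl

∨-elim : ∀ {a b} → a ∨ b ≡ true → a ≡ true ⊎ b ≡ true
∨-elim {true} _ = inj₁ refl
∨-elim {false} e = inj₂ e

allᵇ : {A : Set} → (A → Bool) → List A → Bool
allᵇ p [] = true
allᵇ p (x ∷ xs) = p x ∧ allᵇ p xs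

allᵇ-sound : {A : Set} (p : A → Bool) (xs : List A) → allᵇ p xs ≡ true → All (λ x → p x ≡ true) xs
allᵇ-sound p [] _ = []
allᵇ-sound p (x ∷ xs) e = proj₁ (∧-elim e) ∷ allᵇ-sound p xs (proj₂ (∧-elim e))

firstReturn-spec : ∀ n (f : Fin n → Fin n) x k m s → firstReturn n f x k m ≡ suc s →
  iter f (suc s) x ≡ x × (∀ j → k ≤ j → j < suc s → iter f j x ≢ x)
firstReturn-spec n f x k (suc m) s e with toℕ (iter f k x) ≡ᵇ toℕ x in eq
... | true rewrite e =
  toℕ-injective (≡ᵇ⇒≡ _ _ (subst Data.Bool.T (sym eq) _)) , λ j k≤j j<k _ → <-irrefl refl (≤-trans j<k k≤j)
... | false with firstReturn-spec n f x (suc k) m s e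
...   | ret , min = ret , λ j k≤j j<s → case-≤ j (m≤n⇒m<n∨m≡n k≤j) j<s
  where
  case-≤ : ∀ j → k < j ⊎ k ≡ j → j < suc s → iter f j x ≢ x
  case-≤ j (inj₁ k<j) j<s = min j k<j j<s
  case-≤ j (inj₂ refl) _ fx with () ← subst Data.Bool.T eq (≡⇒≡ᵇ (toℕ (iter f k x)) (toℕ x) (cong toℕ fx))

period-spec : ∀ n (f : Fin n → Fin n) x s → period n f x ≡ suc s →
  iter f (suc s) x ≡ x × (∀ j → 1 ≤ j → j < suc s → iter f j x ≢ x)
period-spec (suc m) f x s e =
  firstReturn-spec (suc m) f x 1 (suc m) s (trans (sym (period-firstReturn m f x)) e)

-- Closed paths

data Gen : Set where
  a s t : Gen

Word : Set
Word = List Gen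

-- Multiplication by a letter in the free product of cyclic groups of orders two and three, on
-- reduced words; `t` stands for `s` squared.
cons : Gen → Word → Word
cons a (a ∷ w) = w
cons s (s ∷ w) = t ∷ w
cons s (t ∷ w) = w
cons t (s ∷ w) = w
cons t (t ∷ w) = s ∷ w
cons g w = g ∷ w

red : Word → Word
red [] = []
red (g ∷ w) = cons g (red w)

gen⁻¹ : Gen → Gen
gen⁻¹ a = a
gen⁻¹ s = t
gen⁻¹ t = s

inv : Word → Word
inv [] = []
inv (g ∷ w) = inv w ++ gen⁻¹ g ∷ []

rot1 : Word → Word
rot1 [] = []
rot1 (g ∷ w) = red (w ++ g ∷ [])

-- Moving the first letter of a reduced word to its end merges or cancels it with the last one, or
-- keeps the length. In the latter case the word is cyclically reduced and the process stops.
cyc : ℕ → Word → Word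
cyc zero w = w
cyc (suc n) w = if length (rot1 w) <ᵇ length w then cyc n (rot1 w) else w

-- The path letters: true is a left turn (φ = σ ∘ α), false a right turn (σ² ∘ α).
Turns : Set
Turns = List Bool

turn : Bool → Gen
turn true = s
turn false = t

fromTurns : Turns → Word
fromTurns [] = []
fromTurns (b ∷ u) = a ∷ turn b ∷ fromTurns u

toTurns : Word → Maybe Turns
toTurns [] = just []
toTurns (a ∷ s ∷ w) = Maybe.map (true ∷_) (toTurns w)
toTurns (a ∷ t ∷ w) = Maybe.map (false ∷_) (toTurns w)
toTurns _ = nothing

toTurns-sound : ∀ w {u} → toTurns w ≡ just u → w ≡ fromTurns u
toTurns-sound [] refl = refl
toTurns-sound (a ∷ s ∷ w) e with toTurns w in eq
toTurns-sound (a ∷ s ∷ w) refl | just u = cong (λ v → a ∷ s ∷ v) (toTurns-sound w eq)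
toTurns-sound (a ∷ t ∷ w) e with toTurns w in eq
toTurns-sound (a ∷ t ∷ w) refl | just u = cong (λ v → a ∷ t ∷ v) (toTurns-sound w eq)

flip : Turns → Turns
flip [] = []
flip (b ∷ u) = flip u ++ not b ∷ []

rotl : Turns → Turns
rotl [] = []
rotl (b ∷ u) = u ++ b ∷ []

rotations : ℕ → Turns → List Turns
rotations zero u = []
rotations (suc n) u = u ∷ rotations n (rotl u)

precedes : Turns → Turns → Bool
precedes (true ∷ u) (true ∷ v) = precedes u v
precedes (true ∷ u) (false ∷ v) = true
precedes (false ∷ u) (false ∷ v) = precedes u v
precedes _ _ = false

leftmost : Turns → List Turns → Turns
leftmost u [] = u
leftmost u (v ∷ vs) = if precedes v u then leftmost v vs else leftmost u vs

-- The lexicographically first rotation, left before right, begins with a longest run of left turns.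
-- Walking backwards exchanges left and right, so both sides of the path compete.
best : Turns → Turns
best u = leftmost u (rotations (length u) u ++ rotations (length u) (flip u))

shortFace : Turns → Bool
shortFace (true ∷ []) = true
shortFace (true ∷ true ∷ []) = true
shortFace (true ∷ true ∷ true ∷ []) = true
shortFace (true ∷ true ∷ true ∷ true ∷ []) = true
shortFace _ = false

-- A cyclically reduced word of length at least two alternates between `a` and rotations, so
-- bringing `a` to the front turns it into a sequence of turns.
headA : Word → Word
headA (a ∷ w) = a ∷ w
headA w = rot1 w

eqTurns : Turns → Turns → Bool
eqTurns [] [] = true
eqTurns (true ∷ u) (true ∷ v) = eqTurns u v
eqTurns (false ∷ u) (false ∷ v) = eqTurns u v
eqTurns _ _ = false

eqTurns-sound : ∀ u v → eqTurns u v ≡ true → u ≡ v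
eqTurns-sound [] [] _ = refl
eqTurns-sound (true ∷ u) (true ∷ v) e = cong (true ∷_) (eqTurns-sound u v e)
eqTurns-sound (false ∷ u) (false ∷ v) e = cong (false ∷_) (eqTurns-sound u v e)

elemᵇ : Turns → List Turns → Bool
elemᵇ u [] = false
elemᵇ u (v ∷ vs) = eqTurns u v ∨ elemᵇ u vs

elemᵇ-lookup : {P : Turns → Set} → ∀ {vs} u → All P vs → elemᵇ u vs ≡ true → P u
elemᵇ-lookup {P} u (_∷_ {v} {vs} p ps) e with ∨-elim {eqTurns u v} e
... | inj₁ e₁ = subst P (sym (eqTurns-sound u v e₁)) p
... | inj₂ e₂ = elemᵇ-lookup u ps e₂

power : ℕ → Word → Word
power zero w = []
power (suc n) w = w ++ power n w

pushed : ℕ → Turns → Word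
pushed n u = power n (t ∷ a ∷ []) ++ fromTurns u

-- A closed path is pushed across the face along its longest run of left turns: inserting a power of
-- φ⁻¹ replaces the run by the complementary arc, once for each possible face size.
refute : List Turns → ℕ → Word → Bool
refuteTurns : List Turns → ℕ → Turns → Bool
refuteMaybe : List Turns → ℕ → Maybe Turns → Bool
refuteCyclic : List Turns → ℕ → Word → Bool

-- The 40 is fuel for shortening rotations; stopping early could only lose refutations.
refute us n w = refuteCyclic us n (cyc 40 (red w))
-- A path that reduces to nothing closes everywhere and refutes nothing; a single letter would give
-- a fixed point of `α`, `σ` or its square.
refuteCyclic us n [] = false
refuteCyclic us n (g ∷ []) = true
refuteCyclic us n w = refuteMaybe us n (toTurns (headA w))
refuteMaybe us n nothing = false
refuteMaybe us n (just u) = elemᵇ u us ∨ refuteTurns us n (best u)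
refuteTurns us zero u = shortFace u
refuteTurns us (suc n) u =
  shortFace u ∨ (refute us n (pushed 5 u) ∧ refute us n (pushed 6 u))

-- Closed paths with as many left as right turns, each with the hexagons (position of a dart on the path,
-- orientation) across which it is pushed to reach the other end of the edge hanging off its start.
balanced : List (Turns × List (ℕ × Bool))
balanced =
    (l ∷ l ∷ r ∷ r ∷ [] , (0 , true) ∷ [])
  ∷ (l ∷ r ∷ l ∷ r ∷ [] , (0 , true) ∷ [])
  ∷ (l ∷ r ∷ r ∷ l ∷ [] , (5 , false) ∷ [])
  ∷ (r ∷ l ∷ l ∷ r ∷ [] , (4 , true) ∷ [])
  ∷ (r ∷ l ∷ r ∷ l ∷ [] , (1 , false) ∷ [])
  ∷ (r ∷ r ∷ l ∷ l ∷ [] , (1 , false) ∷ [])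
  ∷ (l ∷ l ∷ l ∷ r ∷ r ∷ r ∷ [] , (0 , true) ∷ [])
  ∷ (l ∷ l ∷ r ∷ l ∷ r ∷ r ∷ [] , (0 , true) ∷ [])
  ∷ (l ∷ l ∷ r ∷ r ∷ l ∷ r ∷ [] , (0 , true) ∷ [])
  ∷ (l ∷ l ∷ r ∷ r ∷ r ∷ l ∷ [] , (7 , false) ∷ [])
  ∷ (l ∷ r ∷ l ∷ l ∷ r ∷ r ∷ [] , (0 , true) ∷ (5 , true) ∷ [])
  ∷ (l ∷ r ∷ l ∷ r ∷ l ∷ r ∷ [] , (0 , true) ∷ (5 , true) ∷ (9 , true) ∷ [])
  ∷ (l ∷ r ∷ l ∷ r ∷ r ∷ l ∷ [] , (9 , false) ∷ [])
  ∷ (l ∷ r ∷ r ∷ l ∷ l ∷ r ∷ [] , (8 , true) ∷ [])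
  ∷ (l ∷ r ∷ r ∷ l ∷ r ∷ l ∷ [] , (5 , false) ∷ (9 , false) ∷ [])
  ∷ (l ∷ r ∷ r ∷ r ∷ l ∷ l ∷ [] , (5 , false) ∷ (1 , false) ∷ [])
  ∷ (r ∷ l ∷ l ∷ l ∷ r ∷ r ∷ [] , (4 , true) ∷ (0 , true) ∷ [])
  ∷ (r ∷ l ∷ l ∷ r ∷ l ∷ r ∷ [] , (4 , true) ∷ (8 , true) ∷ [])
  ∷ (r ∷ l ∷ l ∷ r ∷ r ∷ l ∷ [] , (9 , false) ∷ [])
  ∷ (r ∷ l ∷ r ∷ l ∷ l ∷ r ∷ [] , (8 , true) ∷ [])
  ∷ (r ∷ l ∷ r ∷ l ∷ r ∷ l ∷ [] , (1 , false) ∷ (6 , false) ∷ (10 , false) ∷ [])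
  ∷ (r ∷ l ∷ r ∷ r ∷ l ∷ l ∷ [] , (1 , false) ∷ (6 , false) ∷ [])
  ∷ (r ∷ r ∷ l ∷ l ∷ l ∷ r ∷ [] , (6 , true) ∷ [])
  ∷ (r ∷ r ∷ l ∷ l ∷ r ∷ l ∷ [] , (1 , false) ∷ [])
  ∷ (r ∷ r ∷ l ∷ r ∷ l ∷ l ∷ [] , (1 , false) ∷ [])
  ∷ (r ∷ r ∷ r ∷ l ∷ l ∷ l ∷ [] , (1 , false) ∷ []) ∷ []
  where
  l = true
  r = false

-- These are all 6 + 20 balanced sequences of lengths four and six. Pushing them across hexagons
-- alone leaves them balanced, so `refute` makes no headway on them.
balancedTurns : List Turns
balancedTurns = map proj₁ balanced

-- The letters `t`, `a` spell the inverse of `φ`, and `a`, `s` spell `φ`; for a face of size `n`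
-- this is a full tour in either direction.
around : ℕ → Bool → Word
around n b = power n (if b then t ∷ a ∷ [] else a ∷ s ∷ [])

insertFace : ℕ → ℕ → Bool → Word → Word
insertFace n k b w = red (take k w ++ around n b ++ inv (take k w) ++ w)

memberTurns : Maybe Turns → Bool
memberTurns nothing = false
memberTurns (just u) = elemᵇ u balancedTurns

conjugate : Word → Word → Word
conjugate p w = red (inv p ++ w ++ p)

onBalanced : Word → Bool
onBalanced w = memberTurns (toTurns (conjugate [] w)) ∨ memberTurns (toTurns (conjugate (s ∷ []) w))
  ∨ memberTurns (toTurns (conjugate (t ∷ []) w))

-- Each face crossed has to be a hexagon: a tour of a pentagon would unbalance the path, which
-- `refute` can then dispose of.
pushes : List (ℕ × Bool) → Word → Bool
pushes [] w = onBalanced w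
pushes ((k , b) ∷ c) w =
  refute [] 8 (insertFace 5 k b w) ∧ pushes c (insertFace 6 k b w)

-- A pentagon at this corner could be inserted into the path in either direction; it is enough that
-- one of the two unbalanced results is refuted.
cornerHexagonal : Turns → Word → Bool
cornerHexagonal u p = refute [] 8 (p ++ around 5 false ++ inv p ++ fromTurns u)
  ∨ refute [] 8 (p ++ around 5 true ++ inv p ++ fromTurns u)

-- Conjugating by `a` and `p` bases the path at the other end of an edge at its starting vertex.
-- There it must be balanced up to a rotation, at once or after the listed hexagons have been
-- crossed.
pushable : List (ℕ × Bool) → Turns → Word → Bool
pushable c u p = onBalanced w ∨ pushes c w
  where w = red (a ∷ p ++ fromTurns u ++ inv p ++ a ∷ [])

checkBalanced : Turns × List (ℕ × Bool) → Bool
checkBalanced (u , c) = allᵇ (λ p → cornerHexagonal u p ∧ pushable c u p) ([] ∷ (s ∷ []) ∷ (t ∷ []) ∷ [])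

balanced-checked : allᵇ checkBalanced balanced ≡ true
balanced-checked = refl

-- If the faces of σ² α x and σ² α (σ x) share a vertex, k resp. l steps along them, this path through it is closed.
meetingWord : ℕ → ℕ → ℕ → Word
meetingWord k l m = power k (a ∷ s ∷ []) ++ power m (s ∷ []) ++ power l (t ∷ a ∷ []) ++ s ∷ a ∷ t ∷ a ∷ t ∷ []

-- Balanced sequences of length two join the list; as digons they are excluded by the absence of
-- parallel edges rather than by the tube argument.
tubes : List Turns
tubes = (true ∷ false ∷ []) ∷ (false ∷ true ∷ []) ∷ balancedTurns

upTo6 : List ℕ
upTo6 = 0 ∷ 1 ∷ 2 ∷ 3 ∷ 4 ∷ 5 ∷ []

meetings-refuted : allᵇ (λ k → allᵇ (λ l → allᵇ (λ m → refute tubes 8 (meetingWord k l m)) (0 ∷ 1 ∷ 2 ∷ [])) upTo6)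
    upTo6 ≡ true
meetings-refuted = refl

-- Closed paths in a fullerene: soundness of the path calculus

module Geometry (F : Fullerene) where
  open Fullerene F

  Dart : Set
  Dart = Fin d

  Closes : ℕ → Dart → Set
  Closes n x = iter φ n x ≡ x

  pentagon-closes : ∀ {x} → period d φ x ≡ 5 → Closes 5 x
  pentagon-closes {x} e = proj₁ (period-spec d φ x 4 e)

  hexagon-closes : ∀ {x} → period d φ x ≡ 6 → Closes 6 x
  hexagon-closes {x} e = proj₁ (period-spec d φ x 5 e)

  closes-5⊎6 : ∀ x → Closes 5 x ⊎ Closes 6 x
  closes-5⊎6 x with faceSizes x
  ... | inj₁ e = inj₁ (pentagon-closes e)
  ... | inj₂ e = inj₂ (hexagon-closes e)

  no-short-face : ∀ j x → 1 ≤ j → j < 5 → ¬ Closes j x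
  no-short-face j x 1≤j j<5 with faceSizes x
  ... | inj₁ e = proj₂ (period-spec d φ x 4 e) j 1≤j j<5
  ... | inj₂ e = proj₂ (period-spec d φ x 5 e) j 1≤j (≤-trans j<5 (n≤1+n 5))

  -- Consecutive lengths would make `φ` fix `x`.
  ¬closes-5×6 : ∀ {x} → Closes 5 x → ¬ Closes 6 x
  ¬closes-5×6 {x} e₅ e₆ = no-short-face 1 x (s≤s z≤n) (s≤s (s≤s z≤n)) (trans (cong φ (sym e₅)) e₆)

  closes-hexagon : ∀ {x} → Closes 6 x → period d φ x ≡ 6
  closes-hexagon {x} e with faceSizes x
  ... | inj₁ p = ⊥-elim (¬closes-5×6 (pentagon-closes p) e)
  ... | inj₂ p = p

  act : Gen → Dart → Dart
  act a = α
  act s = σ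
  act t = λ x → σ (σ x)

  run : Word → Dart → Dart
  run [] x = x
  run (g ∷ w) x = run w (act g x)

  run-++ : ∀ u v x → run (u ++ v) x ≡ run v (run u x)
  run-++ [] v x = refl
  run-++ (g ∷ u) v x = run-++ u v (act g x)

  run-cons : ∀ g w x → run (cons g w) x ≡ run w (act g x)
  run-cons a [] x = refl
  run-cons a (a ∷ w) x = cong (run w) (sym (α-invol x))
  run-cons a (s ∷ w) x = refl
  run-cons a (t ∷ w) x = refl
  run-cons s [] x = refl
  run-cons s (a ∷ w) x = refl
  run-cons s (s ∷ w) x = refl
  run-cons s (t ∷ w) x = cong (run w) (sym (σ-cube x))
  run-cons t [] x = refl
  run-cons t (a ∷ w) x = refl
  run-cons t (s ∷ w) x = cong (run w) (sym (σ-cube x))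
  run-cons t (t ∷ w) x = cong (run w) (sym (cong σ (σ-cube x)))

  run-red : ∀ w x → run (red w) x ≡ run w x
  run-red [] x = refl
  run-red (g ∷ w) x = trans (run-cons g (red w) x) (run-red w (act g x))

  act-inverse : ∀ g x → act (gen⁻¹ g) (act g x) ≡ x
  act-inverse a x = α-invol x
  act-inverse s x = σ-cube x
  act-inverse t x = σ-cube x

  run-inv : ∀ w x → run (inv w) (run w x) ≡ x
  run-inv [] x = refl
  run-inv (g ∷ w) x = trans (run-++ (inv w) _ _) (trans (cong (act (gen⁻¹ g)) (run-inv w (act g x)))
      (act-inverse g x))

  -- The base point is existential because cyclic reduction and the passage to the best rotation
  -- both move it.
  Loop : Word → Set
  Loop w = ∃ λ x → run w x ≡ x

  red-loop : ∀ w → Loop w → Loop (red w)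
  red-loop w (x , e) = x , trans (run-red w x) e

  rot1-loop : ∀ w → Loop w → Loop (rot1 w)
  rot1-loop [] l = l
  rot1-loop (g ∷ w) (x , e) = red-loop (w ++ g ∷ []) (act g x , trans (run-++ w _ _) (cong (act g) e))

  cyc-loop : ∀ n w → Loop w → Loop (cyc n w)
  cyc-loop zero w l = l
  cyc-loop (suc n) w l with length (rot1 w) <ᵇ length w
  ... | true = cyc-loop n (rot1 w) (rot1-loop w l)
  ... | false = l

  headA-loop : ∀ w → Loop w → Loop (headA w)
  headA-loop [] l = l
  headA-loop (a ∷ w) l = l
  headA-loop (s ∷ w) l = rot1-loop (s ∷ w) l
  headA-loop (t ∷ w) l = rot1-loop (t ∷ w) l

  step : Bool → Dart → Dart
  step b x = act (turn b) (α x)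

  follow : Turns → Dart → Dart
  follow [] x = x
  follow (b ∷ u) x = follow u (step b x)

  run-fromTurns : ∀ u x → run (fromTurns u) x ≡ follow u x
  run-fromTurns [] x = refl
  run-fromTurns (b ∷ u) x = run-fromTurns u (step b x)

  follow-++ : ∀ u v x → follow (u ++ v) x ≡ follow v (follow u x)
  follow-++ [] v x = refl
  follow-++ (b ∷ u) v x = follow-++ u v (step b x)

  step-back : ∀ b x → step (not b) (α (step b x)) ≡ α x
  step-back true x = trans (cong (λ y → σ (σ y)) (α-invol _)) (σ-cube _)
  step-back false x = trans (cong σ (α-invol _)) (σ-cube _)

  follow-flip : ∀ u x → follow (flip u) (α (follow u x)) ≡ α x
  follow-flip [] x = refl
  follow-flip (b ∷ u) x = trans (follow-++ (flip u) _ _)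
    (trans (cong (step (not b)) (follow-flip u (step b x))) (step-back b x))

  TLoop : Turns → Set
  TLoop u = ∃ λ x → follow u x ≡ x

  rotl-loop : ∀ u → TLoop u → TLoop (rotl u)
  rotl-loop [] l = l
  rotl-loop (b ∷ u) (x , e) = step b x , trans (follow-++ u _ _) (cong (step b) e)

  flip-loop : ∀ u → TLoop u → TLoop (flip u)
  flip-loop u (x , e) = α x , trans (cong (λ y → follow (flip u) (α y)) (sym e)) (follow-flip u x)

  rotations-loop : ∀ n u → TLoop u → All TLoop (rotations n u)
  rotations-loop zero u l = []
  rotations-loop (suc n) u l = l ∷ rotations-loop n (rotl u) (rotl-loop u l)

  leftmost-loop : ∀ u vs → TLoop u → All TLoop vs → TLoop (leftmost u vs)
  leftmost-loop u [] l _ = l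
  leftmost-loop u (v ∷ vs) l (m ∷ ls) with precedes v u
  ... | true = leftmost-loop v vs m ls
  ... | false = leftmost-loop u vs l ls

  best-loop : ∀ u → TLoop u → TLoop (best u)
  best-loop u l = leftmost-loop u _ l
    (++⁺ (rotations-loop (length u) u l) (rotations-loop (length u) (flip u) (flip-loop u l)))

  shortFace-sound : ∀ u → shortFace u ≡ true → ¬ TLoop u
  shortFace-sound (true ∷ []) _ (x , e) = no-short-face 1 x (s≤s z≤n) (s≤s (s≤s z≤n)) e
  shortFace-sound (true ∷ true ∷ []) _ (x , e) = no-short-face 2 x (s≤s z≤n) (s≤s (s≤s (s≤s z≤n))) e
  shortFace-sound (true ∷ true ∷ true ∷ []) _ (x , e) =
    no-short-face 3 x (s≤s z≤n) (s≤s (s≤s (s≤s (s≤s z≤n)))) e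
  shortFace-sound (true ∷ true ∷ true ∷ true ∷ []) _ (x , e) =
    no-short-face 4 x (s≤s z≤n) (s≤s (s≤s (s≤s (s≤s (s≤s z≤n))))) e

  letter-no-loop : ∀ g → ¬ Loop (g ∷ [])
  letter-no-loop a (x , e) = α-nofix x e
  letter-no-loop s (x , e) = σ-nofix x e
  letter-no-loop t (x , e) = σ-nofix x (trans (cong σ (sym e)) (σ-cube x))

  iter-φ : ∀ n x → iter φ n (φ x) ≡ φ (iter φ n x)
  iter-φ zero x = refl
  iter-φ (suc n) x = cong φ (iter-φ n x)

  run-forward : ∀ n x → run (power n (a ∷ s ∷ [])) x ≡ iter φ n x
  run-forward zero x = refl
  run-forward (suc n) x = trans (run-forward n (φ x)) (iter-φ n x)

  run-backward : ∀ n x → run (power n (t ∷ a ∷ [])) (iter φ n x) ≡ x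
  run-backward zero x = refl
  run-backward (suc n) x =
    trans (cong (run (power n _)) (trans (cong α (σ-cube _)) (α-invol _))) (run-backward n x)

  run-around : ∀ n b {x} → Closes n x → run (around n b) x ≡ x
  run-around n false {x} e = trans (run-forward n x) e
  run-around n true {x} e = trans (cong (run (power n (t ∷ a ∷ []))) (sym e)) (run-backward n x)

  pushed-loop : ∀ k {x} → Closes k x → ∀ u → follow u x ≡ x → run (pushed k u) x ≡ x
  pushed-loop k {x} c u l = trans (run-++ (power k _) _ x)
    (trans (cong (run (fromTurns u)) (run-around k true c)) (trans (run-fromTurns u x) l))

  -- The calculus serves twice: with an empty list while tubes are being excluded, and afterwards
  -- with the tubes as paths known not to close.
  module Refute (us : List Turns) (no-loops : All (λ u → ¬ TLoop u) us) where
    refute-sound : ∀ n w → refute us n w ≡ true → ¬ Loop w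
    refuteCyclic-sound : ∀ n w → refuteCyclic us n w ≡ true → ¬ Loop w
    refuteMaybe-sound : ∀ n w m → toTurns w ≡ m → refuteMaybe us n m ≡ true → ¬ Loop w
    refuteTurns-sound : ∀ n u → refuteTurns us n u ≡ true → ¬ TLoop u

    refute-sound n w e l = refuteCyclic-sound n (cyc 40 (red w)) e (cyc-loop 40 (red w) (red-loop w l))
    refuteCyclic-sound n (g ∷ []) e = letter-no-loop g
    refuteCyclic-sound n (g ∷ g′ ∷ w) e l =
      refuteMaybe-sound n (headA (g ∷ g′ ∷ w)) _ refl e (headA-loop (g ∷ g′ ∷ w) l)
    refuteMaybe-sound n w (just u) eq e (x , l) with ∨-elim {elemᵇ u us} e
    ... | inj₁ e₁ = elemᵇ-lookup u no-loops e₁ (x , trans (sym (run-fromTurns u x))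
        (subst (λ v → run v x ≡ x) (toTurns-sound w eq) l))
    ... | inj₂ e₂ = refuteTurns-sound n (best u) e₂
      (best-loop u (x , trans (sym (run-fromTurns u x)) (subst (λ v → run v x ≡ x) (toTurns-sound w eq) l)))
    refuteTurns-sound zero u e = shortFace-sound u e
    refuteTurns-sound (suc n) u e (x , l) with ∨-elim {shortFace u} e
    ... | inj₁ e₁ = shortFace-sound u e₁ (x , l)
    -- The path begins with its run of left turns, so the face to push across is the one of `x`.
    ... | inj₂ e₂ with closes-5⊎6 x
    ...   | inj₁ c = refute-sound n (pushed 5 u)
      (proj₁ (∧-elim {refute us n (pushed 5 u)} {refute us n (pushed 6 u)} e₂)) (x , pushed-loop 5 c u l)
    ...   | inj₂ c = refute-sound n (pushed 6 u)
      (proj₂ (∧-elim {refute us n (pushed 5 u)} {refute us n (pushed 6 u)} e₂)) (x , pushed-loop 6 c u l)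

  open Refute [] [] using (refute-sound)

  data Rotation : Word → Set where
    none : Rotation []
    once : Rotation (s ∷ [])
    twice : Rotation (t ∷ [])

  -- The successful check travels with the path, since it supplies both the hexagons at the vertex
  -- of `y` and the way across its edges.
  OnTube : Dart → Set
  OnTube y = ∃₂ λ u c → ∃ λ p → checkBalanced (u , c) ≡ true × Rotation p × run (fromTurns u) (run p y) ≡ run p y

  balanced-checks : All (λ uc → checkBalanced uc ≡ true) balanced
  balanced-checks = allᵇ-sound checkBalanced balanced balanced-checked

  lookup-check : ∀ u → elemᵇ u balancedTurns ≡ true → ∃ λ c → checkBalanced (u , c) ≡ true
  lookup-check u = elemᵇ-lookup {λ u → ∃ λ c → checkBalanced (u , c) ≡ true} u
    (map⁺ {f = proj₁} (All.map (λ {uc} e → proj₂ uc , e) balanced-checks))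

  check-at : ∀ {u c p} → checkBalanced (u , c) ≡ true → Rotation p →
    cornerHexagonal u p ≡ true × pushable c u p ≡ true
  check-at {u} {c} {p} e r = ∧-elim {cornerHexagonal u p} (at r (allᵇ-sound
      (λ p → cornerHexagonal u p ∧ pushable c u p) ([] ∷ (s ∷ []) ∷ (t ∷ []) ∷ []) e))
    where
    at : ∀ {P : Word → Set} {p} → Rotation p → All P ([] ∷ (s ∷ []) ∷ (t ∷ []) ∷ []) → P p
    at none (e ∷ _) = e
    at once (_ ∷ e ∷ _) = e
    at twice (_ ∷ _ ∷ e ∷ _) = e

  insert-loop : ∀ p n b w {z} → Closes n (run p z) → run w z ≡ z →
    run (p ++ around n b ++ inv p ++ w) z ≡ z
  insert-loop p n b w {z} c e =
    trans (run-++ p _ z) (trans (run-++ (around n b) _ _) (trans (cong (run (inv p ++ w)) (run-around n b c))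
      (trans (run-++ (inv p) w _) (trans (cong (run w) (run-inv p z)) e))))

  corner-closes-6 : ∀ u p {z} → cornerHexagonal u p ≡ true → run (fromTurns u) z ≡ z → Closes 6 (run p z)
  corner-closes-6 u p {z} e l with closes-5⊎6 (run p z)
  ... | inj₂ c = c
  ... | inj₁ c with ∨-elim {refute [] 8 (p ++ around 5 false ++ inv p ++ fromTurns u)} e
  ...   | inj₁ r = ⊥-elim (refute-sound 8 (p ++ around 5 false ++ inv p ++ fromTurns u) r
      (z , insert-loop p 5 false (fromTurns u) c l))
  ...   | inj₂ r = ⊥-elim (refute-sound 8 (p ++ around 5 true ++ inv p ++ fromTurns u) r
      (z , insert-loop p 5 true (fromTurns u) c l))

  conjugate-loop : ∀ p w {z} → run w z ≡ z → run (conjugate p w) (run p z) ≡ run p z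
  conjugate-loop p w {z} e = trans (run-red (inv p ++ w ++ p) _) (trans (run-++ (inv p) _ _)
    (trans (cong (run (w ++ p)) (run-inv p z)) (trans (run-++ w p z) (cong (run p) e))))

  memberTurns-tube : ∀ p w {z} → Rotation p → memberTurns (toTurns (conjugate p w)) ≡ true → run w z ≡ z → OnTube z
  memberTurns-tube p w {z} r e l with toTurns (conjugate p w) in eq
  ... | just u with lookup-check u e
  ...   | c , k = u , c , p , k , r ,
    subst (λ v → run v (run p z) ≡ run p z) (toTurns-sound (conjugate p w) eq) (conjugate-loop p w l)

  onBalanced-tube : ∀ w {z} → onBalanced w ≡ true → run w z ≡ z → OnTube z
  onBalanced-tube w e l with ∨-elim {memberTurns (toTurns (conjugate [] w))} e
  ... | inj₁ e₁ = memberTurns-tube [] w none e₁ l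
  ... | inj₂ e₁ with ∨-elim {memberTurns (toTurns (conjugate (s ∷ []) w))} e₁
  ...   | inj₁ e₂ = memberTurns-tube (s ∷ []) w once e₂ l
  ...   | inj₂ e₂ = memberTurns-tube (t ∷ []) w twice e₂ l

  insertFace-loop : ∀ n k b w {z} → Closes n (run (take k w) z) → run w z ≡ z → run (insertFace n k b w) z ≡ z
  insertFace-loop n k b w c l = trans (run-red (take k w ++ around n b ++ inv (take k w) ++ w) _)
      (insert-loop (take k w) n b w c l)

  pushes-tube : ∀ c w {z} → pushes c w ≡ true → run w z ≡ z → OnTube z
  pushes-tube [] w e l = onBalanced-tube w e l
  pushes-tube ((k , b) ∷ c) w {z} e l with closes-5⊎6 (run (take k w) z)
  ... | inj₁ h = ⊥-elim (refute-sound 8 (insertFace 5 k b w) (proj₁ (∧-elim {refute [] 8 (insertFace 5 k b w)} e))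
    (z , insertFace-loop 5 k b w h l))
  ... | inj₂ h = pushes-tube c (insertFace 6 k b w) (proj₂ (∧-elim {refute [] 8 (insertFace 5 k b w)} e))
    (insertFace-loop 6 k b w h l)

  tube-hexagonal : ∀ {y} → OnTube y → Closes 6 y
  -- Seen from the start `run p y` of the path, `y` is the corner `inv p`.
  tube-hexagonal {y} (u , c , p , k , r , l) = subst (Closes 6) (run-inv p y)
    (corner-closes-6 u (inv p) (proj₁ (check-at {u} {c} {inv p} k (inverse r))) l)
    where
    inverse : ∀ {p} → Rotation p → Rotation (inv p)
    inverse none = none
    inverse once = twice
    inverse twice = once

  loop-through : ∀ p w {y} → run w (run p y) ≡ run p y → run (red (a ∷ p ++ w ++ inv p ++ a ∷ [])) (α y) ≡ α y
  loop-through p w {y} l = trans (run-red (a ∷ p ++ w ++ inv p ++ a ∷ []) (α y))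
    (trans (cong (run (p ++ w ++ inv p ++ a ∷ [])) (α-invol y))
    (trans (run-++ p _ y) (trans (run-++ w _ _) (trans (cong (run (inv p ++ a ∷ [])) l)
    (trans (run-++ (inv p) _ _) (cong α (run-inv p y)))))))

  tube-α : ∀ {y} → OnTube y → OnTube (α y)
  tube-α (u , c , p , k , r , l)
    with ∨-elim {onBalanced (red (a ∷ p ++ fromTurns u ++ inv p ++ a ∷ []))} (proj₂ (check-at {u} {c} {p} k r))
  ... | inj₁ e = onBalanced-tube (red (a ∷ p ++ fromTurns u ++ inv p ++ a ∷ [])) e (loop-through p (fromTurns u) l)
  ... | inj₂ e = pushes-tube c (red (a ∷ p ++ fromTurns u ++ inv p ++ a ∷ [])) e (loop-through p (fromTurns u) l)

  tube-σ : ∀ {y} → OnTube y → OnTube (σ y)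
  tube-σ {y} (u , c , _ , k , none , l) = u , c , t ∷ [] , k , twice , subst (λ z → run (fromTurns u) z ≡ z)
      (sym (σ-cube y)) l
  tube-σ {y} (u , c , _ , k , once , l) = u , c , [] , k , none , l
  tube-σ {y} (u , c , _ , k , twice , l) = u , c , s ∷ [] , k , once , l

  -- Such a path would sweep out all of F as a tube of hexagons.
  tube-everywhere : ∀ {x y} → OnTube x → Reach σ α (λ _ → ⊤) x y → OnTube y
  tube-everywhere o here = o
  tube-everywhere o (stepσ r) = tube-σ (tube-everywhere o r)
  tube-everywhere o (stepα r _) = tube-α (tube-everywhere o r)

  count-positive : ∀ {m} (p : Dart → Bool) xs → count p xs ≡ suc m → ∃ λ x → p x ≡ true
  count-positive p (x ∷ xs) e with p x in eq
  ... | true = x , eq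
  ... | false = count-positive p xs e

  pentagon-exists : ∃ λ x → Closes 5 x
  pentagon-exists with count-positive _ (allFin d) (trans (sym (countFin-count d _)) twelvePentagons)
  ... | x , e = x , pentagon-closes (≡ᵇ⇒≡ _ _ (subst Data.Bool.T (sym (proj₂ (∧-elim {isOrbitMin d φ x} e))) _))

  no-tube : ∀ {x} → ¬ OnTube x
  no-tube {x} o with pentagon-exists
  ... | y , c = ¬closes-5×6 c (tube-hexagonal (tube-everywhere o (connected x y)))

  -- A closed left-right path makes the edges of `x` and `σ x` parallel.
  no-digon : ¬ TLoop (true ∷ false ∷ [])
  no-digon (x , e) = noMulti x (σ x) (1 , refl) (λ q → σ-nofix x (sym q))
    (1 , trans (sym (α-invol _)) (cong α (trans (sym (σ-cube _)) (cong σ e))))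

  tubes-no-loop : All (λ u → ¬ TLoop u) tubes
  tubes-no-loop = no-digon ∷ (λ l → no-digon (rotl-loop (false ∷ true ∷ []) l)) ∷
    map⁺ {f = proj₁} (All.map (λ {uc} k → λ { (x , e) → no-tube {x}
        (proj₁ uc , proj₂ uc , [] , k , none , trans (run-fromTurns (proj₁ uc) x) e) }) balanced-checks)

  module Tubes = Refute tubes tubes-no-loop

  iter-reduce : ∀ (f : Dart → Dart) n {x} → iter f (suc n) x ≡ x → ∀ k → ∃ λ j → j < suc n × iter f k x ≡ iter f j x
  iter-reduce f n e zero = 0 , s≤s z≤n , refl
  iter-reduce f n e (suc k) with iter-reduce f n e k
  ... | j , j<n , q with m≤n⇒m<n∨m≡n j<n
  ...   | inj₁ lt = suc j , lt , cong f q
  ...   | inj₂ refl = 0 , s≤s z≤n , trans (cong f q) e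

  -- Of the three faces at the far end of `x`, this dart belongs to the one that does not run along
  -- the edge of `x`.
  radial : Dart → Dart
  radial x = σ (σ (α x))

  meeting-refuted : ∀ k l m → k < 6 → l < 6 → m < 3 → refute tubes 8 (meetingWord k l m) ≡ true
  meeting-refuted k l m k<6 l<6 m<3 =
    at3 {λ m → refuted k l m ≡ true} {m} m<3 (allᵇ-sound (refuted k l) (0 ∷ 1 ∷ 2 ∷ [])
      (at6 {λ l → refuted₁ k l ≡ true} {l} l<6 (allᵇ-sound (refuted₁ k) upTo6
      (at6 {λ k → refuted₂ k ≡ true} {k} k<6 (allᵇ-sound refuted₂ upTo6 meetings-refuted)))))
    where
    refuted : ℕ → ℕ → ℕ → Bool
    refuted k l m = refute tubes 8 (meetingWord k l m)
    refuted₁ : ℕ → ℕ → Bool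
    refuted₁ k l = allᵇ (refuted k l) (0 ∷ 1 ∷ 2 ∷ [])
    refuted₂ : ℕ → Bool
    refuted₂ k = allᵇ (refuted₁ k) upTo6
    at3 : ∀ {P : ℕ → Set} {m} → m < 3 → All P (0 ∷ 1 ∷ 2 ∷ []) → P m
    at3 {m = 0} _ (p ∷ _) = p
    at3 {m = 1} _ (_ ∷ p ∷ _) = p
    at3 {m = 2} _ (_ ∷ _ ∷ p ∷ _) = p
    at3 {m = suc (suc (suc m))} (s≤s (s≤s (s≤s ()))) _
    at6 : ∀ {P : ℕ → Set} {m} → m < 6 → All P upTo6 → P m
    at6 {m = 0} _ (p ∷ _) = p
    at6 {m = 1} _ (_ ∷ p ∷ _) = p
    at6 {m = 2} _ (_ ∷ _ ∷ p ∷ _) = p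
    at6 {m = 3} _ (_ ∷ _ ∷ _ ∷ p ∷ _) = p
    at6 {m = 4} _ (_ ∷ _ ∷ _ ∷ _ ∷ p ∷ _) = p
    at6 {m = 5} _ (_ ∷ _ ∷ _ ∷ _ ∷ _ ∷ p ∷ _) = p
    at6 {m = suc (suc (suc (suc (suc (suc m)))))} (s≤s (s≤s (s≤s (s≤s (s≤s (s≤s ())))))) _

  run-σ : ∀ m x → run (power m (s ∷ [])) x ≡ iter σ m x
  run-σ zero x = refl
  run-σ (suc m) x = trans (run-σ m (σ x)) (shift m x)
    where
    shift : ∀ m x → iter σ m (σ x) ≡ σ (iter σ m x)
    shift zero x = refl
    shift (suc m) x = cong σ (shift m x)

  meeting-loop : ∀ x k l m → iter σ m (iter φ k (radial x)) ≡ iter φ l (radial (σ x)) → Loop (meetingWord k l m)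
  meeting-loop x k l m e = radial x , trans (run-++ (power k (a ∷ s ∷ [])) w₁ _)
      (trans (cong (run w₁) (run-forward k _))
    (trans (run-++ (power m (s ∷ [])) w₂ _) (trans (cong (run w₂) (trans (run-σ m _) e))
    (trans (run-++ (power l (t ∷ a ∷ [])) w₃ _) (trans (cong (run w₃) (run-backward l (radial (σ x)))) back)))))
    where
    -- From `radial (σ x)` back along the edge of `σ x`, around to `x`, and out to `radial x`.
    w₃ = s ∷ a ∷ t ∷ a ∷ t ∷ []
    w₂ = power l (t ∷ a ∷ []) ++ w₃
    w₁ = power m (s ∷ []) ++ w₂
    back : run (s ∷ a ∷ t ∷ a ∷ t ∷ []) (radial (σ x)) ≡ radial x
    back = cong (λ y → σ (σ (α y))) (trans (cong (λ y → σ (σ y)) (trans (cong α (σ-cube (α (σ x)))) (α-invol (σ x))))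
        (σ-cube x))

  -- A common vertex would close a ring consisting of the two hexagons and the face between the
  -- edges of `x` and `σ x`. The periods of `φ` and `σ` leave 6 · 6 · 3 ways to meet, all refuted.
  radials-disjoint : ∀ x → Closes 6 (radial x) → Closes 6 (radial (σ x)) →
    VertexDisjointFaces F (radial x) (radial (σ x))
  radials-disjoint x c₁ c₂ k l (m , e) with iter-reduce φ 5 c₁ k | iter-reduce φ 5 c₂ l
  ... | k′ , k<6 , ek | l′ , l<6 , el with iter-reduce σ 2 (σ-cube (iter φ k (radial x))) m
  ...   | m′ , m<3 , em = Tubes.refute-sound 8 (meetingWord k′ l′ m′) (meeting-refuted k′ l′ m′ k<6 l<6 m<3)
    (meeting-loop x k′ l′ m′ (trans (cong (iter σ m′) (sym ek)) (trans (sym em) (trans e el))))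

iter-+ : {A : Set} (f : A → A) (m n : ℕ) (x : A) → iter f (m + n) x ≡ iter f m (iter f n x)
iter-+ f zero n x = refl
iter-+ f (suc m) n x = cong f (iter-+ f m n x)

bit : Bool → ℕ
bit b = if b then 1 else 0

-- Excluded configurations

module Resonance (F : Fullerene) where
  open Fullerene F
  open Geometry F

  sameVertex-sym : ∀ {x y} → SameVertex x y → SameVertex y x
  -- Together with the `m` rotations already made, `m + m` more give a multiple of three.
  sameVertex-sym {x} (m , refl) = m + m , trans (sym (iter-+ σ (m + m) m x)) (cube m x)
    where
    cube : ∀ m x → iter σ (m + m + m) x ≡ x
    cube zero x = refl
    cube (suc m) x rewrite +-comm m (suc m) | +-comm (m + m) (suc m) | +-comm m (m + m) =
      trans (σ-cube (iter σ (m + m + m) x)) (cube m x)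

  disjoint-sym : ∀ {x y} → VertexDisjointFaces F x y → VertexDisjointFaces F y x
  disjoint-sym D k l v = D l k (sameVertex-sym v)

  disjoint-φˡ : ∀ {x y} → VertexDisjointFaces F x y → VertexDisjointFaces F (φ x) y
  disjoint-φˡ {x} D k l v = D (suc k) l (subst (λ z → SameVertex z _) (iter-φ k x) v)

  disjoint-φʳ : ∀ {x y} → VertexDisjointFaces F x y → VertexDisjointFaces F x (φ y)
  disjoint-φʳ D = disjoint-sym (disjoint-φˡ (disjoint-sym D))

  module _ (PM : PerfectMatching F) where
    open PerfectMatching PM

    -- The hexagon has two edges at the vertex of `r`: that of `r` and that of `σ (σ r)`, which is
    -- opposite to the preceding side. Alternation matches exactly one of them, so the spoke `σ r`
    -- is left out.
    off-hexagon : ∀ {r} → Closes 6 r → Alternating F PM r → M (σ r) ≡ false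
    off-hexagon {r} c alt = cases (M r) (M (σ r)) (M (σ (σ r))) (M-perf r) differ
      where
      incoming : α (iter φ 5 r) ≡ σ (σ r)
      incoming = trans (sym (σ-cube _)) (cong (λ y → σ (σ y)) c)
      differ : M r ≢ M (σ (σ r))
      differ e = alt 5 (trans (sym (M-edge _)) (trans (cong M incoming) (trans (sym e) (cong M (sym c)))))
      cases : ∀ b₀ b₁ b₂ → bit b₀ + bit b₁ + bit b₂ ≡ 1 → b₀ ≢ b₂ → b₁ ≡ false
      cases b₀ false b₂ _ _ = refl
      cases true true true () _
      cases true true false () _
      cases false true true () _
      cases false true false _ ne = ⊥-elim (ne refl)

    -- The edge of `x` is a spoke of this hexagon.
    radial-unmatched : ∀ x → Closes 6 (radial x) → Alternating F PM (radial x) → M x ≡ false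
    radial-unmatched x c alt = trans (sym (M-edge x)) (trans (cong M (sym (σ-cube (α x)))) (off-hexagon c alt))

    matched : ∀ x → M x ≡ false → M (σ x) ≡ false → M (σ (σ x)) ≡ true
    matched x e₀ e₁ with M x | M (σ x) | M (σ (σ x)) | M-perf x
    ... | false | false | true | _ = refl
    matched x () e₁ | true | _ | _ | _
    matched x e₀ () | false | true | _ | _
    matched x e₀ e₁ | false | false | false | ()

  disjoint-triple : ∀ {x y z} → Closes 6 x → Closes 6 y → Closes 6 z →
    VertexDisjointFaces F x y → VertexDisjointFaces F x z → VertexDisjointFaces F y z → DisjointHexagons F
        (x ∷ y ∷ z ∷ [])
  disjoint-triple cx cy cz xy xz yz =
    (closes-hexagon cx ∷ closes-hexagon cy ∷ closes-hexagon cz ∷ []) ,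
    ((xy ∷ xz ∷ []) ∷ (yz ∷ []) ∷ [] ∷ [])

  -- In a pentagon, `φ (φ x)` is the side facing the vertex of `x`; this dart lies across it.
  opposite : Dart → Dart
  opposite x = α (φ (φ x))

  φ-opposite : ∀ x → φ (opposite x) ≡ radial (φ x)
  φ-opposite x = cong σ (α-invol _)

  closes-φ : ∀ n {x} → Closes n x → Closes n (φ x)
  closes-φ n {x} c = trans (iter-φ n x) (cong φ c)

  -- With `φ-opposite` this shows that the faces across the far sides of two adjacent pentagons are
  -- the radial faces along `φ x` and `σ (φ x)`, the two other edges at the far end of `x`. The claw
  -- thus reduces to radial faces at a neighbouring vertex.
  opposite-radial : ∀ x → Closes 5 (σ x) → radial (σ (φ x)) ≡ opposite (σ x)
  opposite-radial x c = trans (cong (λ y → σ (σ (α (σ (σ y))))) (sym αx))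
    (trans (cong (λ y → σ (σ y)) (trans (cong α (σ-cube _)) (α-invol _))) (σ-cube _))
    where
    -- On its pentagon `σ x` is the successor of `α x`.
    αx : iter φ 4 (σ x) ≡ α x
    αx = trans (sym (α-invol _)) (cong α (trans (sym (σ-cube _)) (trans (cong (λ y → σ (σ y)) c) (σ-cube x))))

  opposite-disjoint : ∀ x → Closes 5 (σ x) → Closes 6 (opposite x) → Closes 6 (opposite (σ x)) →
    VertexDisjointFaces F (φ (opposite x)) (φ (opposite (σ x)))
  opposite-disjoint x c c₀ c₁ = disjoint-φʳ (subst₂ (VertexDisjointFaces F) (sym (φ-opposite x)) (opposite-radial x c)
    (radials-disjoint (φ x) (subst (Closes 6) (φ-opposite x) (closes-φ 6 c₀))
        (subst (Closes 6) (sym (opposite-radial x c)) c₁)))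

  alternating-φ : ∀ PM {x} → Alternating F PM x → Alternating F PM (φ x)
  alternating-φ PM {x} alt k e = alt (suc k) (trans (sym (cong M (iter-φ k x))) (trans e (cong M (iter-φ (suc k) x))))
    where open PerfectMatching PM

  alternating-back : ∀ PM {x} → Closes 6 x → Alternating F PM (φ x) → Alternating F PM x
  alternating-back PM {x} c alt k e = alt (5 + k) (trans (eq k) (trans e (sym (eq (suc k)))))
    where
    open PerfectMatching PM
    eq : ∀ k → M (iter φ (5 + k) (φ x)) ≡ M (iter φ k x)
    eq k = cong M (trans (iter-φ (5 + k) x) (trans (sym (iter-+ φ 6 k x))
        (trans (cong (λ n → iter φ n x) (+-comm 6 k))
      (trans (iter-+ φ k 6 x) (cong (iter φ k) c)))))

  -- At the far end of `x` both other edges are spokes of alternating hexagons, so only the edge of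
  -- `x` can be matched.
  opposite-matched : ∀ PM x → Closes 5 (σ x) → Closes 6 (opposite x) → Closes 6 (opposite (σ x)) →
    Alternating F PM (φ (opposite x)) → Alternating F PM (φ (opposite (σ x))) → PerfectMatching.M PM x ≡ true
  opposite-matched PM x c c₀ c₁ a₀ a₁ = trans (sym (M-edge x)) (trans (cong M (sym (σ-cube (α x))))
    (matched PM (φ x) (radial-unmatched PM (φ x) (subst (Closes 6) (φ-opposite x) (closes-φ 6 c₀))
        (subst (Alternating F PM) (φ-opposite x) a₀))
      (radial-unmatched PM (σ (φ x)) (subst (Closes 6) (sym (opposite-radial x c)) c₁)
        (subst (Alternating F PM) (sym (opposite-radial x c)) (alternating-back PM c₁ a₁)))))
    where open PerfectMatching PM

  module _ (resonant : Resonant F 3) where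

    -- Otherwise the three hexagons would isolate the vertex of x.
    radial-pentagon : ∀ x → Closes 6 (radial x) → Closes 6 (radial (σ x)) → ¬ Closes 6 (radial (σ (σ x)))
    radial-pentagon x c₀ c₁ c₂ with resonant (radial x ∷ radial (σ x) ∷ radial (σ (σ x)) ∷ []) (s≤s (s≤s (s≤s z≤n)))
      (disjoint-triple c₀ c₁ c₂ (radials-disjoint x c₀ c₁)
        (disjoint-sym (subst (λ y → VertexDisjointFaces F (radial (σ (σ x))) (radial y)) (σ-cube x)
          (radials-disjoint (σ (σ x)) c₂ (subst (λ y → Closes 6 (radial y)) (sym (σ-cube x)) c₀))))
        (radials-disjoint (σ x) c₁ c₂))
    ... | PM , a₀ ∷ a₁ ∷ a₂ ∷ [] with trans (sym (matched PM x (radial-unmatched PM x c₀ a₀)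
        (radial-unmatched PM (σ x) c₁ a₁)))
                                           (radial-unmatched PM (σ (σ x)) c₂ a₂)
    ...   | ()

    -- Otherwise the three hexagons would cut off the claw at the vertex of x, which has no perfect matching.
    opposite-pentagon : ∀ x → Closes 5 x → Closes 5 (σ x) → Closes 5 (σ (σ x)) →
      Closes 6 (opposite x) → Closes 6 (opposite (σ x)) → ¬ Closes 6 (opposite (σ (σ x)))
    opposite-pentagon x p₀ p₁ p₂ c₀ c₁ c₂ with resonant
        (φ (opposite x) ∷ φ (opposite (σ x)) ∷ φ (opposite (σ (σ x))) ∷ []) (s≤s (s≤s (s≤s z≤n)))
      (disjoint-triple (closes-φ 6 c₀) (closes-φ 6 c₁) (closes-φ 6 c₂) (opposite-disjoint x p₁ c₀ c₁)
        (disjoint-sym (subst (λ y → VertexDisjointFaces F (φ (opposite (σ (σ x)))) (φ (opposite y))) (σ-cube x)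
          (opposite-disjoint (σ (σ x)) (subst (Closes 5) (sym (σ-cube x)) p₀) c₂
              (subst (λ y → Closes 6 (opposite y)) (sym (σ-cube x)) c₀))))
        (opposite-disjoint (σ x) p₂ c₁ c₂))
    -- Both `x` and `σ x` would be matched at a single vertex.
    ... | PM , a₀ ∷ a₁ ∷ a₂ ∷ [] with PerfectMatching.M PM x | PerfectMatching.M PM (σ x) | PerfectMatching.M-perf PM
        x
                                    | opposite-matched PM x p₁ c₀ c₁ a₀ a₁ | opposite-matched PM (σ x) p₂ c₁ c₂ a₁ a₂
    ...   | true | true | () | refl | refl

-- Developing a map face by face

data Corner : Set where
  c0 c1 c2 : Corner

next : Corner → Corner
next c0 = c1
next c1 = c2
next c2 = c0

data Face : Set where
  unknown five six : Face

-- Corner c of vertex v names the dart σᶜ of a base dart of v.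
Ix : Set
Ix = ℕ × Corner

turnσ : Ix → Ix
turnσ (v , c) = v , next c

record Vertex : Set where
  constructor vertex
  field
    l0 l1 l2 : Maybe Ix
    f0 f1 f2 : Face

blank : Vertex
blank = vertex nothing nothing nothing unknown unknown unknown

link : Vertex → Corner → Maybe Ix
link (vertex l0 l1 l2 _ _ _) c0 = l0
link (vertex l0 l1 l2 _ _ _) c1 = l1
link (vertex l0 l1 l2 _ _ _) c2 = l2

face : Vertex → Corner → Face
face (vertex _ _ _ f0 f1 f2) c0 = f0
face (vertex _ _ _ f0 f1 f2) c1 = f1
face (vertex _ _ _ f0 f1 f2) c2 = f2

setLink : Corner → Ix → Vertex → Vertex
setLink c0 j (vertex l0 l1 l2 f0 f1 f2) = vertex (just j) l1 l2 f0 f1 f2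
setLink c1 j (vertex l0 l1 l2 f0 f1 f2) = vertex l0 (just j) l2 f0 f1 f2
setLink c2 j (vertex l0 l1 l2 f0 f1 f2) = vertex l0 l1 (just j) f0 f1 f2

setFace : Corner → Face → Vertex → Vertex
setFace c0 f (vertex l0 l1 l2 f0 f1 f2) = vertex l0 l1 l2 f f1 f2
setFace c1 f (vertex l0 l1 l2 f0 f1 f2) = vertex l0 l1 l2 f0 f f2
setFace c2 f (vertex l0 l1 l2 f0 f1 f2) = vertex l0 l1 l2 f0 f1 f

Table : Set
Table = List Vertex

look : Table → ℕ → Vertex
look [] v = blank
look (x ∷ T) zero = x
look (x ∷ T) (suc v) = look T v

modify : (Vertex → Vertex) → Table → ℕ → Table
modify f [] v = []
modify f (x ∷ T) zero = f x ∷ T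
modify f (x ∷ T) (suc v) = x ∷ modify f T v

grow : Table → Table
grow [] = blank ∷ []
grow (x ∷ T) = x ∷ grow T

linkAt : Table → Ix → Maybe Ix
linkAt T (v , c) = link (look T v) c

faceAt : Table → Ix → Face
faceAt T (v , c) = face (look T v) c

putLink : Ix → Ix → Table → Table
putLink (v , c) j T = modify (setLink c j) T v

putFace : Ix → Face → Table → Table
putFace (v , c) f T = modify (setFace c f) T v

join : Ix → Ix → Table → Table
join i j T = putLink j i (putLink i j T)

-- One step of `φ`. A missing far end becomes a fresh vertex whose corner `c0` points back to the
-- vertex it was reached from; `rooted` relies on this.
advance : Table → Ix → Maybe Ix → Table × Ix
advance T i (just j) = T , turnσ j
advance T i nothing = join i (length T , c0) (grow T) , (length T , c1)

-- The last side is sent by `φ` to `start`, hence by `α` to the inverse rotation of `start`, written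
-- as two turns. A link already present is kept; if it leads elsewhere, `start` has acquired a
-- second name, which `fold` can exploit.
closeUp : Table → Ix → Ix → Maybe Ix → Table
closeUp T start i (just _) = T
closeUp T start i nothing = join i (turnσ (turnσ start)) T

trace : Face → Ix → ℕ → Table × Ix → Table
trace f start zero (T , i) = closeUp (putFace i f T) start i (linkAt T i)
trace f start (suc n) (T , i) = trace f start n (advance (putFace i f T) i (linkAt T i))

size-1 : Face → ℕ
size-1 unknown = 0
size-1 five = 4
size-1 six = 5

addFace : Face → Ix → Table → Table
addFace f i T = trace f i (size-1 f) (T , i)

length-modify : ∀ f T v → length (modify f T v) ≡ length T
length-modify f [] v = refl
length-modify f (x ∷ T) zero = refl
length-modify f (x ∷ T) (suc v) = cong suc (length-modify f T v)

length-grow : ∀ T → length (grow T) ≡ suc (length T)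
length-grow [] = refl
length-grow (x ∷ T) = cong suc (length-grow T)

look-grow : ∀ T v → look (grow T) v ≡ look T v
look-grow [] zero = refl
look-grow [] (suc v) = refl
look-grow (x ∷ T) zero = refl
look-grow (x ∷ T) (suc v) = look-grow T v

look-length : ∀ T → look T (length T) ≡ blank
look-length [] = refl
look-length (x ∷ T) = look-length T

look-modify : ∀ f T v w → (w ≡ v × look (modify f T v) w ≡ f (look T w)) ⊎ look (modify f T v) w ≡ look T w
look-modify f [] v w = inj₂ refl
look-modify f (x ∷ T) zero zero = inj₁ (refl , refl)
look-modify f (x ∷ T) zero (suc w) = inj₂ refl
look-modify f (x ∷ T) (suc v) zero = inj₂ refl
look-modify f (x ∷ T) (suc v) (suc w) with look-modify f T v w
... | inj₁ (refl , e) = inj₁ (refl , e)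
... | inj₂ e = inj₂ e

link-setLink : ∀ c j x e → (e ≡ c × link (setLink c j x) e ≡ just j) ⊎ link (setLink c j x) e ≡ link x e
link-setLink c0 j x c0 = inj₁ (refl , refl)
link-setLink c0 j x c1 = inj₂ refl
link-setLink c0 j x c2 = inj₂ refl
link-setLink c1 j x c0 = inj₂ refl
link-setLink c1 j x c1 = inj₁ (refl , refl)
link-setLink c1 j x c2 = inj₂ refl
link-setLink c2 j x c0 = inj₂ refl
link-setLink c2 j x c1 = inj₂ refl
link-setLink c2 j x c2 = inj₁ (refl , refl)

face-setLink : ∀ c j x e → face (setLink c j x) e ≡ face x e
face-setLink c0 j x c0 = refl
face-setLink c0 j x c1 = refl
face-setLink c0 j x c2 = refl
face-setLink c1 j x c0 = refl
face-setLink c1 j x c1 = refl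
face-setLink c1 j x c2 = refl
face-setLink c2 j x c0 = refl
face-setLink c2 j x c1 = refl
face-setLink c2 j x c2 = refl

link-setFace : ∀ c f x e → link (setFace c f x) e ≡ link x e
link-setFace c0 f x c0 = refl
link-setFace c0 f x c1 = refl
link-setFace c0 f x c2 = refl
link-setFace c1 f x c0 = refl
link-setFace c1 f x c1 = refl
link-setFace c1 f x c2 = refl
link-setFace c2 f x c0 = refl
link-setFace c2 f x c1 = refl
link-setFace c2 f x c2 = refl

face-setFace : ∀ c f x e → (e ≡ c × face (setFace c f x) e ≡ f) ⊎ face (setFace c f x) e ≡ face x e
face-setFace c0 f x c0 = inj₁ (refl , refl)
face-setFace c0 f x c1 = inj₂ refl
face-setFace c0 f x c2 = inj₂ refl
face-setFace c1 f x c0 = inj₂ refl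
face-setFace c1 f x c1 = inj₁ (refl , refl)
face-setFace c1 f x c2 = inj₂ refl
face-setFace c2 f x c0 = inj₂ refl
face-setFace c2 f x c1 = inj₂ refl
face-setFace c2 f x c2 = inj₁ (refl , refl)

linkAt-putLink : ∀ i j T k → (k ≡ i × linkAt (putLink i j T) k ≡ just j) ⊎ linkAt (putLink i j T) k ≡ linkAt T k
linkAt-putLink (v , c) j T (w , e) with look-modify (setLink c j) T v w
... | inj₂ q = inj₂ (cong (λ x → link x e) q)
... | inj₁ (refl , q) with link-setLink c j (look T w) e
...   | inj₁ (refl , r) = inj₁ (refl , trans (cong (λ x → link x e) q) r)
...   | inj₂ r = inj₂ (trans (cong (λ x → link x e) q) r)

faceAt-putLink : ∀ i j T k → faceAt (putLink i j T) k ≡ faceAt T k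
faceAt-putLink (v , c) j T (w , e) with look-modify (setLink c j) T v w
... | inj₂ q = cong (λ x → face x e) q
... | inj₁ (refl , q) = trans (cong (λ x → face x e) q) (face-setLink c j (look T w) e)

linkAt-putFace : ∀ i f T k → linkAt (putFace i f T) k ≡ linkAt T k
linkAt-putFace (v , c) f T (w , e) with look-modify (setFace c f) T v w
... | inj₂ q = cong (λ x → link x e) q
... | inj₁ (refl , q) = trans (cong (λ x → link x e) q) (link-setFace c f (look T w) e)

faceAt-putFace : ∀ i f T k → (k ≡ i × faceAt (putFace i f T) k ≡ f) ⊎ faceAt (putFace i f T) k ≡ faceAt T k
faceAt-putFace (v , c) f T (w , e) with look-modify (setFace c f) T v w
... | inj₂ q = inj₂ (cong (λ x → face x e) q)
... | inj₁ (refl , q) with face-setFace c f (look T w) e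
...   | inj₁ (refl , r) = inj₁ (refl , trans (cong (λ x → face x e) q) r)
...   | inj₂ r = inj₂ (trans (cong (λ x → face x e) q) r)

length-putLink : ∀ i j T → length (putLink i j T) ≡ length T
length-putLink (v , c) j T = length-modify (setLink c j) T v

length-putFace : ∀ i f T → length (putFace i f T) ≡ length T
length-putFace (v , c) f T = length-modify (setFace c f) T v

module Tables (F : Fullerene) where
  open Fullerene F
  open Geometry F

  corner : Corner → Dart → Dart
  corner c0 x = x
  corner c1 x = σ x
  corner c2 x = σ (σ x)

  Naming : Set
  Naming = ℕ → Dart

  ⟦_⟧ : Ix → Naming → Dart
  ⟦ v , c ⟧ h = corner c (h v)

  corner-next : ∀ c x → corner (next c) x ≡ σ (corner c x)
  corner-next c0 x = refl
  corner-next c1 x = refl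
  corner-next c2 x = sym (σ-cube x)

  naming-σ : ∀ i h → ⟦ turnσ i ⟧ h ≡ σ (⟦ i ⟧ h)
  naming-σ (v , c) h = corner-next c (h v)

  FaceIs : Face → Dart → Set
  FaceIs unknown x = ⊤
  FaceIs five x = Closes 5 x
  FaceIs six x = Closes 6 x

  -- The bound keeps link targets inside the table, so that naming a fresh vertex does not change
  -- what they denote.
  LinkIs : ℕ → Naming → Dart → Maybe Ix → Set
  LinkIs n h x nothing = ⊤
  LinkIs n h x (just j) = proj₁ j < n × α x ≡ ⟦ j ⟧ h

  -- Different names may denote one dart, so any true entry may be added or overwrite another. All
  -- indices are included because `look` is blank outside the table.
  record Valid (T : Table) (h : Naming) : Set where
    field
      links : ∀ i → LinkIs (length T) h (⟦ i ⟧ h) (linkAt T i)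
      faces : ∀ i → FaceIs (faceAt T i) (⟦ i ⟧ h)
  open Valid public

  putLink-valid : ∀ {T h} i j → Valid T h → proj₁ j < length T → α (⟦ i ⟧ h) ≡ ⟦ j ⟧ h → Valid (putLink i j T) h
  putLink-valid {T} {h} i j V j<n e .links k rewrite length-putLink i j T with linkAt-putLink i j T k
  ... | inj₁ (refl , q) rewrite q = j<n , e
  ... | inj₂ q rewrite q = links V k
  putLink-valid {T} {h} i j V j<n e .faces k rewrite faceAt-putLink i j T k = faces V k

  putFace-valid : ∀ {T h} i f → Valid T h → FaceIs f (⟦ i ⟧ h) → Valid (putFace i f T) h
  putFace-valid {T} {h} i f V p .links k rewrite length-putFace i f T | linkAt-putFace i f T k = links V k
  putFace-valid {T} {h} i f V p .faces k with faceAt-putFace i f T k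
  ... | inj₁ (refl , q) rewrite q = p
  ... | inj₂ q rewrite q = faces V k

  join-valid : ∀ {T h} i j → Valid T h → proj₁ i < length T → proj₁ j < length T → α (⟦ i ⟧ h) ≡ ⟦ j ⟧ h → Valid
      (join i j T) h
  join-valid {T} {h} i j V i<n j<n e = putLink-valid j i (putLink-valid i j V j<n e)
    (subst (proj₁ i <_) (sym (length-putLink i j T)) i<n) (trans (cong α (sym e)) (α-invol _))

  length-join : ∀ i j T → length (join i j T) ≡ length T
  length-join i j T = trans (length-putLink j i (putLink i j T)) (length-putLink i j T)

  rename : Naming → ℕ → Dart → Naming
  rename h n x v = if v ≡ᵇ n then x else h v

  rename-new : ∀ h n x → rename h n x n ≡ x
  rename-new h n x with n ≡ᵇ n in eq
  ... | true = refl
  ... | false with () ← subst Data.Bool.T eq (≡⇒≡ᵇ n n refl)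

  rename-old : ∀ h n x {v} → v < n → rename h n x v ≡ h v
  rename-old h n x {v} v<n with v ≡ᵇ n in eq
  ... | false = refl
  ... | true = ⊥-elim (<⇒≢ v<n (≡ᵇ⇒≡ v n (subst Data.Bool.T (sym eq) tt)))

  -- Only the name at index `length T` changes, where the table was blank and to which no link
  -- points.
  grow-valid : ∀ {T h} x → Valid T h → Valid (grow T) (rename h (length T) x)
  grow-valid {T} {h} x V .links (v , c) rewrite length-grow T | look-grow T v with v ≡ᵇ length T in eq
  ... | true rewrite ≡ᵇ⇒≡ v (length T) (subst Data.Bool.T (sym eq) tt) | look-length T = blank-link c
    where
    blank-link : ∀ c → LinkIs (suc (length T)) (rename h (length T) x) (corner c x) (link blank c)
    blank-link c0 = tt
    blank-link c1 = tt
    blank-link c2 = tt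
  ... | false with link (look T v) c | links V (v , c)
  ...   | nothing | _ = tt
  ...   | just (w , e) | w<n , q = ≤-trans w<n (n≤1+n _) , trans q
      (cong (corner e) (sym (rename-old h (length T) x w<n)))
  grow-valid {T} {h} x V .faces (v , c) rewrite look-grow T v with v ≡ᵇ length T in eq
  ... | true rewrite ≡ᵇ⇒≡ v (length T) (subst Data.Bool.T (sym eq) tt) | look-length T = blank-face c
    where
    blank-face : ∀ c → FaceIs (face blank c) (corner c x)
    blank-face c0 = tt
    blank-face c1 = tt
    blank-face c2 = tt
  ... | false = faces V (v , c)

  _⊑_ : Table × Naming → Table × Naming → Set
  (T , h) ⊑ (T′ , h′) = length T ≤ length T′ × (∀ {v} → v < length T → h′ v ≡ h v)

  ⊑-name : ∀ {T h T′ h′} → (T , h) ⊑ (T′ , h′) → ∀ i → proj₁ i < length T → ⟦ i ⟧ h′ ≡ ⟦ i ⟧ h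
  ⊑-name (_ , agree) (v , c) v<n = cong (corner c) (agree v<n)

  advance-valid : ∀ {T h} i → Valid T h → proj₁ i < length T →
    let T′ , j = advance T i (linkAt T i) in
    ∃ λ h′ → Valid T′ h′ × (T , h) ⊑ (T′ , h′) × proj₁ j < length T′ × ⟦ j ⟧ h′ ≡ φ (⟦ i ⟧ h)
  advance-valid {T} {h} i V i<n with linkAt T i | links V i
  ... | just j | j<n , e = h , V , (≤-refl , λ _ → refl) , j<n , trans (naming-σ j h) (cong σ (sym e))
  ... | nothing | _ = h′ ,
    join-valid i (n , c0) (grow-valid x V) (subst (proj₁ i <_) (sym (length-grow T)) (≤-trans i<n (n≤1+n n))) n<n′
      (trans (cong α same) (sym (rename-new h n x))) ,
    (subst (n ≤_) (sym len) (n≤1+n n) , λ v<n → rename-old h n x v<n) ,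
    subst (n <_) (sym len) ≤-refl ,
    cong σ (rename-new h n x)
    where
    n = length T
    x = α (⟦ i ⟧ h)
    h′ = rename h n x
    len : length (join i (n , c0) (grow T)) ≡ suc n
    len = trans (length-join i (n , c0) (grow T)) (length-grow T)
    n<n′ : n < length (grow T)
    n<n′ = subst (n <_) (sym (length-grow T)) ≤-refl
    same : ⟦ i ⟧ h′ ≡ ⟦ i ⟧ h
    same = cong (corner (proj₂ i)) (rename-old h n x i<n)

  ⊑-trans : ∀ {A B C} → A ⊑ B → B ⊑ C → A ⊑ C
  ⊑-trans (l , e) (l′ , e′) = ≤-trans l l′ , λ v<n → trans (e′ (≤-trans v<n l)) (e v<n)

  FaceIs-φ : ∀ f {x} → FaceIs f x → FaceIs f (φ x)
  FaceIs-φ unknown _ = tt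
  FaceIs-φ five {x} c = trans (iter-φ 5 x) (cong φ c)
  FaceIs-φ six {x} c = trans (iter-φ 6 x) (cong φ c)

  -- The equation on `iter φ (suc n)` counts the sides still to be traced; at `n = 0` it is the
  -- closing condition that `closeUp` needs.
  trace-valid : ∀ f start n T i h → Valid T h → proj₁ start < length T → proj₁ i < length T →
    FaceIs f (⟦ i ⟧ h) → iter φ (suc n) (⟦ i ⟧ h) ≡ ⟦ start ⟧ h →
    ∃ λ h′ → Valid (trace f start n (T , i)) h′ × (T , h) ⊑ (trace f start n (T , i) , h′)
  trace-valid f start zero T i h V s<n i<n fi e with linkAt T i
  ... | just _ = h , putFace-valid i f V fi , ≤-reflexive (sym (length-putFace i f T)) , λ _ → refl
  ... | nothing = h , join-valid i (turnσ (turnσ start)) (putFace-valid i f V fi)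
      (subst (proj₁ i <_) (sym len) i<n) (subst (proj₁ start <_) (sym len) s<n)
      (trans (sym (σ-cube _)) (trans (cong (λ y → σ (σ y)) e)
          (sym (trans (naming-σ (turnσ start) h) (cong σ (naming-σ start h)))))) ,
    ≤-reflexive (sym (trans (length-join i (turnσ (turnσ start)) (putFace i f T)) len)) , λ _ → refl
    where
    len = length-putFace i f T
  trace-valid f start (suc n) T i h V s<n i<n fi e
    with advance-valid i (putFace-valid i f V fi) (subst (proj₁ i <_) (sym (length-putFace i f T)) i<n)
  ... | h₁ , V₁ , ext , j<n , q rewrite linkAt-putFace i f T i
    with advance (putFace i f T) i (linkAt T i)
  ... | T₁ , j with trace-valid f start n T₁ j h₁ V₁ (≤-trans s<n (proj₁ ext′)) j<n
      (subst (FaceIs f) (sym q) (FaceIs-φ f fi))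
        (trans (cong (iter φ (suc n)) q) (trans (iter-φ (suc n) _)
            (trans e (sym (⊑-name {T} {h} {T₁} {h₁} ext′ start s<n)))))
    where
    ext′ : (T , h) ⊑ (T₁ , h₁)
    ext′ = subst (_≤ length T₁) (length-putFace i f T) (proj₁ ext) , λ v<n → proj₂ ext
        (subst (_ <_) (sym (length-putFace i f T)) v<n)
  ... | h₂ , V₂ , ext₂ = h₂ , V₂ , ⊑-trans {T , h} {T₁ , h₁} {trace f start n (T₁ , j) , h₂}
      (subst (_≤ length T₁) (length-putFace i f T) (proj₁ ext) , λ v<n → proj₂ ext
          (subst (_ <_) (sym (length-putFace i f T)) v<n)) ext₂

  addFace-valid : ∀ f i T h → f ≢ unknown → Valid T h → proj₁ i < length T → FaceIs f (⟦ i ⟧ h) →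
    ∃ λ h′ → Valid (addFace f i T) h′ × (T , h) ⊑ (addFace f i T , h′)
  addFace-valid unknown i T h ne V i<n fi = ⊥-elim (ne refl)
  addFace-valid five i T h ne V i<n fi = trace-valid five i 4 T i h V i<n i<n fi fi
  addFace-valid six i T h ne V i<n fi = trace-valid six i 5 T i h V i<n i<n fi fi

-- Certificates for the case analysis

Pattern : Set
Pattern = List Face

-- Certificates refer to corner `c` of vertex `v` by the number `3v + c`.
dart : ℕ → Ix
dart 0 = 0 , c0
dart 1 = 0 , c1
dart 2 = 0 , c2
dart (suc (suc (suc n))) = suc (proj₁ (dart n)) , proj₂ (dart n)

-- A decision tree on face sizes. At a leaf the developed table contradicts one of the excluded configurations
-- (radials, opposites), the lengths of faces (fixed, short, fold), a neighbour pattern that is absent or required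
-- (pattern-at, mismatch), or it has become a whole map (closed).
data Cert (R : Set) : Set where
  query : ℕ → Cert R → Cert R → Cert R
  radials : ℕ → Cert R
  opposites : ℕ → Cert R
  fixed : ℕ → Cert R
  short : ℕ → ℕ → Cert R
  fold : ℕ → Word → Cert R
  pattern-at : ℕ → ℕ → Cert R
  mismatch : Cert R
  closed : R → Cert R

sameCorner : Corner → Corner → Bool
sameCorner c0 c0 = true
sameCorner c1 c1 = true
sameCorner c2 c2 = true
sameCorner _ _ = false

sameIx : Ix → Ix → Bool
sameIx (v , c) (w , e) = (v ≡ᵇ w) ∧ sameCorner c e

isJust : Maybe Ix → Ix → Bool
isJust nothing i = false
isJust (just j) i = sameIx j i

isFive isSix : Face → Bool
isFive five = true
isFive _ = false
isSix six = true
isSix _ = false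

agrees differs : Face → Face → Bool
agrees five five = true
agrees six six = true
agrees _ _ = false
differs five six = true
differs six five = true
differs _ _ = false

via : {A : Set} → A → (Ix → A) → Maybe Ix → A
via z f nothing = z
via z f (just j) = f j

faceAcross : Table → Ix → (Face → Bool) → Bool
faceAcross T i p = via false (λ j → p (faceAt T j)) (linkAt T i)

radialFace : Table → Ix → (Face → Bool) → Bool
radialFace T i p = via false (λ j → p (faceAt T (turnσ (turnσ j)))) (linkAt T i)

walk : Table → ℕ → Ix → Maybe Ix
walk T zero i = just i
walk T (suc n) i = via nothing (λ j → walk T n (turnσ j)) (linkAt T i)

move : Table → Gen → Ix → Maybe Ix
move T a i = linkAt T i
move T s i = just (turnσ i)
move T t i = just (turnσ (turnσ i))

oppositeFace : Table → Ix → (Face → Bool) → Bool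
oppositeFace T i p = via false (λ j → faceAcross T j p) (walk T 2 i)

distinctTurn : Ix → Ix → Bool
distinctTurn i j = sameIx (turnσ i) j ∨ sameIx (turnσ (turnσ i)) j

-- If both names denoted one dart, then a rotation, `α` or `φ` would have a fixed point, or a face
-- would have both sizes.
inconsistent : Table → Ix → Ix → Bool
inconsistent T i j = distinctTurn i j ∨ isJust (linkAt T i) j ∨ isJust (walk T 1 i) j ∨ isJust (walk T 1 j) i
  ∨ differs (faceAt T i) (faceAt T j)

-- For two names of one dart: walk from both in parallel to a visible contradiction.
foldCheck : Table → Word → Ix → Ix → Bool
foldCheck T [] i j = inconsistent T i j
foldCheck T (g ∷ w) i j = via false (λ i′ → via false (λ j′ → foldCheck T w i′ j′) (move T g j)) (move T g i)

-- One traversal for two tests: with `agrees` and `_∧_` that a pattern certainly occurs, with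
-- `differs` and `_∨_` that it certainly fails. Undetermined faces count for neither.
compare : (Face → Face → Bool) → (Bool → Bool → Bool) → Bool → Table → Ix → Pattern → Bool
compare r _⊕_ z T i [] = z
compare r _⊕_ z T i (f ∷ fs) = via false (λ j → r f (faceAt T j) ⊕ compare r _⊕_ z T (turnσ j) fs) (linkAt T i)

atPattern : ℕ → List Pattern → (Pattern → Bool) → Bool
atPattern n [] f = false
atPattern zero (p ∷ ps) f = f p
atPattern (suc n) (p ∷ ps) f = atPattern n ps f

size : Face → ℕ
size unknown = 0
size five = 5
size six = 6

shortLength : ℕ → Bool
shortLength 1 = true
shortLength 2 = true
shortLength 3 = true
shortLength 4 = true
shortLength _ = false

allCorners : (Corner → Bool) → Bool
allCorners p = p c0 ∧ p c1 ∧ p c2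

module Explore {R : Set} (resolve : R → Table → Bool) (required : Pattern) (forbidden : List Pattern) where

  explore : Table → Cert R → Bool
  explore T (query n c₅ c₆) = (proj₁ (dart n) <ᵇ length T) ∧ explore (addFace five (dart n) T) c₅ ∧ explore
      (addFace six (dart n) T) c₆
  explore T (radials v) = allCorners (λ c → radialFace T (v , c) isSix)
  explore T (opposites v) = allCorners (λ c → isFive (faceAt T (v , c))) ∧ allCorners
      (λ c → oppositeFace T (v , c) isSix)
  explore T (fixed n) = isJust (linkAt T (dart n)) (dart n)
  explore T (short n k) = shortLength k ∧ isJust (walk T k (dart n)) (dart n)
  -- One full tour of the face ends at a possibly different name of the dart it started from.
  explore T (fold n w) = via false (foldCheck T w (dart n)) (walk T (size (faceAt T (dart n))) (dart n))
  explore T (pattern-at k n) = isFive (faceAt T (dart n)) ∧ atPattern k forbidden (compare agrees _∧_ true T (dart n))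
  explore T mismatch = compare differs _∨_ false T (0 , c0) required
  explore T (closed r) = resolve r T

-- Soundness of the certificate checker

module ExploreSound (F : Fullerene) where
  open Fullerene F
  open Geometry F
  open Resonance F
  open Tables F

  Surrounded : Pattern → Dart → Set
  Surrounded [] x = ⊤
  Surrounded (f ∷ fs) x = FaceIs f (α x) × Surrounded fs (φ x)

  Absent : Pattern → Set
  Absent p = ∀ x → Closes 5 x → ¬ Surrounded p x

  sameCorner-sound : ∀ c e → sameCorner c e ≡ true → c ≡ e
  sameCorner-sound c0 c0 _ = refl
  sameCorner-sound c1 c1 _ = refl
  sameCorner-sound c2 c2 _ = refl

  sameIx-sound : ∀ i j → sameIx i j ≡ true → i ≡ j
  sameIx-sound (v , c) (w , e) q with ∧-elim {v ≡ᵇ w} q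
  ... | q₁ , q₂ = cong₂ _,_ (≡ᵇ⇒≡ v w (subst Data.Bool.T (sym q₁) tt)) (sameCorner-sound c e q₂)

  isJust-sound : ∀ m i → isJust m i ≡ true → m ≡ just i
  isJust-sound (just j) i q = cong just (sameIx-sound j i q)

  via-sound : ∀ (f : Ix → Bool) m → via false f m ≡ true → ∃ λ j → m ≡ just j × f j ≡ true
  via-sound f (just j) q = j , refl , q

  isFive-sound : ∀ f {x} → FaceIs f x → isFive f ≡ true → Closes 5 x
  isFive-sound five c _ = c

  isSix-sound : ∀ f {x} → FaceIs f x → isSix f ≡ true → Closes 6 x
  isSix-sound six c _ = c

  allCorners-sound : ∀ p → allCorners p ≡ true → ∀ c → p c ≡ true
  allCorners-sound p e c with ∧-elim {p c0} e
  ... | e₀ , e′ with ∧-elim {p c1} e′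
  allCorners-sound p e c0 | e₀ , e′ | e₁ , e₂ = e₀
  allCorners-sound p e c1 | e₀ , e′ | e₁ , e₂ = e₁
  allCorners-sound p e c2 | e₀ , e′ | e₁ , e₂ = e₂

  differs-sound : ∀ f g {x} → FaceIs f x → FaceIs g x → differs f g ≢ true
  differs-sound five six p q _ = ¬closes-5×6 p q
  differs-sound six five p q _ = ¬closes-5×6 q p

  agrees-sound : ∀ f g {x} → FaceIs g x → agrees f g ≡ true → FaceIs f x
  agrees-sound five five p _ = p
  agrees-sound six six p _ = p

  module _ {T : Table} {h : Naming} (V : Valid T h) where

    link-sound : ∀ i {j} → linkAt T i ≡ just j → α (⟦ i ⟧ h) ≡ ⟦ j ⟧ h
    link-sound i e with linkAt T i | links V i
    link-sound i refl | just j | _ , q = q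

    φ-sound : ∀ i {j} → linkAt T i ≡ just j → ⟦ turnσ j ⟧ h ≡ φ (⟦ i ⟧ h)
    φ-sound i {j} e = trans (naming-σ j h) (cong σ (sym (link-sound i e)))

    walk-sound : ∀ n i {j} → walk T n i ≡ just j → ⟦ j ⟧ h ≡ iter φ n (⟦ i ⟧ h)
    walk-sound zero i refl = refl
    walk-sound (suc n) i e with linkAt T i in eq
    ... | just k = trans (walk-sound n (turnσ k) e) (trans (cong (iter φ n) (φ-sound i eq)) (iter-φ n _))

    σσ-sound : ∀ i → ⟦ turnσ (turnσ i) ⟧ h ≡ σ (σ (⟦ i ⟧ h))
    σσ-sound i = trans (naming-σ (turnσ i) h) (cong σ (naming-σ i h))

    radialFace-sound : ∀ i → radialFace T i isSix ≡ true → Closes 6 (radial (⟦ i ⟧ h))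
    radialFace-sound i e with via-sound (λ j → isSix (faceAt T (turnσ (turnσ j)))) (linkAt T i) e
    ... | j , q , r = subst (Closes 6) (trans (σσ-sound j) (cong (λ y → σ (σ y)) (sym (link-sound i q))))
      (isSix-sound (faceAt T (turnσ (turnσ j))) (faces V (turnσ (turnσ j))) r)

    oppositeFace-sound : ∀ i → oppositeFace T i isSix ≡ true → Closes 6 (opposite (⟦ i ⟧ h))
    oppositeFace-sound i e with via-sound (λ j → faceAcross T j isSix) (walk T 2 i) e
    ... | j , q , r with via-sound (λ k → isSix (faceAt T k)) (linkAt T j) r
    ...   | k , q′ , r′ = subst (Closes 6) (trans (sym (link-sound j q′)) (cong α (walk-sound 2 i q)))
      (isSix-sound (faceAt T k) (faces V k) r′)

    move-sound : ∀ g i {j} → move T g i ≡ just j → ⟦ j ⟧ h ≡ act g (⟦ i ⟧ h)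
    move-sound a i e = sym (link-sound i e)
    move-sound s i refl = naming-σ i h
    move-sound t i refl = σσ-sound i

    σ-distinct : ∀ i j → distinctTurn i j ≡ true → ⟦ i ⟧ h ≢ ⟦ j ⟧ h
    σ-distinct i j e q with ∨-elim {sameIx (turnσ i) j} e
    ... | inj₁ e₁ = σ-nofix _ (trans (sym (naming-σ i h))
        (trans (cong (λ k → ⟦ k ⟧ h) (sameIx-sound (turnσ i) j e₁)) (sym q)))
    ... | inj₂ e₂ = σ-nofix (⟦ i ⟧ h) (trans (cong σ (trans q
        (trans (cong (λ k → ⟦ k ⟧ h) (sym (sameIx-sound (turnσ (turnσ i)) j e₂))) (σσ-sound i)))) (σ-cube _))

    inconsistent-sound : ∀ i j → inconsistent T i j ≡ true → ⟦ i ⟧ h ≢ ⟦ j ⟧ h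
    inconsistent-sound i j e q with ∨-elim {distinctTurn i j} e
    ... | inj₁ e₁ = σ-distinct i j e₁ q
    ... | inj₂ e₁ with ∨-elim {isJust (linkAt T i) j} e₁
    ...   | inj₁ e₂ = α-nofix _ (trans (link-sound i (isJust-sound (linkAt T i) j e₂)) (sym q))
    ...   | inj₂ e₂ with ∨-elim {isJust (walk T 1 i) j} e₂
    ...     | inj₁ e₃ = no-short-face 1 _ (s≤s z≤n) (s≤s (s≤s z≤n))
        (trans (sym (walk-sound 1 i (isJust-sound (walk T 1 i) j e₃))) (sym q))
    ...     | inj₂ e₃ with ∨-elim {isJust (walk T 1 j) i} e₃
    ...       | inj₁ e₄ = no-short-face 1 _ (s≤s z≤n) (s≤s (s≤s z≤n))
        (trans (sym (walk-sound 1 j (isJust-sound (walk T 1 j) i e₄))) q)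
    ...       | inj₂ e₄ = differs-sound (faceAt T i) (faceAt T j) (faces V i)
        (subst (FaceIs (faceAt T j)) (sym q) (faces V j)) e₄

    foldCheck-sound : ∀ w i j → foldCheck T w i j ≡ true → ⟦ i ⟧ h ≢ ⟦ j ⟧ h
    foldCheck-sound [] i j e q = inconsistent-sound i j e q
    foldCheck-sound (g ∷ w) i j e q with via-sound (λ i′ → via false (λ j′ → foldCheck T w i′ j′) (move T g j))
        (move T g i) e
    ... | i′ , mi , e′ with via-sound (λ j′ → foldCheck T w i′ j′) (move T g j) e′
    ...   | j′ , mj , e″ = foldCheck-sound w i′ j′ e″ (trans (move-sound g i mi)
        (trans (cong (act g) q) (sym (move-sound g j mj))))

    face-closes : ∀ i → Closes (size (faceAt T i)) (⟦ i ⟧ h)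
    face-closes i with faceAt T i | faces V i
    ... | unknown | _ = refl
    ... | five | c = c
    ... | six | c = c

    matches-sound : ∀ i p → compare agrees _∧_ true T i p ≡ true → Surrounded p (⟦ i ⟧ h)
    matches-sound i [] e = tt
    matches-sound i (f ∷ p) e with via-sound (λ j → agrees f (faceAt T j) ∧ compare agrees _∧_ true T (turnσ j) p)
        (linkAt T i) e
    ... | j , q , r with ∧-elim {agrees f (faceAt T j)} r
    ...   | r₁ , r₂ = subst (FaceIs f) (sym (link-sound i q)) (agrees-sound f (faceAt T j) (faces V j) r₁) ,
      subst (Surrounded p) (φ-sound i q) (matches-sound (turnσ j) p r₂)

    clash-sound : ∀ i p → Surrounded p (⟦ i ⟧ h) → compare differs _∨_ false T i p ≢ true
    clash-sound i (f ∷ p) (m , ms) e with via-sound (λ j → differs f (faceAt T j) ∨ compare differs _∨_ false T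
        (turnσ j) p) (linkAt T i) e
    ... | j , q , r with ∨-elim {differs f (faceAt T j)} r
    ...   | inj₁ r₁ = differs-sound f (faceAt T j) (subst (FaceIs f) (link-sound i q) m) (faces V j) r₁
    ...   | inj₂ r₂ = clash-sound (turnσ j) p (subst (Surrounded p) (sym (φ-sound i q)) ms) r₂

    shortLength-sound : ∀ k x → shortLength k ≡ true → ¬ Closes k x
    shortLength-sound 1 x _ = no-short-face 1 x (s≤s z≤n) (s≤s (s≤s z≤n))
    shortLength-sound 2 x _ = no-short-face 2 x (s≤s z≤n) (s≤s (s≤s (s≤s z≤n)))
    shortLength-sound 3 x _ = no-short-face 3 x (s≤s z≤n) (s≤s (s≤s (s≤s (s≤s z≤n))))
    shortLength-sound 4 x _ = no-short-face 4 x (s≤s z≤n) (s≤s (s≤s (s≤s (s≤s (s≤s z≤n)))))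

  module _ (resonant : Resonant F 3) {R : Set} (resolve : R → Table → Bool) {Goal : Set}
    (resolve-sound : ∀ r {T h} → Valid T h → resolve r T ≡ true → Goal)
    (required : Pattern) (forbidden : List Pattern)
    (absent : All Absent forbidden)
    where
    open Explore resolve required forbidden

    explore-sound : ∀ c {T h} → Valid T h → Surrounded required (⟦ 0 , c0 ⟧ h) → 0 < length T → explore T c ≡ true →
        Goal
    explore-sound (query n c₅ c₆) {T} {h} V req 0<n e =
      [ (λ c → let h′ , V′ , ext = addFace-valid five (dart n) T h (λ ()) V i<n c in
          explore-sound c₅ {addFace five (dart n) T} {h′} V′ (req′ {T′ = addFace five (dart n) T} ext)
              (≤-trans 0<n (proj₁ ext)) (proj₁ split)) ,
        (λ c → let h′ , V′ , ext = addFace-valid six (dart n) T h (λ ()) V i<n c in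
          explore-sound c₆ {addFace six (dart n) T} {h′} V′ (req′ {T′ = addFace six (dart n) T} ext)
              (≤-trans 0<n (proj₁ ext)) (proj₂ split)) ]′
      (closes-5⊎6 (⟦ dart n ⟧ h))
      where
      i<n = <ᵇ⇒< (proj₁ (dart n)) (length T) (subst Data.Bool.T (sym (proj₁ (∧-elim {proj₁ (dart n) <ᵇ length T} e)))
          tt)
      split = ∧-elim {explore (addFace five (dart n) T) c₅} {explore (addFace six (dart n) T) c₆}
        (proj₂ (∧-elim {proj₁ (dart n) <ᵇ length T} e))
      -- The root keeps its dart when the naming is extended, so the required pattern passes to both
      -- branches.
      req′ : ∀ {T′ h′} → (T , h) ⊑ (T′ , h′) → Surrounded required (⟦ 0 , c0 ⟧ h′)
      req′ {T′} {h′} ext = subst (Surrounded required) (sym (⊑-name {T} {h} {T′} {h′} ext (0 , c0) 0<n)) req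
    explore-sound (radials v) {T} {h} V req 0<n e = ⊥-elim (radial-pentagon resonant (h v) (at c0) (at c1) (at c2))
      where
      at : ∀ c → Closes 6 (radial (corner c (h v)))
      at c = radialFace-sound V (v , c) (allCorners-sound (λ c → radialFace T (v , c) isSix) e c)
    explore-sound (opposites v) {T} {h} V req 0<n e with ∧-elim {allCorners (λ c → isFive (faceAt T (v , c)))} e
    ... | e₅ , e₆ = ⊥-elim (opposite-pentagon resonant (h v) (at₅ c0) (at₅ c1) (at₅ c2) (at₆ c0) (at₆ c1) (at₆ c2))
      where
      at₅ : ∀ c → Closes 5 (corner c (h v))
      at₅ c = isFive-sound (faceAt T (v , c)) (faces V (v , c))
          (allCorners-sound (λ c → isFive (faceAt T (v , c))) e₅ c)
      at₆ : ∀ c → Closes 6 (opposite (corner c (h v)))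
      at₆ c = oppositeFace-sound V (v , c) (allCorners-sound (λ c → oppositeFace T (v , c) isSix) e₆ c)
    explore-sound (fixed n) {T} V req 0<n e = ⊥-elim (α-nofix _
        (link-sound V (dart n) (isJust-sound (linkAt T (dart n)) (dart n) e)))
    explore-sound (short n k) {T} V req 0<n e with ∧-elim {shortLength k} e
    ... | e₁ , e₂ = ⊥-elim (shortLength-sound V k _ e₁ (sym
        (walk-sound V k (dart n) (isJust-sound (walk T k (dart n)) (dart n) e₂))))
    explore-sound (fold n w) {T} V req 0<n e with via-sound (foldCheck T w (dart n))
        (walk T (size (faceAt T (dart n))) (dart n)) e
    ... | j , q , r = ⊥-elim (foldCheck-sound V w (dart n) j r
      (trans (sym (face-closes V (dart n))) (sym (walk-sound V (size (faceAt T (dart n))) (dart n) q))))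
    explore-sound (pattern-at k n) {T} V req 0<n e with ∧-elim {isFive (faceAt T (dart n))} e
    ... | e₁ , e₂ = ⊥-elim (missing k forbidden absent e₂)
      where
      missing : ∀ k ps → All Absent ps → atPattern k ps (compare agrees _∧_ true T (dart n)) ≢ true
      missing zero (p ∷ ps) (ab ∷ _) e = ab _ (isFive-sound (faceAt T (dart n)) (faces V (dart n)) e₁)
          (matches-sound V (dart n) p e)
      missing (suc k) (p ∷ ps) (_ ∷ abs) e = missing k ps abs e
    explore-sound mismatch V req 0<n e = ⊥-elim (clash-sound V (0 , c0) required req e)
    explore-sound (closed r) V req 0<n e = resolve-sound r V e
 

-- Closed tables

allBelow : ℕ → (ℕ → Bool) → Bool
allBelow zero p = true
allBelow (suc n) p = p n ∧ allBelow n p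

allBelow-sound : ∀ n p → allBelow n p ≡ true → ∀ v → v < n → p v ≡ true
allBelow-sound (suc n) p e v v<n with ∧-elim {p n} e | m≤n⇒m<n∨m≡n (s≤s⁻¹ v<n)
... | _ , e′ | inj₁ lt = allBelow-sound n p e′ v lt
... | e₀ , _ | inj₂ refl = e₀

anyIx : (Ix → Bool) → List Ix → Bool
anyIx p [] = false
anyIx p (i ∷ is) = p i ∨ anyIx p is

anyIx-sound : ∀ p is → anyIx p is ≡ true → ∃ λ i → i ∈ is × p i ≡ true
anyIx-sound p (i ∷ is) e with ∨-elim {p i} e
... | inj₁ e₁ = i , here refl , e₁
... | inj₂ e₂ with anyIx-sound p is e₂
...   | j , m , q = j , there m , q

orbit : Table → ℕ → Ix → List Ix
orbit T zero i = []
orbit T (suc n) i = i ∷ via [] (λ j → orbit T n (turnσ j)) (linkAt T i)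

known : Face → Bool
known unknown = false
known _ = true

allInside : Table → (Ix → Bool) → Bool
allInside T p = allBelow (length T) (λ v → allCorners (λ c → p (v , c)))

completeAt : Table → Ix → Bool
completeAt T i = known (faceAt T i) ∧ via false (λ j → (proj₁ j <ᵇ length T) ∧ isJust (linkAt T j) i) (linkAt T i)

complete : Table → Bool
complete T = allInside T (completeAt T)

-- Corner `c0` leads to a vertex of smaller index, typically the one from which `v` was created.
-- This gives a spanning tree along which uniqueness of names spreads from vertex 0.
rootedAt : Table → ℕ → Bool
rootedAt T v = (v ≡ᵇ 0) ∨ via false (λ j → proj₁ j <ᵇ v) (linkAt T (v , c0))

rooted : Table → Bool
rooted T = allBelow (length T) (rootedAt T)

inFaces : (Face → Bool) → List Ix → Table → Ix → Bool
inFaces p is T i = not (p (faceAt T i)) ∨ anyIx (sameIx i) is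

facesFrom : (Face → Bool) → ℕ → List ℕ → Table → Bool
facesFrom p n rs T = allInside T (inFaces p (concatMap (λ r → orbit T n (dart r)) rs) T)

-- The pigeonhole principle for a relation: no later entry can use the partner of the first, so that
-- partner may be removed from `ys`.
matched-length : {A B : Set} (R : A → B → Set) {xs : List A} {ys : List B} →
  AllPairs (λ x x′ → ∀ y → R x y → ¬ R x′ y) xs → All (λ x → Any (R x) ys) xs → length xs ≤ length ys
matched-length R [] [] = z≤n
matched-length {A} {B} R {x ∷ xs} {ys} (d ∷ ds) (p ∷ ps) =
  subst (suc (length xs) ≤_) (length-remove p) (s≤s (matched-length R ds (keep d ps)))
  where
  remove : ∀ {ys} → Any (R x) ys → List B
  remove {y ∷ ys} (here _) = ys
  remove {y ∷ ys} (there p) = y ∷ remove p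
  length-remove : ∀ {ys} (p : Any (R x) ys) → suc (length (remove p)) ≡ length ys
  length-remove (here _) = refl
  length-remove (there p) = cong suc (length-remove p)
  avoid : ∀ {x′ ys} (p : Any (R x) ys) → (∀ y → R x y → ¬ R x′ y) → Any (R x′) ys → Any (R x′) (remove p)
  avoid (here r) d (here r′) = ⊥-elim (d _ r r′)
  avoid (here r) d (there q) = q
  avoid (there p) d (here r′) = here r′
  avoid (there p) d (there q) = there (avoid p d q)
  keep : ∀ {xs} → All (λ x′ → ∀ y → R x y → ¬ R x′ y) xs → All (λ x → Any (R x) ys) xs → All
      (λ x → Any (R x) (remove p)) xs
  keep [] [] = []
  keep (d ∷ ds) (q ∷ qs) = avoid p d q ∷ keep ds qs

-- Two positions of a list either coincide, or the second is redundant once its entry entails the first.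
same-or-redundant : {A : Set} {P Q : A → Set} {xs : List A} → Any P xs → Any Q xs →
  (∃ λ r → P r × Q r) ⊎
  (∃₂ λ r r′ → P r × Q r′ × ∃ λ ys → suc (length ys) ≡ length xs ×
    ((S : A → Set) → (S r′ → S r) → Any S xs → Any S ys))
same-or-redundant (here p) (here q) = inj₁ (_ , p , q)
same-or-redundant {A} {P} {Q} {x ∷ xs} (here p) (there q) = inj₂
    (x , entry q , p , holds q , x ∷ without q , cong suc (shorter q) ,
  λ { S i (here e) → here e ; S i (there e) → [ (λ e′ → here (i e′)) , there ]′ (drop S q e) })
  where
  entry : ∀ {xs} → Any Q xs → A
  entry (here {x} _) = x
  entry (there q) = entry q
  holds : ∀ {xs} (q : Any Q xs) → Q (entry q)
  holds (here q) = q
  holds (there q) = holds q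
  without : ∀ {xs} → Any Q xs → List A
  without {_ ∷ xs} (here _) = xs
  without {x ∷ _} (there q) = x ∷ without q
  shorter : ∀ {xs} (q : Any Q xs) → suc (length (without q)) ≡ length xs
  shorter (here _) = refl
  shorter (there q) = cong suc (shorter q)
  drop : ∀ (S : A → Set) {xs} (q : Any Q xs) → Any S xs → S (entry q) ⊎ Any S (without q)
  drop S (here _) (here e) = inj₁ e
  drop S (here _) (there e) = inj₂ e
  drop S (there q) (here e) = inj₂ (here e)
  drop S (there q) (there e) = [ inj₁ , (λ e′ → inj₂ (there e′)) ]′ (drop S q e)
same-or-redundant {A} {P} {Q} {x ∷ xs} (there p) (here q) = inj₂ (entry p , x , holds p , q , xs , refl ,
  λ { S i (here e) → replace S p (i e) ; S i (there e) → e })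
  where
  entry : ∀ {xs} → Any P xs → A
  entry (here {x} _) = x
  entry (there p) = entry p
  holds : ∀ {xs} (p : Any P xs) → P (entry p)
  holds (here p) = p
  holds (there p) = holds p
  replace : ∀ (S : A → Set) {xs} (p : Any P xs) → S (entry p) → Any S xs
  replace S (here _) e = here e
  replace S (there p) e = there (replace S p e)
same-or-redundant {xs = x ∷ xs} (there p) (there q) with same-or-redundant p q
... | inj₁ same = inj₁ same
... | inj₂ (r , r′ , pr , qr , ys , len , f) = inj₂ (r , r′ , pr , qr , x ∷ ys , cong suc len ,
  λ { S i (here e) → here e ; S i (there e) → there (f S i e) })

select : {n : ℕ} → (Fin n → Bool) → List (Fin n) → List (Fin n)
select p [] = []
select p (x ∷ xs) = if p x then x ∷ select p xs else select p xs

length-select : ∀ {n} (p : Fin n → Bool) xs → length (select p xs) ≡ count p xs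
length-select p [] = refl
length-select p (x ∷ xs) with p x
... | true = cong suc (length-select p xs)
... | false = length-select p xs

select-all : ∀ {n} (p : Fin n → Bool) xs → All (λ x → p x ≡ true) (select p xs)
select-all p [] = []
select-all p (x ∷ xs) with p x in eq
... | true = eq ∷ select-all p xs
... | false = select-all p xs

select-⊆ : ∀ {n} {Q : Fin n → Set} (p : Fin n → Bool) xs → All Q xs → All Q (select p xs)
select-⊆ p [] [] = []
select-⊆ p (x ∷ xs) (q ∷ qs) with p x
... | true = q ∷ select-⊆ p xs qs
... | false = select-⊆ p xs qs

select-unique : ∀ {n} (p : Fin n → Bool) xs → Unique xs → Unique (select p xs)
select-unique p [] [] = []
select-unique p (x ∷ xs) (u ∷ us) with p x
... | true = select-⊆ p xs u ∷ select-unique p xs us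
... | false = select-unique p xs us

leastUpTo-sound : ∀ n f x k → leastUpTo n f x k ≡ true → ∀ j → j < k → toℕ x ≤ toℕ (iter f (suc j) x)
leastUpTo-sound n f x (suc k) e j j<k with ∧-elim {toℕ x ≤ᵇ toℕ (iter f (suc k) x)} e | m≤n⇒m<n∨m≡n (s≤s⁻¹ j<k)
... | _ , e′ | inj₁ lt = leastUpTo-sound n f x k e′ j lt
... | e₀ , _ | inj₂ refl = ≤ᵇ⇒≤ _ _ (subst Data.Bool.T (sym e₀) tt)

isOrbitMin-sound : ∀ n f x → isOrbitMin n f x ≡ true → ∀ j → j < n → toℕ x ≤ toℕ (iter f (suc j) x)
isOrbitMin-sound (suc n) f x e j j<n =
  leastUpTo-sound (suc n) f x (suc n) (trans (sym (isOrbitMin-leastUpTo n f x)) e) j j<n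

module ClosedTable (F : Fullerene) (T : Table) (h : ℕ → Fin (Fullerene.d F)) where
  open Fullerene F
  open Geometry F
  open Resonance F
  open Tables F
  open ExploreSound F

  allInside-sound : ∀ p → allInside T p ≡ true → ∀ i → proj₁ i < length T → p i ≡ true
  allInside-sound p e (v , c) v<n = allCorners-sound (λ c → p (v , c))
    (allBelow-sound (length T) (λ v → allCorners (λ c → p (v , c))) e v v<n) c

  -- One dart of each pentagon of `F`, from the very selection that `twelvePentagons` counts.
  pentagonMinima : List Dart
  pentagonMinima = select (λ x → isOrbitMin d φ x ∧ (period d φ x ≡ᵇ 5)) (allFin d)

  length-pentagonMinima : length pentagonMinima ≡ 12
  length-pentagonMinima = trans (length-select _ (allFin d)) (trans (sym (countFin-count d _)) twelvePentagons)

  InFace : Dart → Dart → Set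
  InFace x r = ∃ λ k → iter φ k r ≡ x

  back-to : ∀ n {r x} → Closes (suc n) r → ∀ k → k < suc n → iter φ k r ≡ x → ∃ λ j → j < suc n × iter φ (suc j) x ≡ r
  back-to n {r} c k k<n refl with m≤n⇒∃[o]m+o≡n (s≤s⁻¹ k<n)
  ... | j , refl = j , s≤s (m≤n+m j k) ,
    trans (sym (iter-+ φ (suc j) k _)) (trans (cong (λ m → iter φ (suc m) r) (+-comm j k)) c)

  minima-equal : ∀ {x y r} → Closes 5 r → isOrbitMin d φ x ≡ true → isOrbitMin d φ y ≡ true →
    InFace x r → InFace y r → x ≡ y
  minima-equal {x} {y} {r} c mx my (k , ex) (l , ey) = toℕ-injective
      (≤-antisym (below mx k l ex ey) (below my l k ey ex))
    where
    below : ∀ {x y} → isOrbitMin d φ x ≡ true → ∀ k l → iter φ k r ≡ x → iter φ l r ≡ y → toℕ x ≤ toℕ y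
    below {x} {y} m k l ex ey with iter-reduce φ 4 c k | iter-reduce φ 4 c l
    ... | k′ , k<5 , ek | l′ , l<5 , el with back-to 4 c k′ k<5 (trans (sym ek) ex)
    ...   | j , j<5 , eq = subst (λ z → toℕ x ≤ toℕ z) reach
        -- `isOrbitMin` compares with the first `d` iterates only. At most nine are needed here, and
        -- `d` is at least twelve.
        (isOrbitMin-sound d φ x m (l′ + j) (≤-trans (s≤s (+-mono-≤ (s≤s⁻¹ l<5) (s≤s⁻¹ j<5)))
            (≤-trans (m≤m+n 9 3) moreThan3Vertices)))
      where
      reach : iter φ (suc (l′ + j)) x ≡ y
      reach = trans (cong (λ n → iter φ n x) (sym (+-suc l′ j)))
        (trans (iter-+ φ l′ (suc j) x) (trans (cong (iter φ l′) eq) (trans (sym el) ey)))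

  minima-distinct : AllPairs (λ x y → ∀ r → Closes 5 r × InFace x r → ¬ (Closes 5 r × InFace y r)) pentagonMinima
  minima-distinct = distinct pentagonMinima (select-all _ (allFin d)) (select-unique _ (allFin d) (allFin⁺ d))
    where
    distinct : ∀ xs → All (λ x → isOrbitMin d φ x ∧ (period d φ x ≡ᵇ 5) ≡ true) xs → Unique xs →
      AllPairs (λ x y → ∀ r → Closes 5 r × InFace x r → ¬ (Closes 5 r × InFace y r)) xs
    distinct [] [] [] = []
    distinct (x ∷ xs) (m ∷ ms) (u ∷ us) = All.zipWith (λ { (n , x≢y) r (c , i) (_ , j) →
      x≢y (minima-equal c (proj₁ (∧-elim {isOrbitMin d φ x} m)) (proj₁ (∧-elim n)) i j) }) (ms , u) ∷ distinct xs ms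
          us

  minima-pentagons : All (Closes 5) pentagonMinima
  minima-pentagons = All.map (λ {x} e → pentagon-closes
      (≡ᵇ⇒≡ _ _ (subst Data.Bool.T (sym (proj₂ (∧-elim {isOrbitMin d φ x} e))) tt)))
    (select-all _ (allFin d))

  module _ (V : Valid T h) (comp : complete T ≡ true) (root : rooted T ≡ true) (nonempty : 0 < length T) where

    n : ℕ
    n = length T

    Inside : Ix → Set
    Inside i = proj₁ i < n

    linked : ∀ i → Inside i → ∃ λ j → linkAt T i ≡ just j × Inside j × linkAt T j ≡ just i
    linked i i<n with via-sound (λ j → (proj₁ j <ᵇ length T) ∧ isJust (linkAt T j) i) (linkAt T i)
        (proj₂ (∧-elim {known (faceAt T i)} (allInside-sound (completeAt T) comp i i<n)))
    ... | j , q , r with ∧-elim {proj₁ j <ᵇ n} r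
    ...   | r₁ , r₂ = j , q , <ᵇ⇒< (proj₁ j) n (subst Data.Bool.T (sym r₁) tt) , isJust-sound (linkAt T j) i r₂

    face-known : ∀ i → Inside i → known (faceAt T i) ≡ true
    face-known i i<n = proj₁ (∧-elim {known (faceAt T i)} (allInside-sound (completeAt T) comp i i<n))

    Named : Dart → Set
    Named y = ∃ λ i → Inside i × ⟦ i ⟧ h ≡ y

    named-σ : ∀ {y} → Named y → Named (σ y)
    named-σ (i , i<n , e) = turnσ i , i<n , trans (naming-σ i h) (cong σ e)

    named-α : ∀ {y} → Named y → Named (α y)
    named-α (i , i<n , e) with linked i i<n
    ... | j , q , j<n , _ = j , j<n , trans (sym (link-sound V i q)) (cong α e)

    named-reach : ∀ {y} → Reach σ α (λ _ → ⊤) (h 0) y → Named y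
    named-reach here = (0 , c0) , nonempty , refl
    named-reach (stepσ r) = named-σ (named-reach r)
    named-reach (stepα r _) = named-α (named-reach r)

    named : ∀ y → Named y
    named y = named-reach (connected (h 0) y)

    Determined : Ix → Set
    Determined i = ∀ j → Inside j → ⟦ i ⟧ h ≡ ⟦ j ⟧ h → i ≡ j

    turnσ³ : ∀ i → turnσ (turnσ (turnσ i)) ≡ i
    turnσ³ (v , c0) = refl
    turnσ³ (v , c1) = refl
    turnσ³ (v , c2) = refl

    determined-σ : ∀ i → Determined i → Determined (turnσ i)
    determined-σ i D j j<n e = trans (cong turnσ (D (turnσ (turnσ j)) j<n
      (trans (sym (σ-cube _)) (trans (cong (λ y → σ (σ y)) (trans (sym (naming-σ i h)) e)) (sym (σσ-sound V j))))))
          (turnσ³ j)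

    -- Links of a complete table are symmetric, so a second name of the far dart would lead back to
    -- a second name of the near one.
    determined-α : ∀ i {j} → linkAt T i ≡ just j → Determined i → Determined j
    determined-α i {j} q D k k<n e with linked k k<n
    ... | k′ , q′ , k′<n , r with D k′ k′<n (trans (sym (α-invol _))
        (trans (cong α (trans (link-sound V i q) e)) (link-sound V k q′)))
    ...   | refl = just-inj (trans (sym q) r)
      where
      just-inj : ∀ {j k : Ix} → just j ≡ just k → j ≡ k
      just-inj refl = refl

    determined-corner : ∀ v c e → Determined (v , c) → Determined (v , e)
    determined-corner v c0 c0 D = D
    determined-corner v c0 c1 D = determined-σ _ D
    determined-corner v c0 c2 D = determined-σ _ (determined-σ _ D)
    determined-corner v c1 c0 D = determined-σ _ (determined-σ _ D)
    determined-corner v c1 c1 D = D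
    determined-corner v c1 c2 D = determined-σ _ D
    determined-corner v c2 c0 D = determined-σ _ D
    determined-corner v c2 c1 D = determined-σ _ (determined-σ _ D)
    determined-corner v c2 c2 D = D

    determined-all : Determined (0 , c0) → ∀ i → Inside i → Determined i
    determined-all D₀ (v , c) = <-rec (λ v → ∀ c → v < n → Determined (v , c)) descend v c
      where
      descend : ∀ v → (∀ {w} → w < v → ∀ c → w < n → Determined (w , c)) → ∀ c → v < n → Determined (v , c)
      descend v ih c v<n with ∨-elim {v ≡ᵇ 0} (allBelow-sound n (rootedAt T) root v v<n)
      ... | inj₁ e with ≡ᵇ⇒≡ v 0 (subst Data.Bool.T (sym e) tt)
      ...   | refl = determined-corner 0 c0 c D₀
      descend v ih c v<n | inj₂ e with via-sound (λ j → proj₁ j <ᵇ v) (linkAt T (v , c0)) e | linked (v , c0) v<n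
      ... | j , q , r | j′ , q′ , j′<n , back with trans (sym q) q′
      ...   | refl = determined-corner v c0 c (determined-α j back
        (ih (<ᵇ⇒< (proj₁ j) v (subst Data.Bool.T (sym r) tt)) (proj₂ j) j′<n))

    orbit-sound : ∀ m i {j} → j ∈ orbit T m i → ∃ λ k → k < m × walk T k i ≡ just j
    orbit-sound (suc m) i (here refl) = 0 , s≤s z≤n , refl
    orbit-sound (suc m) i (there p) with linkAt T i in eq
    ... | just j with orbit-sound m (turnσ j) p
    ...   | k , k<m , w = suc k , s≤s k<m , trans (cong (via nothing (λ j → walk T k (turnσ j))) eq) w

    concat-sound : ∀ m rs {j} → j ∈ concatMap (λ r → orbit T m (dart r)) rs →
      Any (λ r → ∃ λ k → k < m × walk T k (dart r) ≡ just j) rs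
    concat-sound m (r ∷ rs) p with ∈-++⁻ (orbit T m (dart r)) p
    ... | inj₁ q = here (orbit-sound m (dart r) q)
    ... | inj₂ q = there (concat-sound m rs q)

    faces-sound : ∀ p m rs → facesFrom p m rs T ≡ true → ∀ i → Inside i → p (faceAt T i) ≡ true →
      Any (λ r → ∃ λ k → k < m × walk T k (dart r) ≡ just i) rs
    faces-sound p m rs e i i<n pf
      with ∨-elim {not (p (faceAt T i))} (allInside-sound (inFaces p (concatMap (λ r → orbit T m (dart r)) rs) T) e i
          i<n)
    ... | inj₁ q with () ← trans (sym (cong not pf)) q
    ... | inj₂ q with anyIx-sound (sameIx i) (concatMap (λ r → orbit T m (dart r)) rs) q
    ...   | j , m∈ , r with sameIx-sound i j r
    ...     | refl = concat-sound m rs m∈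

    closes-5-back : ∀ k {x} → Closes 5 (iter φ k x) → Closes 5 x
    closes-5-back k {x} c with closes-5⊎6 x
    ... | inj₁ c₅ = c₅
    ... | inj₂ c₆ = ⊥-elim (¬closes-5×6 c (forward k))
      where
      forward : ∀ k → Closes 6 (iter φ k x)
      forward zero = c₆
      forward (suc k) = FaceIs-φ six (forward k)

    five-face : ∀ i → Inside i → Closes 5 (⟦ i ⟧ h) → isFive (faceAt T i) ≡ true
    five-face i i<n c with faceAt T i | faces V i | face-known i i<n
    ... | five | _ | _ = refl
    ... | six | c₆ | _ = ⊥-elim (¬closes-5×6 c c₆)

    six-face : ∀ i → Inside i → Closes 6 (⟦ i ⟧ h) → isSix (faceAt T i) ≡ true
    six-face i i<n c with faceAt T i | faces V i | face-known i i<n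
    ... | six | _ | _ = refl
    ... | five | c₅ | _ = ⊥-elim (¬closes-5×6 c₅ c)

    later-step : ∀ {x} k l → k < l → l < 5 → iter φ k x ≢ iter φ l x
    later-step {x} k l k<l l<5 e with m≤n⇒∃[o]m+o≡n k<l
    ... | o , refl = no-short-face (suc o) (iter φ k x) (s≤s z≤n) (≤-trans (s≤s (s≤s (m≤n+m o k))) l<5)
      (trans (sym (iter-+ φ (suc o) k x)) (trans (cong (λ m → iter φ (suc m) x) (+-comm o k)) (sym e)))

    same-step : ∀ {x} k l → k < 5 → l < 5 → iter φ k x ≡ iter φ l x → k ≡ l
    same-step {x} k l k<5 l<5 e with <-cmp k l
    ... | tri≈ _ k≡l _ = k≡l
    ... | tri< k<l _ _ = ⊥-elim (later-step k l k<l l<5 e)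
    ... | tri> _ _ l<k = ⊥-elim (later-step l k l<k k<5 (sym e))

    module _ (rs : List ℕ) (twelve : length rs ≡ 12) (pents : facesFrom isFive 5 rs T ≡ true) where

      Meets : Dart → ℕ → Set
      Meets x r = Closes 5 (⟦ dart r ⟧ h) × InFace x (⟦ dart r ⟧ h)

      Reaches : Ix → ℕ → Set
      Reaches i r = ∃ λ k → k < 5 × walk T k (dart r) ≡ just i

      reaches : ∀ i → Inside i → Closes 5 (⟦ i ⟧ h) → Any (Reaches i) rs
      reaches i i<n c = faces-sound isFive 5 rs pents i i<n (five-face i i<n c)

      reaches-meets : ∀ i {r} → Closes 5 (⟦ i ⟧ h) → Reaches i r → Meets (⟦ i ⟧ h) r
      reaches-meets i {r} c (k , _ , w) =
        closes-5-back k (subst (Closes 5) (walk-sound V k (dart r) w) c) , k , sym (walk-sound V k (dart r) w)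

      minima-met : All (λ x → Any (Meets x) rs) pentagonMinima
      minima-met = All.map met minima-pentagons
        where
        met : ∀ {x} → Closes 5 x → Any (Meets x) rs
        met {x} c with named x
        ... | i , i<n , refl = Any.map (reaches-meets i c) (reaches i i<n c)

      -- Two names reached from the same entry of `rs` agree, since otherwise a face would close too
      -- early. If they came from different entries, both would mark one pentagon of `F`, and eleven
      -- entries would account for all twelve pentagons.
      pentagon-determined : ∀ i → Inside i → Closes 5 (⟦ i ⟧ h) → Determined i
      pentagon-determined i i<n c j j<n e with same-or-redundant (reaches i i<n c)
          (reaches j j<n (subst (Closes 5) e c))
      ... | inj₁ (r , (k , k<5 , wk) , (l , l<5 , wl))
        with same-step {⟦ dart r ⟧ h} k l k<5 l<5
               (trans (sym (walk-sound V k (dart r) wk)) (trans e (walk-sound V l (dart r) wl)))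
      ...   | refl with trans (sym wk) wl
      ...     | refl = refl
      pentagon-determined i i<n c j j<n e | inj₂ (r , r′ , ri , rj , ys , len , f) =
        ⊥-elim (<-irrefl refl (subst (_≤ length ys) (trans length-pentagonMinima (sym (trans len twelve)))
          (matched-length Meets (AllPairs.map (λ d r → d (⟦ dart r ⟧ h)) minima-distinct)
            (All.map (λ {x} → f (Meets x) transfer) minima-met))))
        where
        -- From `r` to the shared dart, on around the pentagon to `r′`, and from there to `x`.
        transfer : ∀ {x} → Meets x r′ → Meets x r
        transfer {x} (c′ , k , ek) with reaches-meets i c ri | reaches-meets j (subst (Closes 5) e c) rj
        ... | cr , p , ea | _ , q , eb with iter-reduce φ 4 c′ q
        ...   | q′ , q<5 , qe with back-to 4 c′ q′ q<5 (trans (sym qe) (trans eb (sym e)))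
        ...     | o , _ , eo = cr , k + (suc o + p) , trans (iter-+ φ k (suc o + p) _) (trans (cong (iter φ k)
          (trans (iter-+ φ (suc o) p _) (trans (cong (iter φ (suc o)) ea) eo))) ek)

      injective : isFive (faceAt T (0 , c0)) ≡ true → ∀ i j → Inside i → Inside j → ⟦ i ⟧ h ≡ ⟦ j ⟧ h → i ≡ j
      injective five₀ i j i<n j<n = determined-all
        (pentagon-determined (0 , c0) nonempty (isFive-sound (faceAt T (0 , c0)) (faces V (0 , c0)) five₀)) i i<n j
            j<n

-- The first list has a dart of each pentagon of a closed table. In a resonant map the others are
-- a dart of each hexagon and perfect matchings (the matched corner of each vertex); otherwise they are disjoint
-- hexagons that form no resonant pattern, and vertices on whose matched edge to split to see this.
data Resolution : Set where
  resonant : List ℕ → List ℕ → List (List Corner) → Resolution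
  obstructed : List ℕ → List ℕ → List ℕ → Resolution

-- Uniqueness of names starts at the root dart, which therefore has to lie on a pentagon, and rests
-- on exactly twelve entries marking all pentagons.
isMap : List ℕ → Table → Bool
isMap ps T = complete T ∧ rooted T ∧ (0 <ᵇ length T) ∧ isFive (faceAt T (0 , c0)) ∧ (length ps ≡ᵇ 12) ∧ facesFrom
    isFive 5 ps T

cornerOf : List Corner → ℕ → Corner
cornerOf [] v = c0
cornerOf (c ∷ M) zero = c
cornerOf (c ∷ M) (suc v) = cornerOf M v

isMatched : List Corner → Ix → Bool
isMatched M (v , c) = sameCorner (cornerOf M v) c

-- Choosing one corner at each vertex covers it exactly once; what remains to test is that the two
-- ends of every edge agree.
isMatching : Table → List Corner → Bool
isMatching T M = allInside T (λ i → via false (λ j → not (isMatched M i xor isMatched M j)) (linkAt T i))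

alternates : Table → List Corner → ℕ → Ix → Bool
alternates T M zero i = true
alternates T M (suc n) i = via false (λ j → (isMatched M i xor isMatched M (turnσ j)) ∧ alternates T M n (turnσ j))
    (linkAt T i)

bitAt : List Bool → ℕ → Bool
bitAt [] i = false
bitAt (b ∷ bs) zero = b
bitAt (b ∷ bs) (suc i) = bitAt bs i

clear : ℕ → List Bool → List Bool
clear i [] = []
clear zero (b ∷ bs) = false ∷ bs
clear (suc i) (b ∷ bs) = b ∷ clear i bs

minus : List Bool → List Bool → List Bool
minus [] cs = []
minus (b ∷ bs) [] = b ∷ bs
minus (b ∷ bs) (c ∷ cs) = (b ∧ not c) ∷ minus bs cs

within : List Bool → List Bool → Bool
within [] cs = true
within (true ∷ bs) [] = false
within (true ∷ bs) (c ∷ cs) = c ∧ within bs cs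
within (false ∷ bs) [] = within bs []
within (false ∷ bs) (c ∷ cs) = within bs cs

withinAny : List Bool → List (List Bool) → Bool
withinAny bs [] = false
withinAny bs (cs ∷ css) = within bs cs ∨ withinAny bs css

-- Every independent set contained in bs, for the conflicts listed row by row from index j on, is within one of css.
covers : List (List Bool) → List (List Bool) → ℕ → List Bool → Bool
covers css [] j bs = withinAny bs css
covers css (row ∷ rows) j bs = withinAny bs css ∨
  (covers css rows (suc j) (clear j bs) ∧ (not (bitAt bs j) ∨ covers css rows (suc j) (minus bs row)))

common : List Ix → List Ix → Bool
common is js = anyIx (λ i → anyIx (λ j → proj₁ i ≡ᵇ proj₁ j) js) is

boundary : Table → ℕ → List Ix
boundary T r = orbit T 6 (dart r)

-- The diagonal is left out, because `covers` removes everything in conflict with a chosen hexagon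
-- and must not remove that hexagon itself.
conflict : Table → ℕ → ℕ → Bool
conflict T r r′ = not (r ≡ᵇ r′) ∧ common (boundary T r) (boundary T r′)

insideᵇ : Table → ℕ → Bool
insideᵇ T r = proj₁ (dart r) <ᵇ length T

-- A lone hexagon is an independent set, so where only one matching is given it has to alternate on
-- every hexagon.
isResonant : List ℕ → List (List Corner) → Table → Bool
isResonant hs Ms T = facesFrom isSix 6 hs T ∧ allᵇ (insideᵇ T) hs ∧ allᵇ (isMatching T) Ms ∧
  covers (map (λ M → map (λ r → alternates T M 6 (dart r)) hs) Ms) (map (λ r → map (conflict T r) hs) hs) 0
      (map (λ _ → true) hs)

disjointBoundaries : Table → List ℕ → Bool
disjointBoundaries T [] = true
disjointBoundaries T (r ∷ rs) = allᵇ (λ r′ → not (common (boundary T r) (boundary T r′))) rs ∧ disjointBoundaries T rs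

clashes : List Ix → List Ix → Ix → Bool
clashes offs used i = anyIx (sameIx i) offs ∨ anyIx
    (λ k → (proj₁ k ≡ᵇ proj₁ i) ∧ not (sameCorner (proj₂ k) (proj₂ i))) used

unmatchable : Table → List Ix → List ℕ → List Ix → Bool
unmatchable T offs [] used = false
unmatchable T offs (v ∷ vs) used = allCorners λ c → via false (λ j →
  clashes offs used (v , c) ∨ clashes offs used j ∨ unmatchable T offs vs ((v , c) ∷ j ∷ used)) (linkAt T (v , c))

-- The darts leaving the boundary of a hexagon, none of which a matching alternating on it can use.
spokes : Table → List ℕ → List Ix
spokes T hs = concatMap (λ r → map turnσ (boundary T r)) hs

isObstructed : List ℕ → List ℕ → Table → Bool
isObstructed hs vs T = (length hs ≤ᵇ 3) ∧ allᵇ (λ r → insideᵇ T r ∧ isSix (faceAt T (dart r))) hs ∧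
  disjointBoundaries T hs ∧ allᵇ (λ v → v <ᵇ length T) vs ∧ unmatchable T (spokes T hs) vs []

resolve : Resolution → Table → Bool
resolve (resonant ps hs Ms) T = isMap ps T ∧ isResonant hs Ms T
resolve (obstructed ps hs vs) T = isMap ps T ∧ isObstructed hs vs T

-- Soundness of the search over independent sets

bitAt-clear : ∀ j bs p → j ≢ p → bitAt bs p ≡ true → bitAt (clear j bs) p ≡ true
bitAt-clear zero (b ∷ bs) zero j≢p e = ⊥-elim (j≢p refl)
bitAt-clear zero (b ∷ bs) (suc p) j≢p e = e
bitAt-clear (suc j) (b ∷ bs) zero j≢p e = e
bitAt-clear (suc j) (b ∷ bs) (suc p) j≢p e = bitAt-clear j bs p (λ q → j≢p (cong suc q)) e

bitAt-minus : ∀ bs cs p → bitAt cs p ≢ true → bitAt bs p ≡ true → bitAt (minus bs cs) p ≡ true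
bitAt-minus (b ∷ bs) [] p ne e = e
bitAt-minus (true ∷ bs) (true ∷ cs) zero ne e = ⊥-elim (ne refl)
bitAt-minus (true ∷ bs) (false ∷ cs) zero ne e = refl
bitAt-minus (b ∷ bs) (c ∷ cs) (suc p) ne e = bitAt-minus bs cs p ne e

within-sound : ∀ bs cs p → within bs cs ≡ true → bitAt bs p ≡ true → bitAt cs p ≡ true
within-sound (true ∷ bs) (c ∷ cs) zero w e = proj₁ (∧-elim w)
within-sound (true ∷ bs) (c ∷ cs) (suc p) w e = within-sound bs cs p (proj₂ (∧-elim {c} w)) e
within-sound (false ∷ bs) (c ∷ cs) (suc p) w e = within-sound bs cs p w e
within-sound (false ∷ bs) [] (suc p) w e = within-sound bs [] p w e

withinAny-sound : ∀ bs css → withinAny bs css ≡ true → ∃ λ cs → cs ∈ css × within bs cs ≡ true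
withinAny-sound bs (cs ∷ css) e with ∨-elim {within bs cs} e
... | inj₁ w = cs , here refl , w
... | inj₂ e′ with withinAny-sound bs css e′
...   | cs′ , m , w = cs′ , there m , w

rowAt : List (List Bool) → ℕ → List Bool
rowAt [] k = []
rowAt (row ∷ rows) zero = row
rowAt (row ∷ rows) (suc k) = rowAt rows k

-- The set `ps` picks one branch at each index `j`: if `j` is not a member its bit may be cleared,
-- and if it is, so may the bits of everything it conflicts with. Either way `bs` still contains
-- `ps`.
covers-sound : ∀ css rows j bs (ps : List ℕ) → covers css rows j bs ≡ true →
  (∀ {p} → p ∈ ps → bitAt bs p ≡ true) →
  (∀ k {q} → j + k ∈ ps → q ∈ ps → bitAt (rowAt rows k) q ≢ true) →
  ∃ λ cs → cs ∈ css × (∀ {p} → p ∈ ps → bitAt cs p ≡ true)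
covers-sound css [] j bs ps e inn ind with withinAny-sound bs css e
... | cs , m , w = cs , m , λ p∈ → within-sound bs cs _ w (inn p∈)
covers-sound css (row ∷ rows) j bs ps e inn ind with ∨-elim {withinAny bs css} e
... | inj₁ e₁ with withinAny-sound bs css e₁
...   | cs , m , w = cs , m , λ p∈ → within-sound bs cs _ w (inn p∈)
covers-sound css (row ∷ rows) j bs ps e inn ind | inj₂ e₂ with ∧-elim {covers css rows (suc j) (clear j bs)} e₂ | j
    ∈? ps
... | e₃ , _ | no j∉ = covers-sound css rows (suc j) (clear j bs) ps e₃
      (λ {p} p∈ → bitAt-clear j bs p (λ { refl → j∉ p∈ }) (inn p∈))
      (λ k q∈ → ind (suc k) (subst (_∈ ps) (sym (+-suc j k)) q∈))
... | _ , e₄ | yes j∈ with ∨-elim {not (bitAt bs j)} e₄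
...   | inj₁ e₅ with () ← trans (sym (cong not (inn j∈))) e₅
...   | inj₂ e₅ = covers-sound css rows (suc j) (minus bs row) ps e₅
      (λ {p} p∈ → bitAt-minus bs row p (ind 0 (subst (_∈ ps) (sym (+-identityʳ j)) j∈) p∈) (inn p∈))
      (λ k q∈ → ind (suc k) (subst (_∈ ps) (sym (+-suc j k)) q∈))

natAt : List ℕ → ℕ → ℕ
natAt [] k = 0
natAt (r ∷ rs) zero = r
natAt (r ∷ rs) (suc k) = natAt rs k

position : {P : ℕ → Set} {rs : List ℕ} → Any P rs → ℕ
position (here _) = 0
position (there p) = suc (position p)

position-holds : {P : ℕ → Set} {rs : List ℕ} (p : Any P rs) → P (natAt rs (position p))
position-holds (here e) = e
position-holds (there p) = position-holds p

position-bit : {P : ℕ → Set} {rs : List ℕ} (p : Any P rs) → bitAt (map (λ _ → true) rs) (position p) ≡ true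
position-bit (here _) = refl
position-bit (there p) = position-bit p

bitAt-map : ∀ (f : ℕ → Bool) rs q → bitAt (map f rs) q ≡ true → f (natAt rs q) ≡ true
bitAt-map f (r ∷ rs) zero e = e
bitAt-map f (r ∷ rs) (suc q) e = bitAt-map f rs q e

bitAt-rowAt : ∀ (f : ℕ → ℕ → Bool) rs rs′ k q → bitAt (rowAt (map (λ r → map (f r) rs′) rs) k) q ≡ true → f
    (natAt rs k) (natAt rs′ q) ≡ true
bitAt-rowAt f (r ∷ rs) rs′ zero q e = bitAt-map (f r) rs′ q e
bitAt-rowAt f (r ∷ rs) rs′ (suc k) q e = bitAt-rowAt f rs rs′ k q e

zipAny : {A : Set} {P Q : A → Set} {xs : List A} → All P xs → Any Q xs → Any (λ x → P x × Q x) xs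
zipAny (p ∷ ps) (here q) = here (p , q)
zipAny (p ∷ ps) (there q) = there (zipAny ps q)

pairs-lookup : {A : Set} {R : A → A → Set} {xs : List A} → AllPairs R xs → ∀ {x y} → x ∈ xs → y ∈ xs → x ≡ y ⊎ R x y
    ⊎ R y x
pairs-lookup (p ∷ ps) (here refl) (here refl) = inj₁ refl
pairs-lookup (p ∷ ps) (here refl) (there j) = inj₂ (inj₁ (All.lookup p j))
pairs-lookup (p ∷ ps) (there i) (here refl) = inj₂ (inj₂ (All.lookup p i))
pairs-lookup (p ∷ ps) (there i) (there j) = pairs-lookup ps i j

anyIx-complete : ∀ p {is i} → i ∈ is → p i ≡ true → anyIx p is ≡ true
anyIx-complete p (here refl) e rewrite e = refl
anyIx-complete p {i ∷ is} (there m) e with p i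
... | true = refl
... | false = anyIx-complete p m e

xor-≢ : ∀ x y → x xor y ≡ true → x ≢ y
xor-≢ true false _ ()
xor-≢ false true _ ()

xor-≡ : ∀ x y → not (x xor y) ≡ true → x ≡ y
xor-≡ true true _ = refl
xor-≡ false false _ = refl

<ᵇ-sound : ∀ m n → (m <ᵇ n) ≡ true → m < n
<ᵇ-sound m n e = <ᵇ⇒< m n (subst Data.Bool.T (sym e) tt)

≡ᵇ-sound : ∀ m n → (m ≡ᵇ n) ≡ true → m ≡ n
≡ᵇ-sound m n e = ≡ᵇ⇒≡ m n (subst Data.Bool.T (sym e) tt)

≡ᵇ-complete : ∀ m n → m ≡ n → (m ≡ᵇ n) ≡ true
≡ᵇ-complete zero zero refl = refl
≡ᵇ-complete (suc m) (suc m) refl = ≡ᵇ-complete m m refl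

-- Transferring matchings and obstructions from a closed table to `F`

module Resolved (F : Fullerene) (res₃ : Resonant F 3) (T : Table) (h : ℕ → Fin (Fullerene.d F)) where
  open Fullerene F
  open Geometry F
  open Resonance F
  open Tables F
  open ExploreSound F
  open ClosedTable F T h

  module _ (V : Valid T h) (ps : List ℕ) (e : isMap ps T ≡ true) where

    private
      N = length T
      e₁ = ∧-elim {complete T} e
      e₂ = ∧-elim {rooted T} (proj₂ e₁)
      e₃ = ∧-elim {0 <ᵇ N} (proj₂ e₂)
      e₄ = ∧-elim {isFive (faceAt T (0 , c0))} (proj₂ e₃)
      e₅ = ∧-elim {length ps ≡ᵇ 12} (proj₂ e₄)
      nonempty = <ᵇ-sound 0 N (proj₁ e₃)

    Within : Ix → Set
    Within i = proj₁ i < N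

    nameOf : ∀ y → ∃ λ i → Within i × ⟦ i ⟧ h ≡ y
    nameOf = named V (proj₁ e₁) (proj₁ e₂) nonempty

    linkOf : ∀ i → Within i → ∃ λ j → linkAt T i ≡ just j × Within j × linkAt T j ≡ just i
    linkOf = linked V (proj₁ e₁) (proj₁ e₂) nonempty

    names-unique : ∀ i j → Within i → Within j → ⟦ i ⟧ h ≡ ⟦ j ⟧ h → i ≡ j
    names-unique = injective V (proj₁ e₁) (proj₁ e₂) nonempty ps (≡ᵇ-sound _ 12 (proj₁ e₅)) (proj₂ e₅) (proj₁ e₄)

    ix : Dart → Ix
    ix y = proj₁ (nameOf y)

    -- `ix` takes whichever name connectedness supplies; uniqueness of names makes it the given one,
    -- so that choices made in the table carry over to darts.
    ix-name : ∀ i → Within i → ix (⟦ i ⟧ h) ≡ i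
    ix-name i i<n with nameOf (⟦ i ⟧ h)
    ... | j , j<n , q = names-unique j i j<n i<n q

    nextIn : ∀ i → Within i → ∃ λ j → linkAt T i ≡ just j × Within (turnσ j) × ⟦ turnσ j ⟧ h ≡ φ (⟦ i ⟧ h)
    nextIn i i<n with linkOf i i<n
    ... | j , q , j<n , _ = j , q , j<n , φ-sound V i q

    orbit-complete : ∀ m i → Within i → ∀ k → k < m → ∃ λ j → j ∈ orbit T m i × Within j × ⟦ j ⟧ h ≡ iter φ k
        (⟦ i ⟧ h)
    orbit-complete (suc m) i i<n zero _ = i , here refl , i<n , refl
    orbit-complete (suc m) i i<n (suc k) k<m with nextIn i i<n
    ... | j , q , j<n , φe with orbit-complete m (turnσ j) j<n k (s≤s⁻¹ k<m)
    ...   | j′ , j∈ , j′<n , eq = j′ , there (subst (λ l → j′ ∈ via [] (λ j → orbit T m (turnσ j)) l) (sym q) j∈) ,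
        j′<n ,
      trans eq (trans (cong (iter φ k) φe) (iter-φ k _))

    vertex-same : ∀ v c e → SameVertex (corner c (h v)) (corner e (h v))
    vertex-same v c0 c0 = 0 , refl
    vertex-same v c0 c1 = 1 , refl
    vertex-same v c0 c2 = 2 , refl
    vertex-same v c1 c0 = 2 , σ-cube _
    vertex-same v c1 c1 = 0 , refl
    vertex-same v c1 c2 = 1 , refl
    vertex-same v c2 c0 = 1 , σ-cube _
    vertex-same v c2 c1 = 2 , cong σ (σ-cube _)
    vertex-same v c2 c2 = 0 , refl

    same-vertex-name : ∀ i j → Within i → Within j → SameVertex (⟦ i ⟧ h) (⟦ j ⟧ h) → proj₁ i ≡ proj₁ j
    same-vertex-name i j i<n j<n (m , eq) with spin m
      where
      spin : ∀ m → ∃ λ c → ⟦ proj₁ i , c ⟧ h ≡ iter σ m (⟦ i ⟧ h)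
      spin zero = proj₂ i , refl
      spin (suc m) with spin m
      ... | c , q = next c , trans (naming-σ (proj₁ i , c) h) (cong σ q)
    ... | c , q = cong proj₁ (names-unique (proj₁ i , c) j i<n j<n (trans q eq))

    module _ (M : List Corner) (matching : isMatching T M ≡ true) where

      isM : Dart → Bool
      isM y = isMatched M (ix y)

      isM-name : ∀ i → Within i → isM (⟦ i ⟧ h) ≡ isMatched M i
      isM-name i i<n = cong (isMatched M) (ix-name i i<n)

      exactly-one : ∀ c e → bit (sameCorner c e) + bit (sameCorner c (next e)) + bit (sameCorner c (next (next e))) ≡
          1
      exactly-one c0 c0 = refl
      exactly-one c0 c1 = refl
      exactly-one c0 c2 = refl
      exactly-one c1 c0 = refl
      exactly-one c1 c1 = refl
      exactly-one c1 c2 = refl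
      exactly-one c2 c0 = refl
      exactly-one c2 c1 = refl
      exactly-one c2 c2 = refl

      edge : ∀ i → Within i → isM (α (⟦ i ⟧ h)) ≡ isM (⟦ i ⟧ h)
      edge i i<n with linkOf i i<n | allInside-sound (λ i → via false (λ j → not (isMatched M i xor isMatched M j))
          (linkAt T i)) matching i i<n
      ... | j , q , j<n , _ | m rewrite q = trans (cong isM (link-sound V i q)) (trans (isM-name j j<n)
        (trans (sym (xor-≡ _ _ m)) (sym (isM-name i i<n))))

      perfect : ∀ i → Within i → bit (isM (⟦ i ⟧ h)) + bit (isM (σ (⟦ i ⟧ h))) + bit (isM (σ (σ (⟦ i ⟧ h)))) ≡ 1
      perfect i i<n = trans (cong₂ _+_ (cong₂ _+_ (cong bit (isM-name i i<n))
          (cong bit (trans (cong isM (sym (naming-σ i h))) (isM-name (turnσ i) i<n))))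
          (cong bit (trans (cong isM (sym (σσ-sound V i))) (isM-name (turnσ (turnσ i)) i<n))))
        (exactly-one (cornerOf M (proj₁ i)) (proj₂ i))

      perfectMatching : PerfectMatching F
      perfectMatching .PerfectMatching.M = isM
      perfectMatching .PerfectMatching.M-edge y with nameOf y in eq
      ... | i , i<n , refl = trans (edge i i<n) (trans (isM-name i i<n) refl)
      perfectMatching .PerfectMatching.M-perf y with nameOf y in eq
      ... | i , i<n , refl = trans (cong (λ b → bit b + bit (isM (σ (⟦ i ⟧ h))) + bit (isM (σ (σ (⟦ i ⟧ h)))))
          (sym (isM-name i i<n))) (perfect i i<n)

      alternates-sound : ∀ m i → Within i → alternates T M m i ≡ true →
        ∀ k → k < m → isM (iter φ k (⟦ i ⟧ h)) ≢ isM (iter φ (suc k) (⟦ i ⟧ h))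
      alternates-sound (suc m) i i<n al k k<m with nextIn i i<n
      ... | j , q , j<n , φe rewrite q with ∧-elim {isMatched M i xor isMatched M (turnσ j)} al
      alternates-sound (suc m) i i<n al zero k<m | j , q , j<n , φe | a₁ , a₂ = λ eq →
        xor-≢ _ _ a₁ (trans (sym (isM-name i i<n)) (trans eq (trans (cong isM (sym φe)) (isM-name (turnσ j) j<n))))
      alternates-sound (suc m) i i<n al (suc k) k<m | j , q , j<n , φe | a₁ , a₂ = λ eq →
        alternates-sound m (turnσ j) j<n a₂ k (s≤s⁻¹ k<m) (trans (cong isM (shift k))
            (trans eq (sym (cong isM (shift (suc k))))))
        where
        shift : ∀ k → iter φ k (⟦ turnσ j ⟧ h) ≡ iter φ (suc k) (⟦ i ⟧ h)
        shift k = trans (cong (iter φ k) φe) (iter-φ k _)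

      -- The table was tested from its own dart of the hexagon, whereas a pattern may present the
      -- hexagon by any of its darts; hence the shift by `p`.
      alternating : ∀ i → Within i → Closes 6 (⟦ i ⟧ h) → alternates T M 6 i ≡ true → ∀ p → Alternating F
          perfectMatching (iter φ p (⟦ i ⟧ h))
      alternating i i<n c al p k eq with iter-reduce φ 5 c (k + p)
      ... | k′ , k<6 , q = alternates-sound 6 i i<n al k′ k<6
        (trans (cong isM (sym q′)) (trans eq (cong isM (cong φ q′))))
        where
        q′ : iter φ k (iter φ p (⟦ i ⟧ h)) ≡ iter φ k′ (⟦ i ⟧ h)
        q′ = trans (sym (iter-+ φ k p _)) q

    common-sound : ∀ is js → common is js ≡ true → ∃₂ λ i j → i ∈ is × j ∈ js × proj₁ i ≡ proj₁ j
    common-sound is js c with anyIx-sound (λ i → anyIx (λ j → proj₁ i ≡ᵇ proj₁ j) js) is c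
    ... | i , i∈ , q with anyIx-sound (λ j → proj₁ i ≡ᵇ proj₁ j) js q
    ...   | j , j∈ , r = i , j , i∈ , j∈ , ≡ᵇ-sound (proj₁ i) (proj₁ j) r

    common-complete : ∀ {is js} {i j : Ix} → i ∈ is → j ∈ js → proj₁ i ≡ proj₁ j → common is js ≡ true
    common-complete {is} {js} {i} {j} i∈ j∈ eq = anyIx-complete (λ i → anyIx (λ j → proj₁ i ≡ᵇ proj₁ j) js) i∈
      (anyIx-complete (λ j → proj₁ i ≡ᵇ proj₁ j) j∈ (≡ᵇ-complete (proj₁ i) (proj₁ j) eq))

    conflict-meet : ∀ r r′ → conflict T r r′ ≡ true →
      r ≢ r′ × ∃₂ λ k l → SameVertex (iter φ k (⟦ dart r ⟧ h)) (iter φ l (⟦ dart r′ ⟧ h))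
    conflict-meet r r′ c with ∧-elim {not (r ≡ᵇ r′)} c
    ... | c₁ , c₂ with common-sound (boundary T r) (boundary T r′) c₂
    ...   | (v , x) , (_ , y) , i∈ , j∈ , refl with orbit-sound V (proj₁ e₁) (proj₁ e₂) nonempty 6 (dart r) i∈
                                             | orbit-sound V (proj₁ e₁) (proj₁ e₂) nonempty 6 (dart r′) j∈
    ...     | k , _ , wk | l , _ , wl = distinct c₁ , k , l ,
      subst₂ SameVertex (walk-sound V k (dart r) wk) (walk-sound V l (dart r′) wl) (vertex-same v x y)
      where
      distinct : not (r ≡ᵇ r′) ≡ true → r ≢ r′
      distinct q refl with () ← trans (sym (cong not (≡ᵇ-complete r r refl))) q

    module _ (hexes : List ℕ) (Ms : List (List Corner)) (ok : isResonant hexes Ms T ≡ true) where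

      private
        f₁ = ∧-elim {facesFrom isSix 6 hexes T} ok
        f₂ = ∧-elim {allᵇ (insideᵇ T) hexes} (proj₂ f₁)
        f₃ = ∧-elim {allᵇ (isMatching T) Ms} (proj₂ f₂)

      Bounds : Dart → ℕ → Set
      Bounds y r = Within (dart r) × InFace y (⟦ dart r ⟧ h)

      bounds : ∀ y → Closes 6 y → Any (Bounds y) hexes
      bounds y c with nameOf y
      ... | i , i<n , refl = Any.map
        (λ { {r} (w , k , _ , q) → <ᵇ-sound _ _ w , k , sym (walk-sound V k (dart r) q) })
        (zipAny (allᵇ-sound (insideᵇ T) hexes (proj₁ f₂))
          (faces-sound V (proj₁ e₁) (proj₁ e₂) nonempty isSix 6 hexes (proj₁ f₁) i i<n
            (six-face V (proj₁ e₁) (proj₁ e₂) nonempty i i<n c)))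

      place : Dart → ℕ
      place y with closes-5⊎6 y
      -- A default on pentagons, so that `place` is total and can be mapped over lists; the lemmas
      -- on `place` are about hexagons.
      ... | inj₁ _ = 0
      ... | inj₂ c = position (bounds y c)

      place-bounds : ∀ y → Closes 6 y → Bounds y (natAt hexes (place y))
      place-bounds y c with closes-5⊎6 y
      ... | inj₁ c₅ = ⊥-elim (¬closes-5×6 c₅ c)
      ... | inj₂ c₆ = position-holds (bounds y c₆)

      place-bit : ∀ y → Closes 6 y → bitAt (map (λ _ → true) hexes) (place y) ≡ true
      place-bit y c with closes-5⊎6 y
      ... | inj₁ c₅ = ⊥-elim (¬closes-5×6 c₅ c)
      ... | inj₂ c₆ = position-bit (bounds y c₆)

      closes-6-back : ∀ k {x} → Closes 6 (iter φ k x) → Closes 6 x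
      closes-6-back k {x} c with closes-5⊎6 x
      ... | inj₂ c₆ = c₆
      ... | inj₁ c₅ = ⊥-elim (¬closes-5×6 (forward k) c)
        where
        forward : ∀ k → Closes 5 (iter φ k x)
        forward zero = c₅
        forward (suc k) = FaceIs-φ five (forward k)

      reachable : ∀ {y r} → Closes 6 y → InFace y r → ∀ k → ∃ λ k′ → iter φ k′ y ≡ iter φ k r
      reachable {y} {r} c (p , refl) k with iter-reduce φ 5 (closes-6-back p c) p
      ... | p′ , p<6 , q with back-to 5 (closes-6-back p c) p′ p<6 (sym q)
      ...   | o , _ , eo = k + suc o , trans (iter-+ φ k (suc o) _) (cong (iter φ k) eo)

      independent : ∀ hs → DisjointHexagons F hs → ∀ {y y′} → y ∈ hs → y′ ∈ hs →
        bitAt (rowAt (map (λ r → map (conflict T r) hexes) hexes) (place y)) (place y′) ≢ true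
      independent hs (hex , dis) {y} {y′} y∈ y′∈ b with conflict-meet (natAt hexes (place y)) (natAt hexes (place y′))
          (bitAt-rowAt (conflict T) hexes hexes (place y) (place y′) b)
      ... | ne , k , l , same with reachable (hexagon-closes (All.lookup hex y∈))
          (proj₂ (place-bounds y (hexagon-closes (All.lookup hex y∈)))) k
                                 | reachable (hexagon-closes (All.lookup hex y′∈)) (proj₂
                                     (place-bounds y′ (hexagon-closes (All.lookup hex y′∈)))) l
      ...   | k′ , ek | l′ , el with pairs-lookup dis y∈ y′∈
      -- A repeated dart has a single place, and no place conflicts with itself.
      ...     | inj₁ refl = ne refl
      ...     | inj₂ (inj₁ D) = D k′ l′ (subst₂ SameVertex (sym ek) (sym el) same)
      ...     | inj₂ (inj₂ D) = D l′ k′ (sameVertex-sym (subst₂ SameVertex (sym ek) (sym el) same))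

      resonant-sound : ∀ k → Resonant F k
      resonant-sound k hs _ (hex , dis)
        with covers-sound (map (λ M → map (λ r → alternates T M 6 (dart r)) hexes) Ms)
            (map (λ r → map (conflict T r) hexes) hexes) 0 (map (λ _ → true) hexes) (map place hs) (proj₂ f₃) full
                apart
        where
        full : ∀ {p} → p ∈ map place hs → bitAt (map (λ _ → true) hexes) p ≡ true
        full p∈ with ∈-map⁻ place p∈
        ... | y , y∈ , refl = place-bit y (hexagon-closes (All.lookup hex y∈))
        apart : ∀ k {q} → k ∈ map place hs → q ∈ map place hs → bitAt
            (rowAt (map (λ r → map (conflict T r) hexes) hexes) k) q ≢ true
        apart k k∈ q∈ with ∈-map⁻ place k∈ | ∈-map⁻ place q∈
        ... | y , y∈ , refl | y′ , y′∈ , refl = independent hs (hex , dis) y∈ y′∈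
      ... | cs , cs∈ , bits with ∈-map⁻ (λ M → map (λ r → alternates T M 6 (dart r)) hexes) cs∈
      ...   | M , M∈ , refl = perfectMatching M matching , All.tabulate λ {y} y∈ →
        let c = hexagon-closes (All.lookup hex y∈)
            (r<n , p , ep) = place-bounds y c in
        subst (Alternating F (perfectMatching M matching)) ep
          (alternating M matching (dart (natAt hexes (place y))) r<n (closes-6-back p (subst (Closes 6) (sym ep) c))
            (bitAt-map (λ r → alternates T M 6 (dart r)) hexes (place y) (bits (∈-map⁺ place y∈))) p)
        where
        matching = All.lookup (allᵇ-sound (isMatching T) Ms (proj₁ f₃)) M∈

    module _ (PM : PerfectMatching F) where
      open PerfectMatching PM renaming (M to used?)

      Used : Ix → Set
      Used i = used? (⟦ i ⟧ h) ≡ true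

      absurd : ∀ {b} → b ≡ false → b ≢ true
      absurd refl ()

      only-used : ∀ v → ∃ λ c → Used (v , c) × (∀ e → Used (v , e) → e ≡ c)
      only-used v with used? (h v) in q₀ | used? (σ (h v)) in q₁ | used? (σ (σ (h v))) in q₂ | M-perf (h v)
      ... | true | false | false | _ = c0 , q₀ , λ
        { c0 _ → refl ; c1 u → ⊥-elim (absurd q₁ u) ; c2 u → ⊥-elim (absurd q₂ u) }
      ... | false | true | false | _ = c1 , q₁ , λ
        { c0 u → ⊥-elim (absurd q₀ u) ; c1 _ → refl ; c2 u → ⊥-elim (absurd q₂ u) }
      ... | false | false | true | _ = c2 , q₂ , λ
        { c0 u → ⊥-elim (absurd q₀ u) ; c1 u → ⊥-elim (absurd q₁ u) ; c2 _ → refl }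

      used-corner : ∀ v → ∃ λ c → Used (v , c)
      used-corner v with only-used v
      ... | c , u , _ = c , u

      used-once : ∀ v c e → Used (v , c) → Used (v , e) → sameCorner c e ≡ true
      used-once v c e u w with only-used v
      ... | x , _ , only with only c u | only e w
      ...   | refl | refl = sameCorner-refl c
        where
        sameCorner-refl : ∀ c → sameCorner c c ≡ true
        sameCorner-refl c0 = refl
        sameCorner-refl c1 = refl
        sameCorner-refl c2 = refl

      module _ (offs : List Ix) (unused : ∀ {i} → i ∈ offs → ¬ Used i) where

        clashes-sound : ∀ us i → All Used us → Used i → clashes offs us i ≢ true
        clashes-sound us i U u c with ∨-elim {anyIx (sameIx i) offs} c
        ... | inj₁ q with anyIx-sound (sameIx i) offs q
        ...   | j , j∈ , r = unused j∈ (subst Used (sameIx-sound i j r) u)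
        clashes-sound us (v , x) U u c | inj₂ q with anyIx-sound
            (λ k → (proj₁ k ≡ᵇ v) ∧ not (sameCorner (proj₂ k) x)) us q
        ... | (w , y) , k∈ , r with ∧-elim {w ≡ᵇ v} r
        ...   | r₁ , r₂ with ≡ᵇ-sound w v r₁
        ...     | refl with () ← trans (sym (cong not (used-once v y x (All.lookup U k∈) u))) r₂

        -- Among the branches at each vertex one follows the edge that `PM` really uses; it cannot
        -- end in a clash.
        unmatchable-sound : ∀ vs us → All (λ v → v < length T) vs → All Used us → unmatchable T offs vs us ≢ true
        unmatchable-sound (v ∷ vs) us (v<n ∷ vs<n) U un with used-corner v
        ... | x , u with linkOf (v , x) v<n | allCorners-sound (λ c → via false (λ j →
              clashes offs us (v , c) ∨ clashes offs us j ∨ unmatchable T offs vs ((v , c) ∷ j ∷ us))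
                  (linkAt T (v , c))) un x
        ...   | j , q , _ , _ | b rewrite q with ∨-elim {clashes offs us (v , x)} b
        ...     | inj₁ b₁ = clashes-sound us (v , x) U u b₁
        ...     | inj₂ b₁ with ∨-elim {clashes offs us j} b₁
        ...       | inj₁ b₂ = clashes-sound us j U (usedLink q) b₂
          where
          usedLink : ∀ {j} → linkAt T (v , x) ≡ just j → Used j
          usedLink q = trans (cong used? (sym (link-sound V (v , x) q))) (trans (M-edge _) u)
        ...       | inj₂ b₂ = unmatchable-sound vs ((v , x) ∷ j ∷ us) vs<n
          (u ∷ trans (cong used? (sym (link-sound V (v , x) q))) (trans (M-edge _) u) ∷ U) b₂

    module _ (hexes vs : List ℕ) (ok : isObstructed hexes vs T ≡ true) where

      private
        g₁ = ∧-elim {length hexes ≤ᵇ 3} ok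
        g₂ = ∧-elim {allᵇ (λ r → insideᵇ T r ∧ isSix (faceAt T (dart r))) hexes} (proj₂ g₁)
        g₃ = ∧-elim {disjointBoundaries T hexes} (proj₂ g₂)
        g₄ = ∧-elim {allᵇ (λ v → v <ᵇ length T) vs} (proj₂ g₃)

      name : ℕ → Dart
      name r = ⟦ dart r ⟧ h

      hexagonal : All (λ r → Within (dart r) × Closes 6 (name r)) hexes
      hexagonal = All.map (λ {r} q → let q₁ , q₂ = ∧-elim {insideᵇ T r} q in
          <ᵇ-sound _ _ q₁ , isSix-sound (faceAt T (dart r)) (faces V (dart r)) q₂)
        (allᵇ-sound (λ r → insideᵇ T r ∧ isSix (faceAt T (dart r))) hexes (proj₁ g₂))

      apart : ∀ r r′ → Within (dart r) × Closes 6 (name r) → Within (dart r′) × Closes 6 (name r′) →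
        not (common (boundary T r) (boundary T r′)) ≡ true → VertexDisjointFaces F (name r) (name r′)
      apart r r′ (r<n , c) (r′<n , c′) nc k l same with iter-reduce φ 5 c k | iter-reduce φ 5 c′ l
      ... | k′ , k<6 , ek | l′ , l<6 , el with orbit-complete 6 (dart r) r<n k′ k<6 | orbit-complete 6 (dart r′) r′<n
          l′ l<6
      ...   | i , i∈ , i<n , ei | j , j∈ , j<n , ej with () ← trans (sym (cong not (common-complete i∈ j∈
        (same-vertex-name i j i<n j<n (subst₂ SameVertex (trans ek (sym ei)) (trans el (sym ej)) same))))) nc

      disjoint : ∀ rs → All (λ r → Within (dart r) × Closes 6 (name r)) rs → disjointBoundaries T rs ≡ true →
        DisjointHexagons F (map name rs)
      disjoint [] [] _ = [] , []
      disjoint (r ∷ rs) (c ∷ cs) q with ∧-elim {allᵇ (λ r′ → not (common (boundary T r) (boundary T r′))) rs} q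
      ... | q₁ , q₂ = closes-hexagon (proj₂ c) ∷ proj₁ (disjoint rs cs q₂) ,
        All.tabulate (λ y∈ → from y∈) ∷ proj₂ (disjoint rs cs q₂)
        where
        from : ∀ {y} → y ∈ map name rs → VertexDisjointFaces F (name r) y
        from y∈ with ∈-map⁻ name y∈
        ... | r′ , r′∈ , refl = apart r r′ c (All.lookup cs r′∈) (All.lookup (allᵇ-sound _ rs q₁) r′∈)

      spoke-free : ∀ PM {x} → Closes 6 x → Alternating F PM x → ∀ k → PerfectMatching.M PM (σ (iter φ k x)) ≡ false
      spoke-free PM c al zero = off-hexagon PM c al
      spoke-free PM {x} c al (suc k) = subst (λ y → PerfectMatching.M PM (σ y) ≡ false) (iter-φ k x)
        (spoke-free PM (FaceIs-φ six c) (alternating-φ PM al) k)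

      spoke-unused : ∀ PM rs → All (λ r → Within (dart r) × Closes 6 (name r)) rs → All (Alternating F PM)
          (map name rs) →
        ∀ {i} → i ∈ spokes T rs → ¬ Used PM i
      spoke-unused PM (r ∷ rs) ((_ , c) ∷ cs) (al ∷ als) {i} i∈ u with ∈-++⁻ (map turnσ (boundary T r)) i∈
      ... | inj₂ i∈′ = spoke-unused PM rs cs als i∈′ u
      ... | inj₁ i∈′ with ∈-map⁻ turnσ i∈′
      ...   | j , j∈ , refl with orbit-sound V (proj₁ e₁) (proj₁ e₂) nonempty 6 (dart r) j∈
      ...     | k , _ , w with () ← trans (sym u) (trans (cong (PerfectMatching.M PM)
          (trans (naming-σ j h) (cong σ (walk-sound V k (dart r) w))))
                (spoke-free PM c al k))

      obstructed-sound : ⊥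
      obstructed-sound with res₃ (map name hexes) (subst (_≤ 3) (sym (length-map name hexes))
          (≤ᵇ⇒≤ _ 3 (subst Data.Bool.T (sym (proj₁ g₁)) tt)))
        (disjoint hexes hexagonal (proj₁ g₃))
      ... | PM , als = unmatchable-sound PM (spokes T hexes) (spoke-unused PM hexes hexagonal als) vs []
        (All.map (λ {v} q → <ᵇ-sound v _ q) (allᵇ-sound (λ v → v <ᵇ length T) vs (proj₁ g₄))) [] (proj₂ g₄)

  resolve-sound : ∀ R → Valid T h → resolve R T ≡ true → ∀ k → Resonant F k
  resolve-sound (resonant ps hs Ms) V e with ∧-elim {isMap ps T} e
  ... | e₁ , e₂ = resonant-sound V ps e₁ hs Ms e₂
  resolve-sound (obstructed ps hs vs) V e with ∧-elim {isMap ps T} e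
  ... | e₁ , e₂ = ⊥-elim (obstructed-sound V ps e₁ hs vs e₂)

-- Classification

pattern0 : Pattern
pattern0 = six ∷ six ∷ six ∷ six ∷ six ∷ []

-- The queries 3, 6, 9, 12 and 15 determine the faces around the root pentagon, so answers other
-- than `pattern0` end in `mismatch`; the later trees open in the same way. The two closed leaves
-- are maps with 10 and 20 hexagons.
cert0 : Cert Resolution
cert0 =
  query 3 (mismatch) (query 6 (mismatch) (query 9 (mismatch) (query 12 (mismatch) (query 15 (mismatch) (query 18
  (query 27 (query 36 (query 45 (query 54 (query 66 (query 72 (query 78 (query 84 (query 60 (query 90 (query 93
  (query 96 (fold 96 (s ∷ a ∷ s ∷ s ∷ a ∷ s ∷ s ∷ a ∷ s ∷ a ∷ s ∷ s ∷ a ∷ s ∷ s ∷ a ∷ s ∷ s ∷ a ∷ [])) (fold 96 (s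
  ∷ a ∷ s ∷ s ∷ []))) (query 108 (fold 108 (s ∷ a ∷ s ∷ s ∷ a ∷ s ∷ s ∷ [])) (query 96 (fold 96 (a ∷ s ∷ a ∷ s ∷ a
  ∷ s ∷ s ∷ [])) (fold 96 (s ∷ a ∷ s ∷ s ∷ []))))) (query 93 (query 96 (fold 96 (s ∷ a ∷ s ∷ a ∷ s ∷ s ∷ []))
  (query 99 (fold 99 (a ∷ s ∷ a ∷ s ∷ a ∷ s ∷ s ∷ [])) (fold 99 (s ∷ a ∷ s ∷ s ∷ [])))) (query 96 (query 99 (fold
  99 (s ∷ [])) (fold 99 (s ∷ a ∷ s ∷ a ∷ s ∷ s ∷ []))) (query 99 (query 105 (fold 105 (a ∷ s ∷ s ∷ [])) (fold 105
  (a ∷ s ∷ s ∷ []))) (query 105 (fold 105 (s ∷ a ∷ s ∷ a ∷ s ∷ s ∷ [])) (query 107 (closed (resonant (0 ∷ 17 ∷ 20 ∷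
  23 ∷ 29 ∷ 32 ∷ 38 ∷ 41 ∷ 47 ∷ 50 ∷ 56 ∷ 107 ∷ []) (1 ∷ 2 ∷ 5 ∷ 8 ∷ 11 ∷ 62 ∷ 68 ∷ 74 ∷ 80 ∷ 86 ∷ []) ((c1 ∷ c2 ∷
  c2 ∷ c2 ∷ c2 ∷ c0 ∷ c1 ∷ c0 ∷ c1 ∷ c1 ∷ c0 ∷ c1 ∷ c1 ∷ c0 ∷ c1 ∷ c1 ∷ c0 ∷ c1 ∷ c1 ∷ c0 ∷ c1 ∷ c0 ∷ c1 ∷ c0 ∷ c1
  ∷ c0 ∷ c1 ∷ c0 ∷ c1 ∷ c0 ∷ c2 ∷ c2 ∷ c2 ∷ c2 ∷ c2 ∷ c0 ∷ c1 ∷ c1 ∷ c1 ∷ c1 ∷ []) ∷ []))) (fold 107 ([]))))))))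
  (query 93 (query 108 (query 96 (fold 96 (s ∷ [])) (fold 96 (s ∷ a ∷ s ∷ a ∷ s ∷ s ∷ []))) (query 96 (fold 96 (s ∷
  a ∷ s ∷ s ∷ [])) (query 99 (fold 99 (s ∷ [])) (radials 28)))) (radials 21))) (query 96 (query 105 (query 99 (fold
  99 (s ∷ [])) (fold 99 (s ∷ []))) (query 99 (fold 99 (s ∷ a ∷ s ∷ a ∷ s ∷ s ∷ a ∷ s ∷ a ∷ s ∷ s ∷ a ∷ s ∷ s ∷ a ∷
  s ∷ a ∷ s ∷ s ∷ [])) (query 102 (fold 102 (s ∷ a ∷ s ∷ s ∷ [])) (query 87 (fold 87 (s ∷ [])) (radials 21)))))
  (radials 26))) (query 93 (query 96 (query 99 (fold 99 (s ∷ a ∷ s ∷ s ∷ [])) (query 81 (fold 81 (s ∷ a ∷ s ∷ a ∷ s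
  ∷ s ∷ a ∷ s ∷ a ∷ s ∷ s ∷ [])) (fold 81 (s ∷ a ∷ s ∷ s ∷ a ∷ [])))) (query 105 (query 99 (fold 99 (s ∷ [])) (fold
  99 (s ∷ a ∷ s ∷ s ∷ a ∷ s ∷ a ∷ []))) (query 108 (query 99 (fold 99 (s ∷ a ∷ s ∷ s ∷ [])) (query 81 (fold 81 (s ∷
  [])) (radials 29))) (query 99 (query 81 (fold 81 (s ∷ a ∷ s ∷ s ∷ [])) (short 47 4)) (query 84 (query 117 (query
  86 (opposites 39) (radials 27)) (radials 28)) (radials 26)))))) (radials 24))) (query 90 (query 99 (query 93
  (query 96 (fold 96 (s ∷ a ∷ s ∷ s ∷ [])) (query 75 (fold 75 (s ∷ a ∷ s ∷ a ∷ s ∷ s ∷ a ∷ s ∷ a ∷ s ∷ s ∷ []))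
  (fold 75 (s ∷ a ∷ s ∷ s ∷ a ∷ [])))) (query 105 (query 96 (fold 96 (s ∷ [])) (fold 96 (s ∷ a ∷ s ∷ s ∷ a ∷ s ∷ a
  ∷ []))) (query 108 (query 96 (fold 96 (s ∷ a ∷ s ∷ s ∷ [])) (query 75 (fold 75 (s ∷ [])) (radials 27))) (query 96
  (query 75 (fold 75 (s ∷ a ∷ s ∷ s ∷ [])) (short 38 4)) (query 78 (query 117 (query 80 (opposites 39) (radials
  25)) (radials 26)) (radials 24)))))) (query 93 (opposites 30) (radials 21))) (radials 22))) (query 72 (query 75
  (query 78 (query 99 (query 81 (fold 81 (s ∷ a ∷ s ∷ s ∷ [])) (query 84 (fold 84 (a ∷ s ∷ s ∷ a ∷ s ∷ a ∷ s ∷ s ∷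
  a ∷ s ∷ a ∷ s ∷ s ∷ [])) (fold 84 (s ∷ a ∷ s ∷ a ∷ [])))) (query 81 (query 84 (fold 84 (s ∷ [])) (fold 84 (s ∷ a
  ∷ s ∷ a ∷ s ∷ s ∷ a ∷ []))) (query 84 (query 87 (fold 87 (s ∷ a ∷ s ∷ s ∷ [])) (query 60 (fold 60 (s ∷ []))
  (radials 21))) (query 111 (query 87 (fold 87 (s ∷ a ∷ s ∷ s ∷ [])) (short 56 4)) (query 60 (query 114 (query 86
  (opposites 39) (radials 20)) (radials 29)) (radials 21)))))) (query 99 (opposites 32) (radials 24))) (radials
  23)) (query 93 (query 96 (query 99 (query 111 (query 114 (query 117 (fold 117 (s ∷ a ∷ s ∷ s ∷ a ∷ s ∷ s ∷ a ∷ s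
  ∷ s ∷ [])) (opposites 35)) (query 120 (query 75 (query 78 (fold 78 (s ∷ [])) (opposites 35)) (query 123 (fold 123
  (s ∷ a ∷ s ∷ s ∷ [])) (radials 20))) (query 75 (query 78 (fold 78 (s ∷ [])) (opposites 35)) (query 78 (query 81
  (fold 81 (s ∷ [])) (radials 20)) (query 129 (fold 129 (s ∷ a ∷ s ∷ a ∷ s ∷ s ∷ a ∷ s ∷ a ∷ s ∷ a ∷ s ∷ s ∷ a ∷ s
  ∷ a ∷ s ∷ s ∷ a ∷ s ∷ a ∷ s ∷ s ∷ a ∷ s ∷ a ∷ s ∷ s ∷ [])) (radials 20)))))) (radials 36)) (radials 23)) (query
  99 (query 78 (query 120 (query 81 (query 84 (fold 84 (s ∷ [])) (opposites 40)) (radials 25)) (query 84 (query 126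
  (query 87 (fold 87 (s ∷ a ∷ s ∷ a ∷ s ∷ s ∷ [])) (query 60 (fold 60 (s ∷ [])) (fold 60 (s ∷ a ∷ s ∷ a ∷ s ∷ s ∷ a
  ∷ s ∷ a ∷ s ∷ s ∷ a ∷ s ∷ a ∷ s ∷ a ∷ s ∷ s ∷ a ∷ s ∷ a ∷ s ∷ s ∷ a ∷ s ∷ [])))) (radials 25)) (radials 26)))
  (query 120 (query 114 (query 123 (query 81 (fold 81 (s ∷ a ∷ s ∷ a ∷ s ∷ s ∷ [])) (query 84 (fold 84 (s ∷ []))
  (fold 84 (s ∷ a ∷ s ∷ a ∷ s ∷ s ∷ a ∷ s ∷ s ∷ a ∷ s ∷ a ∷ s ∷ s ∷ a ∷ s ∷ a ∷ s ∷ s ∷ a ∷ s ∷ a ∷ s ∷ s ∷ a ∷ s ∷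
  [])))) (radials 25)) (radials 39)) (query 123 (query 84 (query 135 (query 87 (query 60 (fold 60 (s ∷ []))
  (opposites 45)) (radials 27)) (query 60 (query 102 (query 105 (fold 105 (s ∷ [])) (radials 20)) (query 144 (fold
  144 (s ∷ a ∷ s ∷ a ∷ s ∷ s ∷ a ∷ s ∷ a ∷ s ∷ a ∷ s ∷ s ∷ a ∷ s ∷ a ∷ s ∷ a ∷ s ∷ s ∷ a ∷ s ∷ a ∷ s ∷ s ∷ a ∷ s ∷
  a ∷ s ∷ [])) (radials 20))) (radials 28))) (query 135 (query 129 (query 141 (query 138 (fold 138 (s ∷ []))
  (radials 27)) (query 138 (fold 138 (s ∷ a ∷ s ∷ a ∷ s ∷ s ∷ a ∷ s ∷ a ∷ s ∷ a ∷ s ∷ s ∷ a ∷ s ∷ a ∷ s ∷ a ∷ s ∷ s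
  ∷ a ∷ s ∷ a ∷ s ∷ s ∷ a ∷ s ∷ a ∷ s ∷ [])) (radials 27))) (radials 44)) (query 138 (query 60 (query 102 (query
  105 (opposites 50) (radials 20)) (radials 29)) (query 102 (query 150 (query 105 (fold 105 (s ∷ a ∷ s ∷ a ∷ s ∷ s
  ∷ [])) (radials 20)) (query 105 (query 114 (fold 114 (a ∷ s ∷ s ∷ a ∷ s ∷ a ∷ s ∷ a ∷ s ∷ s ∷ a ∷ s ∷ a ∷ s ∷ a ∷
  s ∷ s ∷ a ∷ s ∷ a ∷ s ∷ a ∷ s ∷ s ∷ [])) (radials 34)) (radials 20))) (query 150 (query 156 (query 105 (fold 105
  (a ∷ s ∷ s ∷ a ∷ s ∷ a ∷ s ∷ a ∷ s ∷ s ∷ a ∷ s ∷ a ∷ s ∷ a ∷ s ∷ s ∷ a ∷ s ∷ a ∷ s ∷ a ∷ s ∷ s ∷ [])) (radials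
  49)) (radials 20)) (query 156 (query 105 (query 114 (query 129 (opposites 55) (radials 35)) (radials 54)) (query
  114 (radials 38) (query 129 (radials 43) (query 144 (radials 48) (query 165 (fold 165 (s ∷ a ∷ s ∷ a ∷ s ∷ s ∷
  [])) (query 167 (closed (resonant (0 ∷ 17 ∷ 23 ∷ 32 ∷ 41 ∷ 50 ∷ 92 ∷ 98 ∷ 122 ∷ 137 ∷ 152 ∷ 167 ∷ []) (1 ∷ 2 ∷ 5
  ∷ 8 ∷ 11 ∷ 20 ∷ 29 ∷ 38 ∷ 47 ∷ 56 ∷ 62 ∷ 68 ∷ 74 ∷ 80 ∷ 86 ∷ 104 ∷ 107 ∷ 116 ∷ 131 ∷ 146 ∷ []) ((c1 ∷ c2 ∷ c2 ∷
  c2 ∷ c2 ∷ c0 ∷ c1 ∷ c0 ∷ c1 ∷ c1 ∷ c0 ∷ c1 ∷ c1 ∷ c0 ∷ c1 ∷ c1 ∷ c0 ∷ c1 ∷ c1 ∷ c0 ∷ c2 ∷ c2 ∷ c2 ∷ c2 ∷ c2 ∷ c2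
  ∷ c2 ∷ c2 ∷ c2 ∷ c2 ∷ c0 ∷ c1 ∷ c0 ∷ c1 ∷ c2 ∷ c2 ∷ c2 ∷ c0 ∷ c2 ∷ c2 ∷ c0 ∷ c1 ∷ c0 ∷ c2 ∷ c2 ∷ c0 ∷ c1 ∷ c0 ∷
  c2 ∷ c2 ∷ c0 ∷ c1 ∷ c1 ∷ c0 ∷ c2 ∷ c0 ∷ c1 ∷ c1 ∷ c1 ∷ c1 ∷ []) ∷ []))) (radials 35))))))) (radials 20)))))
  (radials 27)))) (radials 25)))) (radials 23))) (radials 22)))) (radials 4)) (radials 3)) (radials 2)) (radials
  1)) (radials 0))))))

pattern1 : Pattern
pattern1 = five ∷ six ∷ six ∷ six ∷ six ∷ []

-- In `pattern-at` the index 0 now means `pattern0`; in general it means the pattern of the stage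
-- just before. One of the two closed leaves is obstructed, with 25 vertices listed for the splits.
cert1 : Cert Resolution
cert1 =
  query 3 (query 6 (mismatch) (query 9 (mismatch) (query 12 (mismatch) (query 15 (mismatch) (query 18 (query 24
  (query 42 (query 63 (query 75 (query 27 (query 33 (query 66 (query 69 (fold 69 (s ∷ [])) (fold 69 (s ∷ a ∷ s ∷ a
  ∷ s ∷ s ∷ a ∷ s ∷ a ∷ s ∷ s ∷ a ∷ s ∷ a ∷ s ∷ a ∷ s ∷ s ∷ a ∷ s ∷ []))) (query 87 (fold 87 (s ∷ a ∷ s ∷ s ∷ []))
  (query 69 (fold 69 (s ∷ a ∷ [])) (short 44 3)))) (query 78 (query 87 (fold 87 (s ∷ a ∷ s ∷ s ∷ [])) (query 66
  (fold 66 (s ∷ a ∷ s ∷ a ∷ s ∷ s ∷ [])) (fold 66 (s ∷ [])))) (query 69 (query 93 (query 96 (fold 96 (s ∷ a ∷ s ∷ a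
  ∷ s ∷ s ∷ [])) (query 99 (fold 99 (s ∷ a ∷ s ∷ s ∷ [])) (short 44 4))) (query 102 (query 96 (fold 96 (s ∷ []))
  (fold 96 (s ∷ a ∷ s ∷ a ∷ []))) (query 105 (radials 35) (query 108 (query 96 (fold 96 (s ∷ [])) (radials 23))
  (radials 35))))) (radials 12)))) (query 78 (query 81 (query 87 (fold 87 (s ∷ a ∷ s ∷ s ∷ a ∷ s ∷ a ∷ s ∷ s ∷ a ∷
  s ∷ a ∷ s ∷ s ∷ a ∷ s ∷ a ∷ s ∷ s ∷ a ∷ s ∷ a ∷ s ∷ [])) (query 33 (fold 33 (s ∷ a ∷ [])) (short 35 3))) (query
  69 (query 90 (query 87 (fold 87 (s ∷ a ∷ s ∷ s ∷ a ∷ s ∷ s ∷ [])) (query 33 (fold 33 (s ∷ a ∷ s ∷ s ∷ [])) (short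
  35 4))) (query 87 (query 33 (fold 33 (s ∷ [])) (fold 33 (s ∷ a ∷ s ∷ s ∷ a ∷ []))) (query 33 (radials 35) (query
  93 (query 96 (opposites 31) (radials 22)) (radials 35))))) (radials 14))) (query 33 (query 66 (query 96 (query 69
  (opposites 32) (radials 31)) (query 69 (query 102 (query 45 (opposites 23) (radials 22)) (query 45 (query 47
  (closed (resonant (0 ∷ 1 ∷ 17 ∷ 20 ∷ 29 ∷ 35 ∷ 38 ∷ 44 ∷ 47 ∷ 59 ∷ 68 ∷ 74 ∷ []) (2 ∷ 5 ∷ 8 ∷ 11 ∷ 26 ∷ 53 ∷ 80 ∷
  83 ∷ []) ((c1 ∷ c2 ∷ c2 ∷ c2 ∷ c2 ∷ c0 ∷ c2 ∷ c1 ∷ c1 ∷ c0 ∷ c1 ∷ c1 ∷ c0 ∷ c1 ∷ c1 ∷ c0 ∷ c1 ∷ c1 ∷ c0 ∷ c2 ∷ c1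
  ∷ c2 ∷ c1 ∷ c0 ∷ c0 ∷ c1 ∷ c2 ∷ c2 ∷ c2 ∷ c0 ∷ c1 ∷ c2 ∷ c0 ∷ c0 ∷ c2 ∷ c1 ∷ []) ∷ []))) (opposites 23)) (radials
  22))) (radials 27))) (query 96 (radials 27) (pattern-at 0 29))) (query 69 (query 99 (query 105 (query 45 (query
  90 (fold 90 (s ∷ a ∷ s ∷ s ∷ a ∷ s ∷ a ∷ s ∷ s ∷ [])) (query 81 (query 93 (fold 93 (s ∷ [])) (opposites 23))
  (query 117 (fold 117 (s ∷ a ∷ s ∷ s ∷ [])) (opposites 23)))) (query 90 (query 81 (fold 81 (s ∷ a ∷ s ∷ s ∷ a ∷ s
  ∷ s ∷ [])) (pattern-at 0 47)) (query 108 (query 111 (fold 111 (s ∷ a ∷ s ∷ a ∷ s ∷ s ∷ [])) (opposites 33))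
  (radials 22)))) (opposites 22)) (query 105 (query 45 (query 90 (fold 90 (s ∷ a ∷ s ∷ s ∷ a ∷ s ∷ a ∷ s ∷ s ∷ a ∷
  s ∷ s ∷ [])) (query 81 (query 93 (fold 93 (s ∷ [])) (opposites 23)) (opposites 35))) (query 90 (query 81 (fold 81
  (s ∷ a ∷ s ∷ s ∷ a ∷ s ∷ s ∷ [])) (pattern-at 0 47)) (query 111 (query 114 (query 129 (query 132 (fold 132 (s ∷ a
  ∷ s ∷ s ∷ [])) (opposites 37)) (query 135 (radials 27) (query 138 (radials 41) (query 141 (fold 141 (s ∷ a ∷ s ∷
  a ∷ s ∷ s ∷ [])) (query 131 (closed (obstructed (0 ∷ 1 ∷ 17 ∷ 20 ∷ 38 ∷ 59 ∷ 68 ∷ 74 ∷ 101 ∷ 104 ∷ 113 ∷ 131 ∷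
  []) (8 ∷ 47 ∷ 83 ∷ []) (4 ∷ 0 ∷ 1 ∷ 7 ∷ 9 ∷ 8 ∷ 14 ∷ 22 ∷ 23 ∷ 26 ∷ 24 ∷ 25 ∷ 21 ∷ 32 ∷ 33 ∷ 36 ∷ 47 ∷ 43 ∷ 42 ∷
  44 ∷ 5 ∷ 6 ∷ 18 ∷ 19 ∷ 20 ∷ []))) (radials 27)))))) (radials 34)) (radials 22)))) (radials 23))) (radials 12)))))
  (opposites 20)) (radials 6)) (radials 3)) (radials 1)) (radials 0)))))) (mismatch)

pattern2 : Pattern
pattern2 = five ∷ six ∷ five ∷ six ∷ six ∷ []

-- All three closed leaves are resonant, with 8, 8 and 14 hexagons and four matchings each.
cert2 : Cert Resolution
cert2 =
  query 3 (query 6 (mismatch) (query 9 (query 12 (mismatch) (query 15 (mismatch) (query 18 (query 39 (query 57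
  (query 24 (query 63 (query 75 (query 69 (query 81 (query 42 (query 48 (query 93 (fold 93 (s ∷ a ∷ s ∷ s ∷ a ∷ s ∷
  s ∷ [])) (fold 93 (s ∷ a ∷ s ∷ s ∷ a ∷ s ∷ s ∷ []))) (query 93 (fold 93 (s ∷ a ∷ s ∷ s ∷ [])) (fold 93 (s ∷ a ∷ s
  ∷ s ∷ a ∷ s ∷ a ∷ s ∷ s ∷ [])))) (query 84 (query 93 (fold 93 (s ∷ a ∷ s ∷ a ∷ s ∷ s ∷ [])) (fold 93 (s ∷ a ∷ s ∷
  a ∷ s ∷ s ∷ a ∷ s ∷ a ∷ s ∷ s ∷ []))) (query 105 (query 93 (fold 93 (s ∷ a ∷ s ∷ a ∷ s ∷ s ∷ a ∷ s ∷ s ∷ []))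
  (fold 93 (s ∷ a ∷ s ∷ a ∷ s ∷ s ∷ a ∷ s ∷ s ∷ []))) (query 93 (fold 93 (s ∷ a ∷ s ∷ a ∷ s ∷ s ∷ a ∷ s ∷ a ∷ s ∷ s
  ∷ a ∷ [])) (fold 93 (s ∷ a ∷ s ∷ a ∷ s ∷ s ∷ a ∷ s ∷ a ∷ s ∷ s ∷ a ∷ s ∷ a ∷ s ∷ s ∷ a ∷ s ∷ a ∷ s ∷ s ∷ a ∷ s ∷
  a ∷ s ∷ [])))))) (opposites 20)) (opposites 19)) (query 84 (query 78 (query 81 (fold 81 (s ∷ a ∷ s ∷ s ∷ []))
  (radials 21)) (opposites 19)) (query 87 (query 90 (query 93 (query 78 (fold 78 (s ∷ [])) (fold 78 (a ∷ s ∷ s ∷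
  []))) (query 78 (fold 78 (s ∷ a ∷ s ∷ a ∷ s ∷ s ∷ [])) (query 81 (fold 81 (s ∷ [])) (radials 21)))) (query 78
  (query 81 (query 42 (fold 42 (a ∷ s ∷ s ∷ [])) (fold 42 (s ∷ []))) (radials 21)) (query 99 (query 102 (radials
  34) (query 105 (query 80 (closed (resonant (0 ∷ 1 ∷ 8 ∷ 17 ∷ 20 ∷ 35 ∷ 41 ∷ 56 ∷ 62 ∷ 68 ∷ 80 ∷ 92 ∷ []) (2 ∷ 5 ∷
  11 ∷ 26 ∷ 29 ∷ 44 ∷ 50 ∷ 77 ∷ []) ((c1 ∷ c1 ∷ c0 ∷ c1 ∷ c0 ∷ c0 ∷ c2 ∷ c2 ∷ c0 ∷ c1 ∷ c0 ∷ c2 ∷ c2 ∷ c0 ∷ c1 ∷ c0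
  ∷ c2 ∷ c2 ∷ c0 ∷ c1 ∷ c0 ∷ c2 ∷ c2 ∷ c1 ∷ c0 ∷ c2 ∷ c2 ∷ c1 ∷ c1 ∷ c2 ∷ c0 ∷ c1 ∷ c0 ∷ c1 ∷ c2 ∷ c1 ∷ []) ∷ (c1 ∷
  c2 ∷ c2 ∷ c2 ∷ c2 ∷ c0 ∷ c2 ∷ c1 ∷ c1 ∷ c0 ∷ c1 ∷ c2 ∷ c1 ∷ c1 ∷ c0 ∷ c1 ∷ c1 ∷ c0 ∷ c2 ∷ c1 ∷ c0 ∷ c2 ∷ c0 ∷ c1
  ∷ c0 ∷ c1 ∷ c0 ∷ c1 ∷ c2 ∷ c1 ∷ c2 ∷ c2 ∷ c1 ∷ c0 ∷ c2 ∷ c1 ∷ []) ∷ (c1 ∷ c1 ∷ c0 ∷ c2 ∷ c2 ∷ c0 ∷ c2 ∷ c2 ∷ c0 ∷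
  c1 ∷ c0 ∷ c2 ∷ c1 ∷ c1 ∷ c0 ∷ c1 ∷ c1 ∷ c0 ∷ c2 ∷ c1 ∷ c0 ∷ c2 ∷ c0 ∷ c1 ∷ c0 ∷ c2 ∷ c2 ∷ c1 ∷ c1 ∷ c2 ∷ c2 ∷ c1
  ∷ c1 ∷ c1 ∷ c2 ∷ c1 ∷ []) ∷ (c1 ∷ c2 ∷ c2 ∷ c1 ∷ c0 ∷ c0 ∷ c2 ∷ c1 ∷ c1 ∷ c0 ∷ c1 ∷ c2 ∷ c2 ∷ c0 ∷ c1 ∷ c0 ∷ c2 ∷
  c2 ∷ c0 ∷ c1 ∷ c0 ∷ c2 ∷ c2 ∷ c1 ∷ c0 ∷ c1 ∷ c0 ∷ c1 ∷ c2 ∷ c1 ∷ c0 ∷ c2 ∷ c0 ∷ c0 ∷ c2 ∷ c1 ∷ []) ∷ [])))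
  (radials 21)) (radials 34))) (pattern-at 0 69)))) (opposites 19)))) (radials 11)) (query 63 (query 78 (query 81
  (query 84 (query 42 (fold 42 (s ∷ a ∷ s ∷ s ∷ [])) (radials 18)) (opposites 20)) (query 84 (query 42 (query 48
  (query 66 (fold 66 (s ∷ [])) (fold 66 (s ∷ []))) (query 96 (fold 96 (s ∷ a ∷ s ∷ s ∷ a ∷ s ∷ s ∷ [])) (query 66
  (fold 66 (s ∷ [])) (radials 23)))) (query 90 (query 96 (query 48 (fold 48 (s ∷ [])) (fold 48 (s ∷ []))) (radials
  18)) (query 96 (query 48 (radials 34) (query 66 (query 68 (closed (resonant (0 ∷ 1 ∷ 8 ∷ 17 ∷ 29 ∷ 35 ∷ 50 ∷ 56 ∷
  62 ∷ 68 ∷ 83 ∷ 92 ∷ []) (2 ∷ 5 ∷ 11 ∷ 20 ∷ 26 ∷ 41 ∷ 44 ∷ 71 ∷ []) ((c1 ∷ c1 ∷ c0 ∷ c2 ∷ c2 ∷ c0 ∷ c2 ∷ c2 ∷ c0 ∷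
  c1 ∷ c0 ∷ c2 ∷ c1 ∷ c1 ∷ c0 ∷ c1 ∷ c1 ∷ c0 ∷ c2 ∷ c1 ∷ c0 ∷ c2 ∷ c0 ∷ c2 ∷ c2 ∷ c0 ∷ c1 ∷ c0 ∷ c1 ∷ c2 ∷ c0 ∷ c2
  ∷ c0 ∷ c0 ∷ c2 ∷ c0 ∷ []) ∷ (c2 ∷ c2 ∷ c2 ∷ c2 ∷ c1 ∷ c2 ∷ c2 ∷ c1 ∷ c1 ∷ c0 ∷ c1 ∷ c2 ∷ c1 ∷ c2 ∷ c2 ∷ c2 ∷ c0 ∷
  c1 ∷ c2 ∷ c1 ∷ c0 ∷ c1 ∷ c0 ∷ c1 ∷ c0 ∷ c2 ∷ c1 ∷ c0 ∷ c2 ∷ c0 ∷ c2 ∷ c1 ∷ c1 ∷ c1 ∷ c2 ∷ c0 ∷ []) ∷ (c1 ∷ c2 ∷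
  c2 ∷ c2 ∷ c2 ∷ c0 ∷ c2 ∷ c1 ∷ c1 ∷ c0 ∷ c1 ∷ c2 ∷ c1 ∷ c1 ∷ c0 ∷ c1 ∷ c1 ∷ c0 ∷ c2 ∷ c1 ∷ c0 ∷ c2 ∷ c0 ∷ c1 ∷ c0
  ∷ c2 ∷ c1 ∷ c0 ∷ c1 ∷ c0 ∷ c2 ∷ c2 ∷ c0 ∷ c1 ∷ c2 ∷ c0 ∷ []) ∷ (c2 ∷ c1 ∷ c0 ∷ c2 ∷ c1 ∷ c2 ∷ c2 ∷ c2 ∷ c0 ∷ c1 ∷
  c0 ∷ c2 ∷ c1 ∷ c2 ∷ c2 ∷ c2 ∷ c0 ∷ c1 ∷ c2 ∷ c1 ∷ c0 ∷ c1 ∷ c0 ∷ c2 ∷ c2 ∷ c0 ∷ c1 ∷ c0 ∷ c2 ∷ c2 ∷ c0 ∷ c1 ∷ c1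
  ∷ c0 ∷ c2 ∷ c0 ∷ []) ∷ []))) (radials 18)) (radials 34))) (pattern-at 0 84)))) (opposites 20))) (query 69 (query
  90 (query 93 (query 96 (fold 96 (s ∷ a ∷ s ∷ s ∷ a ∷ s ∷ s ∷ a ∷ s ∷ a ∷ s ∷ s ∷ [])) (opposites 22)) (query 99
  (query 96 (query 75 (fold 75 (s ∷ a ∷ s ∷ s ∷ [])) (fold 75 (s ∷ a ∷ s ∷ s ∷ []))) (radials 21)) (query 96 (query
  75 (query 87 (fold 87 (a ∷ s ∷ s ∷ [])) (fold 87 (s ∷ []))) (query 87 (query 81 (pattern-at 0 110) (pattern-at 1
  26)) (query 111 (fold 111 (s ∷ a ∷ s ∷ s ∷ [])) (short 80 4)))) (opposites 22)))) (query 84 (query 42 (query 99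
  (fold 99 (s ∷ a ∷ s ∷ s ∷ a ∷ s ∷ a ∷ s ∷ a ∷ s ∷ s ∷ a ∷ s ∷ a ∷ s ∷ s ∷ [])) (query 93 (query 96 (fold 96 (s ∷
  a ∷ s ∷ s ∷ [])) (radials 23)) (opposites 28))) (query 99 (query 93 (pattern-at 0 113) (pattern-at 1 44)) (query
  96 (query 75 (query 87 (fold 87 (s ∷ a ∷ s ∷ s ∷ a ∷ s ∷ a ∷ s ∷ a ∷ s ∷ s ∷ [])) (query 102 (fold 102 (s ∷ a ∷ s
  ∷ a ∷ s ∷ a ∷ s ∷ s ∷ [])) (opposites 32))) (query 87 (query 102 (pattern-at 0 128) (pattern-at 1 26)) (query 102
  (query 105 (opposites 34) (radials 27)) (query 117 (query 120 (opposites 39) (radials 31)) (query 135 (radials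
  35) (query 132 (radials 40) (query 138 (query 119 (closed (resonant (0 ∷ 1 ∷ 8 ∷ 17 ∷ 35 ∷ 56 ∷ 62 ∷ 68 ∷ 83 ∷ 95
  ∷ 104 ∷ 119 ∷ []) (2 ∷ 5 ∷ 11 ∷ 20 ∷ 26 ∷ 29 ∷ 41 ∷ 44 ∷ 50 ∷ 71 ∷ 80 ∷ 92 ∷ 107 ∷ 122 ∷ []) ((c1 ∷ c1 ∷ c0 ∷ c2
  ∷ c2 ∷ c0 ∷ c2 ∷ c2 ∷ c0 ∷ c1 ∷ c0 ∷ c2 ∷ c1 ∷ c1 ∷ c0 ∷ c1 ∷ c1 ∷ c0 ∷ c2 ∷ c1 ∷ c0 ∷ c2 ∷ c0 ∷ c2 ∷ c2 ∷ c0 ∷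
  c2 ∷ c2 ∷ c1 ∷ c1 ∷ c2 ∷ c2 ∷ c1 ∷ c1 ∷ c0 ∷ c2 ∷ c2 ∷ c0 ∷ c2 ∷ c0 ∷ c2 ∷ c2 ∷ c0 ∷ c2 ∷ c0 ∷ c0 ∷ c0 ∷ c0 ∷ [])
  ∷ (c1 ∷ c1 ∷ c0 ∷ c2 ∷ c2 ∷ c0 ∷ c1 ∷ c0 ∷ c2 ∷ c2 ∷ c2 ∷ c0 ∷ c1 ∷ c1 ∷ c0 ∷ c1 ∷ c1 ∷ c0 ∷ c2 ∷ c2 ∷ c2 ∷ c2 ∷
  c0 ∷ c2 ∷ c1 ∷ c1 ∷ c0 ∷ c2 ∷ c1 ∷ c0 ∷ c2 ∷ c2 ∷ c1 ∷ c1 ∷ c0 ∷ c2 ∷ c2 ∷ c0 ∷ c2 ∷ c0 ∷ c1 ∷ c0 ∷ c2 ∷ c0 ∷ c2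
  ∷ c0 ∷ c0 ∷ c1 ∷ []) ∷ (c2 ∷ c1 ∷ c0 ∷ c2 ∷ c1 ∷ c2 ∷ c2 ∷ c2 ∷ c0 ∷ c1 ∷ c0 ∷ c2 ∷ c1 ∷ c2 ∷ c2 ∷ c2 ∷ c0 ∷ c1 ∷
  c2 ∷ c1 ∷ c0 ∷ c1 ∷ c0 ∷ c2 ∷ c2 ∷ c0 ∷ c2 ∷ c2 ∷ c2 ∷ c1 ∷ c1 ∷ c0 ∷ c1 ∷ c2 ∷ c0 ∷ c2 ∷ c1 ∷ c1 ∷ c1 ∷ c2 ∷ c2
  ∷ c2 ∷ c0 ∷ c2 ∷ c0 ∷ c1 ∷ c0 ∷ c0 ∷ []) ∷ (c2 ∷ c1 ∷ c0 ∷ c2 ∷ c1 ∷ c2 ∷ c1 ∷ c0 ∷ c2 ∷ c2 ∷ c2 ∷ c0 ∷ c1 ∷ c2 ∷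
  c2 ∷ c2 ∷ c0 ∷ c1 ∷ c2 ∷ c2 ∷ c2 ∷ c1 ∷ c0 ∷ c2 ∷ c1 ∷ c1 ∷ c0 ∷ c2 ∷ c2 ∷ c0 ∷ c1 ∷ c0 ∷ c1 ∷ c2 ∷ c0 ∷ c2 ∷ c1
  ∷ c1 ∷ c1 ∷ c2 ∷ c1 ∷ c0 ∷ c2 ∷ c0 ∷ c2 ∷ c1 ∷ c0 ∷ c1 ∷ []) ∷ []))) (radials 31)) (radials 27)))))))) (radials
  23)))) (radials 21))) (radials 18))) (radials 11))) (radials 6)) (radials 3)) (radials 0)))) (mismatch)))
  (mismatch)

pattern3 : Pattern
pattern3 = five ∷ five ∷ six ∷ six ∷ six ∷ []

-- All eight closed leaves are obstructed. In each half of the tree below the query of 57 the same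
-- three darts and the same splitting vertices serve four different maps.
cert3 : Cert Resolution
cert3 =
  query 3 (query 6 (query 9 (mismatch) (query 12 (mismatch) (query 15 (mismatch) (query 24 (query 57 (query 60
  (query 30 (query 33 (query 69 (query 39 (fold 39 (s ∷ a ∷ s ∷ a ∷ s ∷ s ∷ a ∷ s ∷ a ∷ s ∷ s ∷ a ∷ s ∷ a ∷ s ∷ s ∷
  [])) (fold 39 (s ∷ []))) (query 39 (query 42 (pattern-at 0 35) (fixed 44)) (query 75 (short 41 3) (radials 13))))
  (query 69 (query 72 (query 39 (pattern-at 0 44) (fixed 41)) (query 39 (short 41 3) (radials 14))) (query 39
  (query 42 (query 75 (query 81 (fold 81 (s ∷ [])) (radials 28)) (query 81 (opposites 26) (short 83 3))) (radials
  24)) (query 81 (query 84 (query 87 (fold 87 (s ∷ a ∷ s ∷ a ∷ [])) (pattern-at 1 84)) (query 93 (radials 14)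
  (query 96 (query 87 (fold 87 ([])) (fixed 89)) (query 87 (short 89 3) (radials 14))))) (radials 24))))) (query 63
  (query 72 (query 69 (query 33 (fold 33 (s ∷ a ∷ [])) (short 35 3)) (query 78 (pattern-at 0 44) (pattern-at 1
  72))) (query 69 (query 33 (radials 11) (query 39 (query 84 (fold 84 ([])) (fixed 86)) (radials 14))) (query 33
  (query 39 (query 87 (short 41 4) (radials 11)) (radials 27)) (query 87 (query 39 (query 75 (query 90 (fold 90 (s
  ∷ [])) (radials 32)) (pattern-at 1 89)) (query 90 (query 93 (opposites 30) (short 95 3)) (radials 14))) (radials
  11))))) (query 72 (query 69 (query 33 (query 84 (query 39 (opposites 28) (radials 27)) (radials 11)) (query 84
  (radials 26) (pattern-at 1 66))) (query 78 (query 81 (query 87 (query 93 (query 83 (closed (obstructed (0 ∷ 1 ∷ 5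
  ∷ 17 ∷ 20 ∷ 32 ∷ 35 ∷ 41 ∷ 44 ∷ 56 ∷ 74 ∷ 83 ∷ []) (2 ∷ 8 ∷ 65 ∷ []) (1 ∷ 6 ∷ 20 ∷ []))) (radials 11)) (query 96
  (opposites 30) (radials 11))) (opposites 26)) (pattern-at 1 44)) (radials 24))) (query 69 (query 33 (query 87
  (query 39 (fold 39 (s ∷ a ∷ [])) (short 41 3)) (radials 11)) (query 87 (pattern-at 0 66) (pattern-at 1 66)))
  (query 81 (query 84 (query 87 (query 33 (query 39 (fold 39 (s ∷ a ∷ s ∷ s ∷ [])) (short 41 4)) (query 90 (query
  105 (query 92 (closed (obstructed (0 ∷ 1 ∷ 5 ∷ 17 ∷ 20 ∷ 35 ∷ 41 ∷ 56 ∷ 74 ∷ 80 ∷ 86 ∷ 92 ∷ []) (2 ∷ 8 ∷ 65 ∷ [])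
  (1 ∷ 6 ∷ 20 ∷ []))) (radials 11)) (query 108 (opposites 31) (radials 11))) (opposites 32))) (pattern-at 1 83))
  (query 93 (query 102 (query 105 (query 108 (fold 108 (s ∷ a ∷ s ∷ s ∷ [])) (opposites 30)) (query 111 (radials
  29) (query 99 (query 114 (query 107 (closed (obstructed (0 ∷ 1 ∷ 5 ∷ 17 ∷ 20 ∷ 41 ∷ 56 ∷ 80 ∷ 86 ∷ 92 ∷ 95 ∷ 107
  ∷ []) (2 ∷ 8 ∷ 65 ∷ []) (1 ∷ 6 ∷ 20 ∷ []))) (radials 11)) (opposites 31)) (radials 28)))) (query 99 (query 105
  (query 117 (query 120 (fold 120 (s ∷ a ∷ s ∷ s ∷ [])) (pattern-at 1 117)) (query 123 (radials 29) (query 126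
  (query 120 (fold 120 (a ∷ s ∷ s ∷ [])) (radials 11)) (query 129 (query 119 (closed (obstructed (0 ∷ 1 ∷ 5 ∷ 17 ∷
  20 ∷ 56 ∷ 80 ∷ 92 ∷ 95 ∷ 104 ∷ 107 ∷ 119 ∷ []) (2 ∷ 8 ∷ 65 ∷ []) (1 ∷ 6 ∷ 20 ∷ []))) (radials 11)) (radials
  31))))) (radials 13)) (radials 27))) (radials 26))) (radials 24)))))) (query 30 (query 33 (query 39 (query 75
  (query 42 (fold 42 (s ∷ a ∷ [])) (short 44 3)) (query 42 (pattern-at 0 35) (pattern-at 1 35))) (query 75 (query
  78 (radials 16) (query 42 (query 84 (fold 84 ([])) (fixed 86)) (radials 16))) (query 81 (query 84 (query 78
  (short 41 4) (radials 14)) (radials 27)) (query 87 (query 90 (query 93 (query 96 (opposites 31) (radials 30))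
  (pattern-at 1 90)) (query 78 (query 99 (fold 99 (s ∷ a ∷ [])) (short 92 3)) (radials 13))) (radials 16)))))
  (query 39 (query 72 (query 81 (query 78 (query 42 (opposites 28) (radials 27)) (radials 16)) (query 78 (radials
  26) (pattern-at 1 63))) (query 42 (query 87 (query 48 (query 81 (query 83 (closed (obstructed (0 ∷ 1 ∷ 5 ∷ 20 ∷
  26 ∷ 35 ∷ 41 ∷ 44 ∷ 50 ∷ 56 ∷ 74 ∷ 83 ∷ []) (2 ∷ 8 ∷ 62 ∷ []) (1 ∷ 6 ∷ 7 ∷ 8 ∷ 22 ∷ []))) (radials 16)) (query 96
  (opposites 29) (radials 16))) (opposites 26)) (pattern-at 1 79)) (radials 25))) (query 72 (query 84 (query 78
  (query 81 (opposites 29) (short 41 3)) (radials 16)) (query 78 (pattern-at 0 85) (pattern-at 1 63))) (query 81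
  (query 90 (query 93 (query 99 (query 96 (opposites 31) (short 41 4)) (query 42 (query 102 (query 95 (closed
  (obstructed (0 ∷ 1 ∷ 5 ∷ 20 ∷ 26 ∷ 41 ∷ 44 ∷ 56 ∷ 74 ∷ 80 ∷ 86 ∷ 95 ∷ []) (2 ∷ 8 ∷ 62 ∷ []) (1 ∷ 6 ∷ 7 ∷ 8 ∷ 22 ∷
  []))) (radials 14)) (query 108 (opposites 31) (radials 14))) (opposites 30))) (pattern-at 1 90)) (query 96 (query
  42 (query 48 (query 84 (fold 84 (s ∷ a ∷ s ∷ s ∷ [])) (opposites 32)) (query 84 (radials 28) (query 102 (query
  117 (query 104 (closed (obstructed (0 ∷ 1 ∷ 5 ∷ 20 ∷ 26 ∷ 41 ∷ 56 ∷ 80 ∷ 86 ∷ 92 ∷ 95 ∷ 104 ∷ []) (2 ∷ 8 ∷ 62 ∷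
  []) (1 ∷ 6 ∷ 7 ∷ 8 ∷ 22 ∷ []))) (radials 16)) (opposites 31)) (radials 29)))) (query 102 (query 105 (query 117
  (query 120 (fold 120 (s ∷ a ∷ s ∷ s ∷ [])) (opposites 34)) (query 123 (radials 16) (query 126 (radials 42) (query
  129 (query 119 (closed (obstructed (0 ∷ 1 ∷ 5 ∷ 20 ∷ 26 ∷ 56 ∷ 80 ∷ 92 ∷ 95 ∷ 104 ∷ 107 ∷ 119 ∷ []) (2 ∷ 8 ∷ 62 ∷
  []) (1 ∷ 6 ∷ 7 ∷ 8 ∷ 22 ∷ []))) (radials 16)) (radials 14))))) (radials 31)) (radials 26))) (radials 27)))
  (radials 25))))) (opposites 1))) (opposites 7)) (radials 1))))) (mismatch)) (mismatch)

pattern4 : Pattern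
pattern4 = five ∷ five ∷ six ∷ five ∷ six ∷ []

cert4 : Cert Resolution
cert4 =
  query 3 (query 6 (query 9 (mismatch) (query 12 (query 15 (mismatch) (query 24 (query 54 (query 57 (query 30
  (query 33 (query 66 (query 39 (fold 39 (s ∷ [])) (pattern-at 2 12)) (query 39 (short 41 4) (pattern-at 0 32)))
  (query 66 (query 69 (short 35 4) (pattern-at 0 60)) (query 39 (query 72 (short 68 4) (radials 23)) (query 72
  (radials 24) (pattern-at 2 12))))) (query 60 (query 69 (query 66 (query 33 (fold 33 (s ∷ [])) (pattern-at 1 40))
  (radials 13)) (query 66 (query 33 (short 35 4) (radials 13)) (pattern-at 0 60))) (query 66 (query 33 (query 39
  (query 69 (query 71 (closed (resonant (0 ∷ 1 ∷ 5 ∷ 11 ∷ 17 ∷ 20 ∷ 32 ∷ 35 ∷ 41 ∷ 53 ∷ 62 ∷ 71 ∷ []) (2 ∷ 8 ∷ 26 ∷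
  47 ∷ []) ((c1 ∷ c2 ∷ c1 ∷ c0 ∷ c2 ∷ c0 ∷ c2 ∷ c1 ∷ c2 ∷ c2 ∷ c0 ∷ c1 ∷ c0 ∷ c2 ∷ c1 ∷ c1 ∷ c0 ∷ c0 ∷ c1 ∷ c1 ∷ c0
  ∷ c2 ∷ c0 ∷ c1 ∷ c0 ∷ c2 ∷ c0 ∷ c1 ∷ []) ∷ []))) (radials 13)) (pattern-at 1 12)) (radials 25)) (query 78
  (pattern-at 1 63) (pattern-at 2 63))) (pattern-at 0 54)))) (query 30 (query 33 (query 39 (query 72 (query 45
  (fold 45 (s ∷ [])) (pattern-at 1 12)) (radials 13)) (query 72 (query 75 (short 41 4) (radials 13)) (pattern-at 0
  32))) (query 69 (query 39 (query 45 (query 75 (query 71 (closed (resonant (0 ∷ 1 ∷ 5 ∷ 11 ∷ 20 ∷ 26 ∷ 35 ∷ 41 ∷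
  47 ∷ 53 ∷ 59 ∷ 71 ∷ []) (2 ∷ 8 ∷ 17 ∷ 32 ∷ []) ((c2 ∷ c2 ∷ c2 ∷ c2 ∷ c1 ∷ c2 ∷ c2 ∷ c1 ∷ c2 ∷ c1 ∷ c1 ∷ c0 ∷ c1 ∷
  c2 ∷ c2 ∷ c0 ∷ c1 ∷ c0 ∷ c1 ∷ c2 ∷ c1 ∷ c0 ∷ c1 ∷ c1 ∷ c0 ∷ c2 ∷ c1 ∷ c2 ∷ []) ∷ []))) (radials 13)) (query 84
  (pattern-at 1 76) (radials 13))) (pattern-at 1 12)) (query 45 (pattern-at 1 40) (pattern-at 2 12))) (pattern-at 0
  64))) (query 33 (query 39 (query 45 (query 81 (query 66 (query 60 (fold 60 (s ∷ [])) (opposites 26)) (query 87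
  (fold 87 (s ∷ a ∷ s ∷ s ∷ [])) (short 59 4))) (radials 13)) (pattern-at 1 12)) (query 45 (pattern-at 1 40)
  (pattern-at 2 12))) (query 39 (query 45 (query 84 (query 66 (query 60 (fold 60 (s ∷ a ∷ s ∷ s ∷ [])) (short 62
  4)) (query 90 (query 60 (query 62 (closed (resonant (0 ∷ 1 ∷ 5 ∷ 11 ∷ 20 ∷ 35 ∷ 41 ∷ 53 ∷ 59 ∷ 62 ∷ 74 ∷ 77 ∷ [])
  (2 ∷ 8 ∷ 17 ∷ 26 ∷ 32 ∷ 47 ∷ []) ((c0 ∷ c0 ∷ c2 ∷ c2 ∷ c2 ∷ c1 ∷ c0 ∷ c2 ∷ c0 ∷ c1 ∷ c1 ∷ c0 ∷ c1 ∷ c2 ∷ c1 ∷ c2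
  ∷ c2 ∷ c2 ∷ c2 ∷ c0 ∷ c2 ∷ c1 ∷ c0 ∷ c2 ∷ c0 ∷ c1 ∷ c0 ∷ c1 ∷ c1 ∷ c2 ∷ c0 ∷ c2 ∷ []) ∷ (c2 ∷ c2 ∷ c2 ∷ c2 ∷ c1 ∷
  c2 ∷ c2 ∷ c1 ∷ c2 ∷ c1 ∷ c1 ∷ c0 ∷ c1 ∷ c2 ∷ c2 ∷ c0 ∷ c1 ∷ c0 ∷ c1 ∷ c2 ∷ c1 ∷ c0 ∷ c1 ∷ c2 ∷ c0 ∷ c1 ∷ c0 ∷ c1
  ∷ c2 ∷ c1 ∷ c2 ∷ c1 ∷ []) ∷ (c2 ∷ c2 ∷ c1 ∷ c0 ∷ c1 ∷ c2 ∷ c2 ∷ c1 ∷ c1 ∷ c0 ∷ c2 ∷ c2 ∷ c2 ∷ c0 ∷ c2 ∷ c0 ∷ c1 ∷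
  c0 ∷ c2 ∷ c2 ∷ c2 ∷ c1 ∷ c1 ∷ c1 ∷ c1 ∷ c0 ∷ c1 ∷ c2 ∷ c0 ∷ c2 ∷ c0 ∷ c2 ∷ []) ∷ (c2 ∷ c2 ∷ c1 ∷ c0 ∷ c1 ∷ c1 ∷
  c0 ∷ c1 ∷ c2 ∷ c2 ∷ c0 ∷ c1 ∷ c0 ∷ c1 ∷ c0 ∷ c2 ∷ c2 ∷ c2 ∷ c1 ∷ c0 ∷ c2 ∷ c2 ∷ c0 ∷ c0 ∷ c1 ∷ c0 ∷ c2 ∷ c0 ∷ c1
  ∷ c2 ∷ c0 ∷ c2 ∷ []) ∷ []))) (pattern-at 1 54)) (query 96 (pattern-at 1 61) (radials 20))) (opposites 27)))
  (radials 13)) (pattern-at 1 12)) (query 45 (pattern-at 1 40) (pattern-at 2 12)))))) (opposites 7)) (radials 1)))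
  (mismatch))) (mismatch)) (mismatch)

pattern5 : Pattern
pattern5 = five ∷ five ∷ five ∷ six ∷ six ∷ []

-- In both closed leaves two disjoint hexagons are already an obstruction.
cert5 : Cert Resolution
cert5 =
  query 3 (query 6 (query 9 (query 12 (mismatch) (query 15 (mismatch) (query 18 (query 24 (query 30 (query 36
  (query 63 (query 39 (fold 39 (s ∷ a ∷ [])) (short 41 3)) (query 39 (pattern-at 0 33) (pattern-at 1 33))) (query
  63 (query 66 (query 39 (pattern-at 0 65) (fixed 41)) (query 39 (query 72 (pattern-at 1 71) (fixed 74)) (query 72
  (pattern-at 4 72) (short 74 2)))) (query 69 (pattern-at 0 55) (pattern-at 1 55)))) (query 36 (pattern-at 0 9)
  (pattern-at 1 9))) (pattern-at 0 22)) (query 24 (query 30 (query 36 (query 66 (query 39 (query 45 (pattern-at 0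
  38) (fixed 47)) (query 45 (query 72 (pattern-at 1 71) (fixed 74)) (query 72 (pattern-at 4 72) (short 74 2))))
  (query 39 (pattern-at 0 33) (pattern-at 1 33))) (query 66 (query 69 (pattern-at 0 63) (pattern-at 1 63)) (query
  39 (query 78 (query 45 (query 51 (query 72 (query 68 (closed (obstructed (0 ∷ 1 ∷ 5 ∷ 8 ∷ 20 ∷ 26 ∷ 38 ∷ 41 ∷ 47
  ∷ 53 ∷ 68 ∷ 77 ∷ []) (17 ∷ 32 ∷ []) (20 ∷ 7 ∷ 0 ∷ 1 ∷ 3 ∷ 9 ∷ []))) (opposites 29)) (opposites 26)) (pattern-at 1
  41)) (query 81 (pattern-at 1 71) (pattern-at 3 76))) (radials 13)) (query 78 (query 84 (query 87 (pattern-at 1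
  74) (pattern-at 3 84)) (query 81 (query 45 (query 51 (pattern-at 1 83) (pattern-at 3 83)) (query 87 (query 105
  (query 108 (pattern-at 1 53) (pattern-at 3 105)) (query 111 (query 108 (pattern-at 3 104) (short 89 4)) (query 96
  (query 114 (query 107 (closed (obstructed (0 ∷ 1 ∷ 5 ∷ 8 ∷ 20 ∷ 26 ∷ 77 ∷ 80 ∷ 86 ∷ 89 ∷ 98 ∷ 107 ∷ []) (17 ∷ 32
  ∷ []) (20 ∷ 7 ∷ 0 ∷ 1 ∷ 3 ∷ 9 ∷ []))) (radials 17)) (radials 15)) (radials 26)))) (radials 24))) (radials 13)))
  (radials 23))))) (opposites 1)) (pattern-at 1 22))))) (mismatch)) (mismatch)) (mismatch)

pattern6 : Pattern
pattern6 = five ∷ five ∷ five ∷ five ∷ six ∷ []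

cert6 : Cert Resolution
cert6 =
  query 3 (query 6 (query 9 (query 12 (query 15 (mismatch) (query 18 (query 24 (query 30 (query 36 (query 60 (query
  42 (fold 42 (s ∷ [])) (pattern-at 0 12)) (query 42 (short 44 4) (pattern-at 0 12))) (query 60 (query 63 (short 38
  4) (pattern-at 0 49)) (pattern-at 0 30))) (query 36 (query 42 (query 57 (query 69 (query 59 (closed (resonant (0
  ∷ 1 ∷ 5 ∷ 8 ∷ 11 ∷ 17 ∷ 20 ∷ 32 ∷ 38 ∷ 44 ∷ 50 ∷ 59 ∷ []) (2 ∷ 26 ∷ []) ((c1 ∷ c1 ∷ c0 ∷ c2 ∷ c2 ∷ c0 ∷ c1 ∷ c0 ∷
  c1 ∷ c0 ∷ c2 ∷ c1 ∷ c2 ∷ c1 ∷ c1 ∷ c0 ∷ c1 ∷ c0 ∷ c2 ∷ c0 ∷ c1 ∷ c1 ∷ c2 ∷ c2 ∷ []) ∷ []))) (pattern-at 1 39))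
  (pattern-at 0 49)) (pattern-at 0 24)) (pattern-at 0 12)) (pattern-at 0 34))) (pattern-at 1 22)) (query 24
  (pattern-at 0 19) (pattern-at 2 22)))) (mismatch)) (mismatch)) (mismatch)) (mismatch)

pattern7 : Pattern
pattern7 = five ∷ five ∷ five ∷ five ∷ five ∷ []

-- The only closed leaf is the dodecahedron. It has no hexagons, and its one matching is there for
-- the empty pattern.
cert7 : Cert Resolution
cert7 =
  query 3 (query 6 (query 9 (query 12 (query 15 (query 18 (query 24 (query 30 (query 36 (query 45 (query 47 (closed
  (resonant (0 ∷ 1 ∷ 2 ∷ 5 ∷ 8 ∷ 11 ∷ 17 ∷ 20 ∷ 26 ∷ 32 ∷ 38 ∷ 47 ∷ []) ([]) ((c0 ∷ c0 ∷ c1 ∷ c0 ∷ c2 ∷ c1 ∷ c0 ∷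
  c2 ∷ c0 ∷ c2 ∷ c0 ∷ c2 ∷ c0 ∷ c1 ∷ c2 ∷ c0 ∷ c2 ∷ c0 ∷ c2 ∷ c0 ∷ []) ∷ []))) (pattern-at 0 45)) (pattern-at 0
  40)) (pattern-at 0 34)) (pattern-at 0 28)) (pattern-at 0 22)) (query 24 (pattern-at 0 19) (pattern-at 1 22)))
  (mismatch)) (mismatch)) (mismatch)) (mismatch)) (mismatch)

start : Table
start = addFace five (0 , c0) (blank ∷ [])

-- The patterns of face sizes around a pentagon, up to rotation; each stage may assume the earlier ones absent.
stages : List (Pattern × Cert Resolution)
stages = (pattern0 , cert0) ∷ (pattern1 , cert1) ∷ (pattern2 , cert2) ∷ (pattern3 , cert3)
  ∷ (pattern4 , cert4) ∷ (pattern5 , cert5) ∷ (pattern6 , cert6) ∷ (pattern7 , cert7) ∷ []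

checkStages : List Pattern → List (Pattern × Cert Resolution) → Bool
checkStages ps [] = true
checkStages ps ((p , c) ∷ st) = Explore.explore resolve p ps start c ∧ checkStages (p ∷ ps) st

stages-checked : checkStages [] stages ≡ true
stages-checked = refl

patternsOf : List Pattern → List (Pattern × Cert Resolution) → List Pattern
patternsOf ps [] = ps
patternsOf ps ((p , _) ∷ st) = patternsOf (p ∷ ps) st

samePattern : Pattern → Pattern → Bool
samePattern [] [] = true
samePattern (five ∷ p) (five ∷ q) = samePattern p q
samePattern (six ∷ p) (six ∷ q) = samePattern p q
samePattern _ _ = false

listed : Pattern → List Pattern → Bool
listed p [] = false
listed p (q ∷ qs) = samePattern p q ∨ listed p qs

rotate : Pattern → Pattern
rotate [] = []
rotate (f ∷ p) = p ++ f ∷ []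

rotationListed : ℕ → Pattern → List Pattern → Bool
rotationListed zero p qs = false
rotationListed (suc n) p qs = listed p qs ∨ rotationListed n (rotate p) qs

patterns : ℕ → List Pattern
patterns zero = [] ∷ []
patterns (suc n) = map (five ∷_) (patterns n) ++ map (six ∷_) (patterns n)

-- The 32 sequences of length five form eight classes under rotation, one for each stage.
patterns-listed : allᵇ (λ p → rotationListed 5 p (patternsOf [] stages)) (patterns 5) ≡ true
patterns-listed = refl

samePattern-sound : ∀ p q → samePattern p q ≡ true → p ≡ q
samePattern-sound [] [] _ = refl
samePattern-sound (five ∷ p) (five ∷ q) e = cong (five ∷_) (samePattern-sound p q e)
samePattern-sound (six ∷ p) (six ∷ q) e = cong (six ∷_) (samePattern-sound p q e)

module Classification (F : Fullerene) (res₃ : Resonant F 3) where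
  open Fullerene F
  open Geometry F
  open Tables F
  open ExploreSound F

  faceIs? : ∀ f x → Dec (FaceIs f x)
  faceIs? unknown x = yes tt
  faceIs? five x = iter φ 5 x Data.Fin.≟ x
  faceIs? six x = iter φ 6 x Data.Fin.≟ x

  surrounded? : ∀ p x → Dec (Surrounded p x)
  surrounded? [] x = yes tt
  surrounded? (f ∷ p) x = faceIs? f (α x) ×-dec surrounded? p (φ x)

  blank-valid : ∀ x → Valid (blank ∷ []) (λ _ → x)
  blank-valid x .links (zero , c0) = tt
  blank-valid x .links (zero , c1) = tt
  blank-valid x .links (zero , c2) = tt
  blank-valid x .links (suc v , c0) = tt
  blank-valid x .links (suc v , c1) = tt
  blank-valid x .links (suc v , c2) = tt
  blank-valid x .faces (zero , c0) = tt
  blank-valid x .faces (zero , c1) = tt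
  blank-valid x .faces (zero , c2) = tt
  blank-valid x .faces (suc v , c0) = tt
  blank-valid x .faces (suc v , c1) = tt
  blank-valid x .faces (suc v , c2) = tt

  occurs-resonant : ∀ p c ps → All Absent ps → Explore.explore resolve p ps start c ≡ true →
    ∀ x → Closes 5 x → Surrounded p x → ∀ k → Resonant F k
  occurs-resonant p c ps absent e x c₅ sur with addFace-valid five (0 , c0) (blank ∷ []) (λ _ → x) (λ ())
      (blank-valid x) (s≤s z≤n) c₅
  ... | h , V , ext = explore-sound res₃ resolve (λ r {T} {h} → Resolved.resolve-sound F res₃ T h r) p ps absent c V
    (subst (Surrounded p) (sym (⊑-name {blank ∷ []} {λ _ → x} {start} {h} ext (0 , c0) (s≤s z≤n))) sur) (s≤s z≤n) e

  -- With finitely many darts it is decidable whether a pattern occurs. The first one that does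
  -- settles resonance, the earlier ones being absent as its tree assumes.
  resonant-or-absent : ∀ ps st → All Absent ps → checkStages ps st ≡ true →
    (∀ k → Resonant F k) ⊎ All Absent (patternsOf ps st)
  resonant-or-absent ps [] absent e = inj₂ absent
  resonant-or-absent ps ((p , c) ∷ st) absent e
    with any? (λ x → (iter φ 5 x Data.Fin.≟ x) ×-dec surrounded? p x) | ∧-elim {Explore.explore resolve p ps start c}
        e
  ... | yes (x , c₅ , sur) | e₁ , _ = inj₁ (occurs-resonant p c ps absent e₁ x c₅ sur)
  ... | no nowhere | _ , e₂ = resonant-or-absent (p ∷ ps) st ((λ x c₅ sur → nowhere (x , c₅ , sur)) ∷ absent) e₂

  surroundings : ∀ n x → ∃ λ p → p ∈ patterns n × length p ≡ n × Surrounded p x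
  surroundings zero x = [] , here refl , refl , tt
  surroundings (suc n) x with closes-5⊎6 (α x) | surroundings n (φ x)
  ... | inj₁ c | p , p∈ , len , sur = five ∷ p , ∈-++⁺ˡ (∈-map⁺ (five ∷_) p∈) , cong suc len , c , sur
  ... | inj₂ c | p , p∈ , len , sur = six ∷ p , ∈-++⁺ʳ (map (five ∷_) (patterns n)) (∈-map⁺ (six ∷_) p∈) , cong suc
      len , c , sur

  surrounded-snoc : ∀ p f x → Surrounded p x → FaceIs f (α (iter φ (length p) x)) → Surrounded (p ++ f ∷ []) x
  surrounded-snoc [] f x _ q = q , tt
  surrounded-snoc (g ∷ p) f x (m , ms) q = m , surrounded-snoc p f (φ x) ms
      (subst (λ y → FaceIs f (α y)) (sym (iter-φ (length p) x)) q)

  -- Starting from the next side of the pentagon rotates the pattern by one, so a single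
  -- representative of each class suffices.
  rotate-surrounded : ∀ p {x} → length p ≡ 5 → Closes 5 x → Surrounded p x → Surrounded (rotate p) (φ x) × length
      (rotate p) ≡ 5
  rotate-surrounded (f ∷ p) {x} len c (m , ms) =
    surrounded-snoc p f (φ x) ms (subst (λ y → FaceIs f (α y))
      (trans (sym c) (trans (sym (iter-φ 4 x)) (cong (λ n → iter φ n (φ x)) (sym (suc-injective len))))) m) ,
    trans (length-++ p) (trans (+-comm (length p) 1) len)

  absent-unlisted : ∀ p {qs} {x} → All Absent qs → Closes 5 x → Surrounded p x → listed p qs ≢ true
  absent-unlisted p {q ∷ qs} {x} (ab ∷ abs) c sur e with ∨-elim {samePattern p q} e
  ... | inj₁ e₁ with samePattern-sound p q e₁
  ...   | refl = ab x c sur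
  absent-unlisted p (ab ∷ abs) c sur e | inj₂ e₂ = absent-unlisted p abs c sur e₂

  absent-unrotated : ∀ n p {qs} {x} → All Absent qs → length p ≡ 5 → Closes 5 x → Surrounded p x → rotationListed n p
      qs ≢ true
  absent-unrotated (suc n) p {qs} {x} abs len c sur e with ∨-elim {listed p qs} e
  ... | inj₁ e₁ = absent-unlisted p abs c sur e₁
  ... | inj₂ e₂ with rotate-surrounded p len c sur
  ...   | sur′ , len′ = absent-unrotated n (rotate p) abs len′ (trans (iter-φ 5 x) (cong φ c)) sur′ e₂

  -- Were all eight patterns absent, the surroundings of an existing pentagon would contradict
  -- `patterns-listed`.
  resonant-for-all : ∀ k → Resonant F k
  resonant-for-all with resonant-or-absent [] stages [] stages-checked | pentagon-exists
  ... | inj₁ r | _ = r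
  ... | inj₂ abs | x , c with surroundings 5 x
  ...   | p , p∈ , len , sur = ⊥-elim (absent-unrotated 5 p abs len c sur
    (All.lookup (allᵇ-sound (λ p → rotationListed 5 p (patternsOf [] stages)) (patterns 5) patterns-listed) p∈))

theorem5p8 : (F : Fullerene) →
    (Resonant F 3 → ∀ k → 3 ≤ k → Resonant F k) × ((∀ k → 3 ≤ k → Resonant F k) → Resonant F 3)
theorem5p8 F = (λ res₃ k _ → Classification.resonant-for-all F res₃ k) , (λ res → res 3 (s≤s (s≤s (s≤s z≤n))))
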